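{- Let $n>m\ge 1$ and $s\ge 1$ be integers and let $A\in\mathbb Z^{m\times n}$ be a matrix such that (i) the greatest common divisor of all $m\times m$ minors of $A$ is $1$, and (ii) $\{\boldsymbol x\in\mathbb R^n_{\ge 0}:A\boldsymbol x=\boldsymbol 0\}=\{\boldsymbol 0\}$. Let $m(A)$ and $M(A)$ denote the minimum and the maximum, respectively, of the absolute values of the $m\times m$ minors of $A$. Then $$\mathrm g_s(A)\ \ge\ \frac{1}{n-m+1}\left(s^{\frac1{n-m}}\left(\sqrt{\det(AA^\intercal)}\right)^{\frac1{n-m}}\left(\frac{m(A)}{M(A)}\right)^2\sqrt{\frac{n-m}{n}}-(n-m)-2\,\frac{m(A)}{M(A)}\right).$$
   Context: For $\boldsymbol b\in\mathbb Z^m$ let $P(A,\boldsymbol b)=\{\boldsymbol x\in\mathbb R^n_{\ge 0}:A\boldsymbol x=\boldsymbol b\}$, and let $\mathcal F_s(A)=\{\boldsymbol b\in\mathbb Z^m:\#(P(A,\boldsymbol b)\cap\mathbb Z^n)\ge s\}$. Let $C\subset\mathbb R^m$ be the convex cone generated by the columns of $A$ and $\boldsymbol v=A\boldsymbol 1$, where $\boldsymbol 1\in\mathbb Z^n$ is the all-ones vector. The diagonal $s$-Frobenius number of $A$ is $$\mathrm g_s(A)=\min\{t\in\mathbb R_{\ge 0}:\ \mathrm{int}(t\boldsymbol v+C)\cap\mathbb Z^m\subseteq\mathcal F_s(A)\}.$$ -}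

module Defs where

open import Data.Fin using (Fin; zero; suc; toℕ; punchIn)
open import Data.Integer as ℤ using (ℤ; +_; -[1+_])
import Data.Integer.Properties as ℤ
open import Data.List using (List; []; _∷_; map; _++_; foldr)
open import Data.List.Extrema.Nat using (max; min; xs≤max)
open import Data.List.Relation.Unary.All using (All; []; _∷_)
open import Data.Nat as ℕ using (ℕ; zero; suc)
open import Data.Nat.Coprimality using (1-coprimeTo)
import Data.Nat.Coprimality as Coprime
open import Data.Nat.GCD using (gcd)
import Data.Nat.Properties as ℕ
open import Data.Product using (∃; _×_; _,_; proj₁; proj₂)
open import Data.Rational as ℚ using (ℚ; mkℚ; 0ℚ; 1ℚ; ½; ∣_∣)
import Data.Rational.Properties as ℚ
open import Data.Rational.Solver using (module +-*-Solver)
open import Data.Sum using (inj₁; inj₂)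
open import Data.Vec using (Vec; []; _∷_; lookup)
import Data.Vec as Vec
open import Data.Vec.Functional using (Vector)
import Data.Vec.Functional as Vector
open import Function using (_∘_)
open import Function.Definitions using (Injective)
open import Level using (0ℓ)
open import Relation.Binary.PropositionalEquality using (_≡_; refl; sym; trans; cong; cong₂; subst; _≗_)
open import Relation.Nullary using (¬_; Dec; yes; no; contradiction)
open import Relation.Unary using (Pred; _∈_; _⊆_)

module Rational where

  open import Data.Rational using (_≤_; _<_; _+_; _*_; _-_; -_; 1/_; *≤*; *<*; positive; nonNegative)
  open ℚ.≤-Reasoning
  open +-*-Solver using (solve; _:+_; _:*_; _:-_; :-_; _:=_; con)

  infixr 8 _^_

  _^_ : ℚ → ℕ → ℚ
  x ^ zero  = 1ℚ
  x ^ suc k = x * x ^ k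

  fromℕ : ℕ → ℚ
  fromℕ n = mkℚ (+ n) 0 (Coprime.sym (1-coprimeTo n))

  unitFraction : ℕ → ℚ
  unitFraction i = 1/ fromℕ (suc i)

  0≤1 : 0ℚ ≤ 1ℚ
  0≤1 = ℚ.nonNegative⁻¹ 1ℚ

  *-mono : ∀ {a b c d} → 0ℚ ≤ a → 0ℚ ≤ d → a ≤ b → c ≤ d → a * c ≤ b * d
  *-mono {a} {b} {c} {d} 0≤a 0≤d a≤b c≤d = ℚ.≤-trans
    (ℚ.*-monoˡ-≤-nonNeg a {{nonNegative 0≤a}} c≤d)
    (ℚ.*-monoʳ-≤-nonNeg d {{nonNegative 0≤d}} a≤b)

  0≤* : ∀ {a b} → 0ℚ ≤ a → 0ℚ ≤ b → 0ℚ ≤ a * b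
  0≤* {a} {b} 0≤a 0≤b = ℚ.nonNegative⁻¹ (a * b)
    {{ℚ.nonNeg*nonNeg⇒nonNeg a {{nonNegative 0≤a}} b {{nonNegative 0≤b}}}}

  0<* : ∀ {a b} → 0ℚ < a → 0ℚ < b → 0ℚ < a * b
  0<* {a} {b} 0<a 0<b = ℚ.positive⁻¹ (a * b)
    {{ℚ.pos*pos⇒pos a {{positive 0<a}} b {{positive 0<b}}}}

  0≤+ : ∀ {a b} → 0ℚ ≤ a → 0ℚ ≤ b → 0ℚ ≤ a + b
  0≤+ = ℚ.+-mono-≤

  x≤x+y : ∀ x {y} → 0ℚ ≤ y → x ≤ x + y
  x≤x+y x {y} 0≤y = subst (_≤ x + y) (ℚ.+-identityʳ x) (ℚ.+-monoʳ-≤ x 0≤y)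

  0≤^ : ∀ {x} k → 0ℚ ≤ x → 0ℚ ≤ x ^ k
  0≤^ zero    0≤x = 0≤1
  0≤^ (suc k) 0≤x = 0≤* 0≤x (0≤^ k 0≤x)

  0<^ : ∀ {x} k → 0ℚ < x → 0ℚ < x ^ k
  0<^ zero    0<x = ℚ.positive⁻¹ 1ℚ
  0<^ (suc k) 0<x = 0<* 0<x (0<^ k 0<x)

  ^-mono : ∀ {x y} k → 0ℚ ≤ x → x ≤ y → x ^ k ≤ y ^ k
  ^-mono zero    0≤x x≤y = ℚ.≤-refl
  ^-mono (suc k) 0≤x x≤y =
    *-mono 0≤x (0≤^ k (ℚ.≤-trans 0≤x x≤y)) x≤y (^-mono k 0≤x x≤y)

  ^-cancel-< : ∀ {x y} k → 0ℚ ≤ y → x ^ k < y ^ k → x < y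
  ^-cancel-< {x} {y} k 0≤y x^k<y^k with ℚ._<?_ x y
  ... | yes x<y = x<y
  ... | no  x≮y = contradiction
    (ℚ.<-≤-trans x^k<y^k (^-mono k 0≤y (ℚ.≮⇒≥ x≮y))) (ℚ.<-irrefl refl)

  ^-superadditive : ∀ {x y} k → 0ℚ ≤ x → 0ℚ ≤ y → x ^ suc k + y ^ suc k ≤ (x + y) ^ suc k
  ^-superadditive {x} {y} k 0≤x 0≤y = begin
    x * x ^ k + y * y ^ k              ≤⟨ ℚ.+-mono-≤
      (ℚ.*-monoˡ-≤-nonNeg x {{nonNegative 0≤x}} (^-mono k 0≤x (x≤x+y x 0≤y)))
      (ℚ.*-monoˡ-≤-nonNeg y {{nonNegative 0≤y}}
        (^-mono k 0≤y (subst (y ≤_) (ℚ.+-comm y x) (x≤x+y y 0≤x)))) ⟩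
    x * (x + y) ^ k + y * (x + y) ^ k  ≡⟨ ℚ.*-distribʳ-+ ((x + y) ^ k) x y ⟨
    (x + y) * (x + y) ^ k              ∎

  1≤^ : ∀ {x} k → 1ℚ ≤ x → 1ℚ ≤ x ^ k
  1≤^ zero    1≤x = ℚ.≤-refl
  1≤^ (suc k) 1≤x = *-mono 0≤1 (ℚ.≤-trans 0≤1 (1≤^ k 1≤x)) 1≤x (1≤^ k 1≤x)

  x≤x^[1+k] : ∀ {x} k → 1ℚ ≤ x → x ≤ x ^ suc k
  x≤x^[1+k] {x} k 1≤x = subst (_≤ x * x ^ k) (ℚ.*-identityʳ x)
    (ℚ.*-monoˡ-≤-nonNeg x {{nonNegative (ℚ.≤-trans 0≤1 1≤x)}} (1≤^ k 1≤x))

  fromℕ-suc : ∀ n → fromℕ (suc n) ≡ 1ℚ + fromℕ n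
  fromℕ-suc n = sym (trans
    (ℚ./-cong {p₁ = + 1 ℤ.* + 1 ℤ.+ + n ℤ.* + 1} {p₂ = + suc n}
      (cong (λ z → + 1 ℤ.+ z) (ℤ.*-identityʳ (+ n))) refl)
    (ℚ.↥p/↧p≡p (fromℕ (suc n))))

  archimedean : ∀ q → ∃ λ n → q ≤ fromℕ n
  archimedean q@(mkℚ (+ a) d _) = a , *≤* (ℤ.*-monoˡ-≤-nonNeg (+ a) (ℤ.+≤+ (ℕ.s≤s ℕ.z≤n)))
  archimedean q@(mkℚ -[1+ a ] d _) = 0 , *≤* ℤ.-≤+

  unitFraction-small : ∀ ε → 0ℚ < ε → ∃ λ N → ∀ i → N ℕ.≤ i → unitFraction i ≤ ε
  unitFraction-small (mkℚ (+ suc a) d _) _ = d , λ i d≤i →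
    *≤* (ℤ.+≤+ (ℕ.*-mono-≤ {1} {suc a} (ℕ.s≤s ℕ.z≤n) (ℕ.s≤s d≤i)))
  unitFraction-small (mkℚ (+ zero)  d _) (*<* (ℤ.+<+ ()))
  unitFraction-small (mkℚ -[1+ a ] d _) (*<* ())

  0<½* : ∀ {ε} → 0ℚ < ε → 0ℚ < ½ * ε
  0<½* = 0<* (ℚ.positive⁻¹ ½)

  ½*+½* : ∀ ε → ½ * ε + ½ * ε ≡ ε
  ½*+½* ε = trans (sym (ℚ.*-distribʳ-+ ε ½ ½)) (ℚ.*-identityˡ ε)

  ∣-∣≤⇒≤+ : ∀ {x y ε} → ∣ x - y ∣ ≤ ε → x ≤ y + ε
  ∣-∣≤⇒≤+ {x} {y} {ε} p = begin
    x            ≡⟨ solve 2 (λ x y → x := y :+ (x :- y)) refl x y ⟩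
    y + (x - y)  ≤⟨ ℚ.+-monoʳ-≤ y (ℚ.≤-trans (≤∣∣ (x - y)) p) ⟩
    y + ε        ∎
    where
    ≤∣∣ : ∀ z → z ≤ ∣ z ∣
    ≤∣∣ z with ℚ.≤-total 0ℚ z
    ... | inj₁ 0≤z = ℚ.≤-reflexive (sym (ℚ.0≤p⇒∣p∣≡p 0≤z))
    ... | inj₂ z≤0 = ℚ.≤-trans z≤0 (ℚ.0≤∣p∣ z)

  ≤+⇒∣-∣≤ : ∀ {x y ε} → x ≤ y + ε → y ≤ x + ε → ∣ x - y ∣ ≤ ε
  ≤+⇒∣-∣≤ {x} {y} {ε} p q with ℚ.∣p∣≡p∨∣p∣≡-p (x - y)
  ... | inj₁ eq = begin
    ∣ x - y ∣      ≡⟨ eq ⟩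
    x - y          ≤⟨ ℚ.+-monoˡ-≤ (- y) p ⟩
    y + ε - y      ≡⟨ solve 2 (λ y ε → y :+ ε :- y := ε) refl y ε ⟩
    ε              ∎
  ... | inj₂ eq = begin
    ∣ x - y ∣      ≡⟨ eq ⟩
    - (x - y)      ≡⟨ solve 2 (λ x y → :- (x :- y) := y :- x) refl x y ⟩
    y - x          ≤⟨ ℚ.+-monoˡ-≤ (- x) q ⟩
    x + ε - x      ≡⟨ solve 2 (λ x ε → x :+ ε :- x := ε) refl x ε ⟩
    ε              ∎

  divide : ∀ B ε → 0ℚ < B → 0ℚ < ε → ∃ λ δ → 0ℚ < δ × B * δ ≡ ε
  divide B ε 0<B 0<ε = r * ε , 0<* 0<r 0<ε ,
    trans (sym (ℚ.*-assoc B r ε))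
      (trans (cong (_* ε) (ℚ.*-inverseʳ B {{nz}})) (ℚ.*-identityˡ ε))
    where
    nz = ℚ.>-nonZero 0<B
    r = (1/ B) {{nz}}
    0<r : 0ℚ < r
    0<r = ℚ.positive⁻¹ r {{ℚ.1/pos⇒pos B {{positive 0<B}}}}

  ∣ab-a′b′∣≤ : ∀ a a′ b b′ B C δ → 0ℚ ≤ δ → ∣ a ∣ ≤ B → ∣ b′ ∣ ≤ C →
               ∣ a - a′ ∣ ≤ δ → ∣ b - b′ ∣ ≤ δ → ∣ a * b - a′ * b′ ∣ ≤ (B + C) * δ
  ∣ab-a′b′∣≤ a a′ b b′ B C δ 0≤δ a≤B b′≤C a-a′≤δ b-b′≤δ = begin
    ∣ a * b - a′ * b′ ∣
      ≡⟨ cong ∣_∣ (solve 4 (λ a a′ b b′ →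
           a :* b :- a′ :* b′ := a :* (b :- b′) :+ b′ :* (a :- a′)) refl a a′ b b′) ⟩
    ∣ a * (b - b′) + b′ * (a - a′) ∣
      ≤⟨ ℚ.∣p+q∣≤∣p∣+∣q∣ (a * (b - b′)) (b′ * (a - a′)) ⟩
    ∣ a * (b - b′) ∣ + ∣ b′ * (a - a′) ∣
      ≡⟨ cong₂ _+_ (ℚ.∣p*q∣≡∣p∣*∣q∣ a (b - b′)) (ℚ.∣p*q∣≡∣p∣*∣q∣ b′ (a - a′)) ⟩
    ∣ a ∣ * ∣ b - b′ ∣ + ∣ b′ ∣ * ∣ a - a′ ∣
      ≤⟨ ℚ.+-mono-≤ (*-mono (ℚ.0≤∣p∣ a) 0≤δ a≤B b-b′≤δ) (*-mono (ℚ.0≤∣p∣ b′) 0≤δ b′≤C a-a′≤δ) ⟩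
    B * δ + C * δ
      ≡⟨ ℚ.*-distribʳ-+ δ B C ⟨
    (B + C) * δ  ∎

  lastTrue : ∀ {P : Pred ℕ 0ℓ} → (∀ p → Dec (P p)) → P 0 → ∀ n → ¬ P n →
             ∃ λ p → P p × ¬ P (suc p)
  lastTrue P? P0 zero    ¬P0 = contradiction P0 ¬P0
  lastTrue P? P0 (suc n) ¬Pn with P? n
  ... | yes Pn = n , Pn , ¬Pn
  ... | no ¬Pn′ = lastTrue P? P0 n ¬Pn′

  -- r is a (k+1)-st root of y rounded down to a multiple of 1 / (i + 1).
  record IsApproxRoot (k i : ℕ) (y r : ℚ) : Set where
    field
      nonNeg : 0ℚ ≤ r
      lower  : r ^ suc k ≤ y
      upper  : y < (r + unitFraction i) ^ suc k

  approxRoot : ∀ k i y → 0ℚ ≤ y → ∃ (IsApproxRoot k i y)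
  approxRoot k i y 0≤y = fromℕ p * δ , record
    { nonNeg = 0≤* (ℚ.nonNegative⁻¹ (fromℕ p)) 0≤δ
    ; lower  = proj₁ (proj₂ found)
    ; upper  = subst (λ r → y < r ^ suc k) next (ℚ.≰⇒> (proj₂ (proj₂ found)))
    }
    where
    δ = unitFraction i
    0≤δ : 0ℚ ≤ δ
    0≤δ = ℚ.nonNegative⁻¹ δ
    P : Pred ℕ 0ℓ
    P p = (fromℕ p * δ) ^ suc k ≤ y
    bound = archimedean ((1ℚ + y) * fromℕ (suc i))
    1+y≤ : 1ℚ + y ≤ fromℕ (proj₁ bound) * δ
    1+y≤ = begin
      1ℚ + y                               ≡⟨ ℚ.*-identityʳ (1ℚ + y) ⟨
      (1ℚ + y) * 1ℚ                        ≡⟨ cong ((1ℚ + y) *_) (ℚ.*-inverseʳ (fromℕ (suc i))) ⟨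
      (1ℚ + y) * (fromℕ (suc i) * δ)       ≡⟨ ℚ.*-assoc (1ℚ + y) (fromℕ (suc i)) δ ⟨
      (1ℚ + y) * fromℕ (suc i) * δ         ≤⟨ ℚ.*-monoʳ-≤-nonNeg δ (proj₂ bound) ⟩
      fromℕ (proj₁ bound) * δ              ∎
    y<1+y : y < 1ℚ + y
    y<1+y = subst (_< 1ℚ + y) (ℚ.+-identityˡ y) (ℚ.+-monoˡ-< y (ℚ.positive⁻¹ 1ℚ))
    1≤1+y : 1ℚ ≤ 1ℚ + y
    1≤1+y = x≤x+y 1ℚ 0≤y
    ¬Pbound : ¬ P (proj₁ bound)
    ¬Pbound Pb = ℚ.<-irrefl refl (begin-strict
      y                                    <⟨ y<1+y ⟩
      1ℚ + y                               ≤⟨ 1+y≤ ⟩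
      fromℕ (proj₁ bound) * δ              ≤⟨ x≤x^[1+k] k (ℚ.≤-trans 1≤1+y 1+y≤) ⟩
      (fromℕ (proj₁ bound) * δ) ^ suc k    ≤⟨ Pb ⟩
      y                                    ∎)
    P0 : P 0
    P0 = subst (_≤ y)
      (sym (trans (cong (_* (fromℕ 0 * δ) ^ k) (ℚ.*-zeroˡ δ)) (ℚ.*-zeroˡ ((fromℕ 0 * δ) ^ k)))) 0≤y
    found = lastTrue {P} (λ p → ℚ._≤?_ _ y) P0 (proj₁ bound) ¬Pbound
    p = proj₁ found
    next : fromℕ (suc p) * δ ≡ fromℕ p * δ + δ
    next = trans (cong (_* δ) (fromℕ-suc p))
      (solve 2 (λ n d → (con 1ℚ :+ n) :* d := n :* d :+ d) refl (fromℕ p) δ)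

  approxRoot-close : ∀ {k i j y y′ r r′ η} →
    IsApproxRoot k i y r → IsApproxRoot k j y′ r′ →
    0ℚ ≤ η → y ≤ y′ + η ^ suc k → unitFraction j ≤ η → r ≤ r′ + (η + η)
  approxRoot-close {k} {i} {j} {y} {y′} {r} {r′} {η} R R′ 0≤η y≤ δ≤η = ℚ.≤-trans
    (ℚ.<⇒≤ (^-cancel-< (suc k) (0≤+ 0≤r′+δ 0≤η) (begin-strict
      r ^ suc k                          ≤⟨ lower R ⟩
      y                                  ≤⟨ y≤ ⟩
      y′ + η ^ suc k                     <⟨ ℚ.+-monoˡ-< (η ^ suc k) (upper R′) ⟩
      (r′ + δ) ^ suc k + η ^ suc k       ≤⟨ ^-superadditive k 0≤r′+δ 0≤η ⟩
      (r′ + δ + η) ^ suc k               ∎)))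
    (begin
      r′ + δ + η      ≡⟨ ℚ.+-assoc r′ δ η ⟩
      r′ + (δ + η)    ≤⟨ ℚ.+-monoʳ-≤ r′ (ℚ.+-monoˡ-≤ η δ≤η) ⟩
      r′ + (η + η)    ∎)
    where
    open IsApproxRoot
    δ = unitFraction j
    0≤r′+δ : 0ℚ ≤ r′ + δ
    0≤r′+δ = 0≤+ (nonNeg R′) (ℚ.nonNegative⁻¹ δ)

  ⊔0-close : ∀ a b {e} → 0ℚ ≤ e → ∣ a - b ∣ ≤ e → a ℚ.⊔ 0ℚ ≤ b ℚ.⊔ 0ℚ + e
  ⊔0-close a b {e} 0≤e a-b≤e = ℚ.⊔-lub
    (ℚ.≤-trans (∣-∣≤⇒≤+ {a} {b} a-b≤e) (ℚ.+-monoˡ-≤ e (ℚ.p≤p⊔q b 0ℚ)))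
    (0≤+ (ℚ.p≤q⊔p b 0ℚ) 0≤e)

-- Real numbers: Cauchy sequences of rationals, up to _≃_
module Real where

  open Rational

  IsCauchy : (ℕ → ℚ) → Set
  IsCauchy x = ∀ ε → 0ℚ ℚ.< ε → ∃ λ N → ∀ i j → N ℕ.≤ i → N ℕ.≤ j → ∣ x i ℚ.- x j ∣ ℚ.≤ ε

  record ℝ : Set where
    constructor mkℝ
    field
      seq    : ℕ → ℚ
      cauchy : IsCauchy seq

  open ℝ public

  infix  4 _≤_ _<_ _≃_
  infixl 6 _+_ _-_
  infixl 7 _*_
  infix  8 -_
  infixr 8 _²

  _≤_ : ℝ → ℝ → Set
  x ≤ y = ∀ ε → 0ℚ ℚ.< ε → ∃ λ N → ∀ i → N ℕ.≤ i → seq x i ℚ.≤ seq y i ℚ.+ ε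

  _<_ : ℝ → ℝ → Set
  x < y = ∃ λ ε → 0ℚ ℚ.< ε × ∃ λ N → ∀ i → N ℕ.≤ i → seq x i ℚ.+ ε ℚ.≤ seq y i

  _≃_ : ℝ → ℝ → Set
  x ≃ y = x ≤ y × y ≤ x

  fromℚ : ℚ → ℝ
  fromℚ q = mkℝ (λ _ → q) λ ε 0<ε → 0 , λ _ _ _ _ →
    subst (ℚ._≤ ε) (sym (cong ∣_∣ (ℚ.+-inverseʳ q))) (ℚ.<⇒≤ 0<ε)

  fromℤ : ℤ → ℝ
  fromℤ z = fromℚ (z ℚ./ 1)

  0ℝ 1ℝ : ℝ
  0ℝ = fromℚ 0ℚ
  1ℝ = fromℚ 1ℚ

  _+_ : ℝ → ℝ → ℝ
  x + y = mkℝ (λ i → seq x i ℚ.+ seq y i) λ ε 0<ε →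
    let (N , Nx) = cauchy x (½ ℚ.* ε) (0<½* 0<ε)
        (M , My) = cauchy y (½ ℚ.* ε) (0<½* 0<ε)
    in N ℕ.⊔ M , λ i j i≥ j≥ → begin
      ∣ (seq x i ℚ.+ seq y i) ℚ.- (seq x j ℚ.+ seq y j) ∣
        ≡⟨ cong ∣_∣ (solve 4 (λ a b c d → (a :+ b) :- (c :+ d) := (a :- c) :+ (b :- d)) refl
                      (seq x i) (seq y i) (seq x j) (seq y j)) ⟩
      ∣ (seq x i ℚ.- seq x j) ℚ.+ (seq y i ℚ.- seq y j) ∣
        ≤⟨ ℚ.∣p+q∣≤∣p∣+∣q∣ (seq x i ℚ.- seq x j) (seq y i ℚ.- seq y j) ⟩
      ∣ seq x i ℚ.- seq x j ∣ ℚ.+ ∣ seq y i ℚ.- seq y j ∣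
        ≤⟨ ℚ.+-mono-≤ (Nx i j (ℕ.m⊔n≤o⇒m≤o N M i≥) (ℕ.m⊔n≤o⇒m≤o N M j≥))
                      (My i j (ℕ.m⊔n≤o⇒n≤o N M i≥) (ℕ.m⊔n≤o⇒n≤o N M j≥)) ⟩
      ½ ℚ.* ε ℚ.+ ½ ℚ.* ε  ≡⟨ ½*+½* ε ⟩
      ε  ∎
    where
    open ℚ.≤-Reasoning
    open +-*-Solver using (solve; _:+_; _:-_; _:=_)

  -_ : ℝ → ℝ
  - x = mkℝ (λ i → ℚ.- seq x i) λ ε 0<ε →
    let (N , Nx) = cauchy x ε 0<ε
    in N , λ i j i≥ j≥ → subst (ℚ._≤ ε)
      (cong ∣_∣ (solve 2 (λ a b → b :- a := :- a :- :- b) refl (seq x i) (seq x j)))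
      (Nx j i j≥ i≥)
    where open +-*-Solver using (solve; _:-_; :-_; _:=_)

  _-_ : ℝ → ℝ → ℝ
  x - y = x + - y

  eventuallyBounded : ∀ x → ∃ λ B → 0ℚ ℚ.< B × ∃ λ N → ∀ i → N ℕ.≤ i → ∣ seq x i ∣ ℚ.≤ B
  eventuallyBounded x =
    let (N , Nx) = cauchy x 1ℚ (ℚ.positive⁻¹ 1ℚ)
    in 1ℚ ℚ.+ ∣ seq x N ∣
     , ℚ.+-mono-<-≤ (ℚ.positive⁻¹ 1ℚ) (ℚ.0≤∣p∣ (seq x N))
     , N
     , λ i i≥ → begin
      ∣ seq x i ∣
        ≡⟨ cong ∣_∣ (solve 2 (λ a b → a := (a :- b) :+ b) refl (seq x i) (seq x N)) ⟩
      ∣ (seq x i ℚ.- seq x N) ℚ.+ seq x N ∣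
        ≤⟨ ℚ.∣p+q∣≤∣p∣+∣q∣ (seq x i ℚ.- seq x N) (seq x N) ⟩
      ∣ seq x i ℚ.- seq x N ∣ ℚ.+ ∣ seq x N ∣
        ≤⟨ ℚ.+-monoˡ-≤ ∣ seq x N ∣ (Nx i N i≥ ℕ.≤-refl) ⟩
      1ℚ ℚ.+ ∣ seq x N ∣  ∎
    where
    open ℚ.≤-Reasoning
    open +-*-Solver using (solve; _:+_; _:-_; _:=_)

  *-cauchy : ∀ x y → IsCauchy (λ i → seq x i ℚ.* seq y i)
  *-cauchy x y ε 0<ε =
    let (B , 0<B , N₁ , x≤B) = eventuallyBounded x
        (C , 0<C , N₂ , y≤C) = eventuallyBounded y
        (δ , 0<δ , [B+C]δ≡ε) = divide (B ℚ.+ C) ε (ℚ.+-mono-< 0<B 0<C) 0<ε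
        (N₃ , Nx) = cauchy x δ 0<δ
        (N₄ , Ny) = cauchy y δ 0<δ
    in (N₁ ℕ.⊔ N₂) ℕ.⊔ (N₃ ℕ.⊔ N₄) , λ i j i≥ j≥ →
    let i≥₁₂ = ℕ.m⊔n≤o⇒m≤o (N₁ ℕ.⊔ N₂) (N₃ ℕ.⊔ N₄) i≥
        i≥₃₄ = ℕ.m⊔n≤o⇒n≤o (N₁ ℕ.⊔ N₂) (N₃ ℕ.⊔ N₄) i≥
        j≥₁₂ = ℕ.m⊔n≤o⇒m≤o (N₁ ℕ.⊔ N₂) (N₃ ℕ.⊔ N₄) j≥
        j≥₃₄ = ℕ.m⊔n≤o⇒n≤o (N₁ ℕ.⊔ N₂) (N₃ ℕ.⊔ N₄) j≥
    in subst (∣ seq x i ℚ.* seq y i ℚ.- seq x j ℚ.* seq y j ∣ ℚ.≤_) [B+C]δ≡ε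
         (∣ab-a′b′∣≤ (seq x i) (seq x j) (seq y i) (seq y j) B C δ (ℚ.<⇒≤ 0<δ)
           (x≤B i (ℕ.m⊔n≤o⇒m≤o N₁ N₂ i≥₁₂))
           (y≤C j (ℕ.m⊔n≤o⇒n≤o N₁ N₂ j≥₁₂))
           (Nx i j (ℕ.m⊔n≤o⇒m≤o N₃ N₄ i≥₃₄) (ℕ.m⊔n≤o⇒m≤o N₃ N₄ j≥₃₄))
           (Ny i j (ℕ.m⊔n≤o⇒n≤o N₃ N₄ i≥₃₄) (ℕ.m⊔n≤o⇒n≤o N₃ N₄ j≥₃₄)))

  _*_ : ℝ → ℝ → ℝ
  x * y = mkℝ (λ i → seq x i ℚ.* seq y i) (*-cauchy x y)

  _² : ℝ → ℝ
  x ² = x * x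

  0≤⊔0 : ∀ q → 0ℚ ℚ.≤ q ℚ.⊔ 0ℚ
  0≤⊔0 q = ℚ.p≤q⊔p q 0ℚ

  rootAt : ∀ k (x : ℝ) i → ∃ (IsApproxRoot k i (seq x i ℚ.⊔ 0ℚ))
  rootAt k x i = approxRoot k i (seq x i ℚ.⊔ 0ℚ) (0≤⊔0 (seq x i))

  rootAt-cauchy : ∀ k x → IsCauchy (λ i → proj₁ (rootAt k x i))
  rootAt-cauchy k x ε 0<ε =
    let 0<η = 0<½* 0<ε
        (N , δ≤η) = unitFraction-small (½ ℚ.* ε) 0<η
        (M , Mx)  = cauchy x ((½ ℚ.* ε) ^ suc k) (0<^ (suc k) 0<η)
        half : ∀ i j → N ℕ.⊔ M ℕ.≤ i → N ℕ.⊔ M ℕ.≤ j →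
               proj₁ (rootAt k x i) ℚ.≤ proj₁ (rootAt k x j) ℚ.+ ε
        half = λ i j i≥ j≥ → subst (λ e → proj₁ (rootAt k x i) ℚ.≤ proj₁ (rootAt k x j) ℚ.+ e) (½*+½* ε)
          (approxRoot-close (proj₂ (rootAt k x i)) (proj₂ (rootAt k x j)) (ℚ.<⇒≤ 0<η)
            (⊔0-close (seq x i) (seq x j) (0≤^ (suc k) (ℚ.<⇒≤ 0<η))
              (Mx i j (ℕ.m⊔n≤o⇒n≤o N M i≥) (ℕ.m⊔n≤o⇒n≤o N M j≥)))
            (δ≤η j (ℕ.m⊔n≤o⇒m≤o N M j≥)))
    in N ℕ.⊔ M , λ i j i≥ j≥ → ≤+⇒∣-∣≤ (half i j i≥ j≥) (half j i j≥ i≥)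

  -- root k x is the nonnegative k-th root of max(x, 0).
  root : (k : ℕ) → .{{ℕ.NonZero k}} → ℝ → ℝ
  root (suc k) x = mkℝ (λ i → proj₁ (rootAt k x i)) (rootAt-cauchy k x)

  √_ : ℝ → ℝ
  √ x = root 2 x

  ∑ : ∀ {n} → Vector ℝ n → ℝ
  ∑ = Vector.foldr _+_ 0ℝ

Matrix : Set → ℕ → ℕ → Set
Matrix X m n = Fin m → Fin n → X

∑ℤ : ∀ {n} → Vector ℤ n → ℤ
∑ℤ = Vector.foldr ℤ._+_ (+ 0)

-- Laplace expansion along the first row.
det : ∀ {k} → Matrix ℤ k k → ℤ
det {zero}  M = + 1
det {suc k} M = ∑ℤ λ j →
  (ℤ.-1ℤ ℤ.^ toℕ j) ℤ.* M zero j ℤ.* det (λ i l → M (suc i) (punchIn j l))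

gram : ∀ {m n} → Matrix ℤ m n → Matrix ℤ m m
gram A i j = ∑ℤ λ l → A i l ℤ.* A j l

-- The strictly increasing tuples, so each set of m columns occurs exactly once.
columnChoices : ∀ m n → List (Vec (Fin n) m)
columnChoices zero    n       = [] ∷ []
columnChoices (suc m) zero    = []
columnChoices (suc m) (suc n) =
  map (λ c → zero ∷ Vec.map suc c) (columnChoices m n) ++
  map (Vec.map suc) (columnChoices (suc m) n)

absMinors : ∀ {m n} → Matrix ℤ m n → List ℕ
absMinors {m} {n} A =
  map (λ c → ℤ.∣ det (λ i j → A i (lookup c j)) ∣) (columnChoices m n)

gcdMinors : ∀ {m n} → Matrix ℤ m n → ℕ
gcdMinors A = foldr gcd 0 (absMinors A)

maxMinor : ∀ {m n} → Matrix ℤ m n → ℕ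
maxMinor A = max 0 (absMinors A)

-- The first argument of min is an upper cut-off, which has no effect here as
-- long as there is at least one minor.
minMinor : ∀ {m n} → Matrix ℤ m n → ℕ
minMinor A = min (maxMinor A) (absMinors A)

maxMinor-nonZero : ∀ {m n} (A : Matrix ℤ m n) → gcdMinors A ≡ 1 → ℕ.NonZero (maxMinor A)
maxMinor-nonZero A gcd≡1 = ℕ.≢-nonZero λ max≡0 →
  contradiction
    (trans (sym gcd≡1) (gcd≡0 (subst (λ M → All (ℕ._≤ M) (absMinors A)) max≡0 (xs≤max 0 (absMinors A)))))
    λ ()
  where
  gcd≡0 : ∀ {xs} → All (ℕ._≤ 0) xs → foldr gcd 0 xs ≡ 0
  gcd≡0 []             = refl
  gcd≡0 (ℕ.z≤n ∷ xs≤0) rewrite gcd≡0 xs≤0 = refl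

-- m(A) / M(A)
minorRatio : ∀ {m n} (A : Matrix ℤ m n) → gcdMinors A ≡ 1 → ℚ
minorRatio A gcd≡1 = (+ minMinor A ℚ./ maxMinor A) {{maxMinor-nonZero A gcd≡1}}

open Real

infix  4 _≈_
infixl 6 _⊕_
infixr 7 _·_ _*ᵥ_

_≈_ : ∀ {n} → Vector ℝ n → Vector ℝ n → Set
x ≈ y = ∀ i → x i ≃ y i

_⊕_ : ∀ {n} → Vector ℝ n → Vector ℝ n → Vector ℝ n
(x ⊕ y) i = x i + y i

_·_ : ∀ {n} → ℝ → Vector ℝ n → Vector ℝ n
(t · x) i = t * x i

_*ᵥ_ : ∀ {m n} → Matrix ℤ m n → Vector ℝ n → Vector ℝ m
(A *ᵥ x) i = ∑ λ j → fromℤ (A i j) * x j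

0ᵥ 1ᵥ : ∀ {n} → Vector ℝ n
0ᵥ _ = 0ℝ
1ᵥ _ = 1ℝ

NonNegative : ∀ {n} → Pred (Vector ℝ n) 0ℓ
NonNegative x = ∀ j → 0ℝ ≤ x j

embed : ∀ {n} → Vector ℤ n → Vector ℝ n
embed z = fromℤ ∘ z

P : ∀ {m n} → Matrix ℤ m n → Vector ℤ m → Pred (Vector ℝ n) 0ℓ
P A b x = NonNegative x × A *ᵥ x ≈ embed b

HasAtLeast : ∀ {n} → ℕ → Pred (Vector ℤ n) 0ℓ → Set
HasAtLeast {n} s S =
  ∃ λ (f : Fin s → Vector ℤ n) → Injective _≡_ _≗_ f × (∀ i → f i ∈ S)

𝓕 : ∀ {m n} → ℕ → Matrix ℤ m n → Pred (Vector ℤ m) 0ℓ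
𝓕 s A b = HasAtLeast s (λ z → embed z ∈ P A b)

cone : ∀ {m n} → Matrix ℤ m n → Pred (Vector ℝ m) 0ℓ
cone {n = n} A y = ∃ λ (c : Vector ℝ n) → NonNegative c × y ≈ A *ᵥ c

translate : ∀ {m} → Vector ℝ m → Pred (Vector ℝ m) 0ℓ → Pred (Vector ℝ m) 0ℓ
translate w S y = ∃ λ c → c ∈ S × y ≈ w ⊕ c

-- Interior for the usual topology of ℝᵐ, given by open boxes.
int : ∀ {m} → Pred (Vector ℝ m) 0ℓ → Pred (Vector ℝ m) 0ℓ
int {m} S y = ∃ λ ε → 0ℝ < ε ×
  (∀ (z : Vector ℝ m) → (∀ i → y i - ε < z i × z i < y i + ε) → z ∈ S)

IsMinimum : Pred ℝ 0ℓ → Pred ℝ 0ℓ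
IsMinimum S g = g ∈ S × (∀ t → t ∈ S → g ≤ t)

Admissible : ∀ {m n} → ℕ → Matrix ℤ m n → Pred ℝ 0ℓ
Admissible s A t =
  0ℝ ≤ t × (λ b → embed b ∈ int (translate (t · (A *ᵥ 1ᵥ)) (cone A))) ⊆ 𝓕 s A

IsDiagonalFrobenius : ∀ {m n} → ℕ → Matrix ℤ m n → Pred ℝ 0ℓ
IsDiagonalFrobenius s A = IsMinimum (Admissible s A)

{-# OPTIONS --safe #-}
-- Put k = n − m, let μ and M be the smallest and the largest minor in absolute value, ρ = μ / M, and let g′ ≥ g be rational.
-- Fix m columns B with |det A_B| = M.  The M classes of ℤᵐ modulo the lattice A_B ℤᵐ have representatives b in the half-open
-- parallelepiped g′ v + A_B (0, 1]ᵐ, which lies in the interior of g v + C, so each b has s solutions u ∈ ℕⁿ of A u = b.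
-- The coordinates of u outside B determine the class of b and then u itself: this gives s M distinct vectors of ℕᵏ.
--
-- Every coordinate of such a u is maximal at a vertex of P(A, b), where Cramer's rule gives u_j ≤ g′ + k (g′ + 1) / ρ;
-- hence s M ≤ ((g′ + 1) (ρ + k) / ρ)ᵏ.  By Cauchy–Binet det(A Aᵀ) ≤ (n choose k) M², so for m ≥ 2 it is enough that
-- (n choose k) (k/n)ᵏ ρ²ᵏ ≤ 1.  This holds because, by the Plücker relations, at least four columns modulo m − 2 others force
-- ρ² ≤ 1/2, and at least seven force ρ² ≤ 1/3.  For m = 1 no such gain exists (ρ = 1 is possible); there the vectors lie in a
-- simplex, and counting lattice points in it gains the factor k! instead.
module Submission where

open import Data.Fin using (Fin; zero; suc; toℕ; punchIn; punchOut)
open import Data.Integer as ℤ using (ℤ; +_; -[1+_]; 0ℤ; 1ℤ; -1ℤ)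
import Data.Integer.Properties as ℤ
open import Data.Nat as ℕ using (ℕ; zero; suc)
import Data.Nat.Properties as ℕ
open import Data.Product using (∃; _×_; _,_; proj₁; proj₂)
open import Data.Sum using (_⊎_; inj₁; inj₂; [_,_]′)
open import Data.Vec.Functional using (Vector; _∷_; removeAt; tail)
open import Function using (_∘_; id)
open import Function.Definitions using (Injective)
open import Relation.Binary.PropositionalEquality
open import Relation.Nullary using (¬_; Dec; yes; no; contradiction)

-- The two factors ρ in the claim do different work: one clears the denominator in the Cramer bound,
-- the other pays for the number of minors in Cauchy-Binet. As (n choose k) k! ≤ nᵏ, the second task
-- amounts to kᵏ / k! ≤ (1 / ρ²)ᵏ. The left side grows like eᵏ, so ρ ≤ 1 alone settles only k = 1; a
-- factor 2 in 1 / ρ² covers k ≤ 4, and 3, an integer above e, covers every k.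
--
-- A real g is a Cauchy sequence and cannot be compared decidably with the rationals of a lattice
-- point count. The count is therefore made for a rational g′ = α / q that lies above g from some
-- index on, and it takes place in the integers after scaling by M q. The cell is (0, 1]ᵐ and not
-- [0, 1)ᵐ because its points must be interior: the scaled coordinates are then integers that are at
-- least 1, and this slack absorbs a perturbation of b.
--
-- When μ = 0, Cramer's rule bounds nothing, but then the product containing ρ vanishes.

-- Determinants by Laplace expansion: transposition, alternation, linearity.

module Determinant where

  open import Defs hiding (_·_; _≈_)
  open import Data.Fin.Properties using (punchIn-punchOut)
  open import Data.Integer using (_+_; _*_; -_; _-_; _^_)
  open import Data.Integer.Tactic.RingSolver using (solve-∀)
  open import Algebra.Properties.Semiring.Sum ℤ.+-*-semiring using (sum-cong-≗; ∑-comm; *-distribˡ-sum; *-distribʳ-sum)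
  open ≡-Reasoning

  sgn : ∀ {n} → Fin n → ℤ
  sgn i = -1ℤ ^ toℕ i

  sgn-suc : ∀ {n} (i : Fin n) → sgn (suc i) ≡ - sgn i
  sgn-suc i = ℤ.-1*i≡-i (sgn i)

  sum-zero : ∀ {n} {f : Vector ℤ n} → (∀ i → f i ≡ 0ℤ) → ∑ℤ f ≡ 0ℤ
  sum-zero {zero}  f≡0 = refl
  sum-zero {suc n} f≡0 = cong₂ _+_ (f≡0 zero) (sum-zero (f≡0 ∘ suc))

  swap₀₁ : ∀ {k} → Fin (suc (suc k)) → Fin (suc (suc k))
  swap₀₁ zero          = suc zero
  swap₀₁ (suc zero)    = zero
  swap₀₁ (suc (suc i)) = suc (suc i)

  -- Laplace expansion duplicates its arguments when it is unfolded, so later proofs only see its algebraic properties.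
  opaque

    Det : ∀ {k} → Matrix ℤ k k → ℤ
    Det = det

    Det≡det : ∀ {k} (M : Matrix ℤ k k) → Det M ≡ det M
    Det≡det M = refl

    Det-empty : (M : Matrix ℤ 0 0) → Det M ≡ 1ℤ
    Det-empty M = refl

    det-row-expansion : ∀ {k} (M : Matrix ℤ (suc k) (suc k)) →
      Det M ≡ ∑ℤ λ j → sgn j * M zero j * Det (λ i l → M (suc i) (punchIn j l))
    det-row-expansion M = refl

  det-cong : ∀ {k} (M N : Matrix ℤ k k) → (∀ i j → M i j ≡ N i j) → Det M ≡ Det N
  det-cong {zero}  M N M≡N = trans (Det-empty M) (sym (Det-empty N))
  det-cong {suc k} M N M≡N = trans (det-row-expansion M) (trans
    (sum-cong-≗ λ j → cong₂ _*_ (cong (sgn j *_) (M≡N zero j)) (det-cong _ _ λ i l → M≡N (suc i) (punchIn j l)))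
    (sym (det-row-expansion N)))

  -- Apart from the corner term, expanding the minors of the first row along their first column
  -- gives a double sum over an entry of the first row and one of the first column. Row expansion of
  -- the minors of the first column yields the same sum.
  det-column-expansion : ∀ {k} (M : Matrix ℤ (suc k) (suc k)) →
    Det M ≡ ∑ℤ λ i → sgn i * M i zero * Det (λ r l → M (punchIn i r) (suc l))
  det-column-expansion {zero}  M = trans (det-row-expansion M)
    (cong (λ d → sgn {1} zero * M zero zero * d + 0ℤ) (det-cong _ _ λ ()))
  det-column-expansion {suc k} M = trans (det-row-expansion M) (cong (λ z → sgn {suc k} zero * M zero zero * Det (λ r l → M (suc r) (suc l)) + z) (begin
    (∑ℤ λ j → sgn (suc j) * x j * Det (minor j))
      ≡⟨ sum-cong-≗ (λ j → trans (cong (sgn (suc j) * x j *_) (det-column-expansion (minor j)))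
           (*-distribˡ-sum (sgn (suc j) * x j) λ i → sgn i * y i * d i j)) ⟩
    (∑ℤ λ j → ∑ℤ λ i → sgn (suc j) * x j * (sgn i * y i * d i j))
      ≡⟨ ∑-comm (λ j i → sgn (suc j) * x j * (sgn i * y i * d i j)) ⟩
    (∑ℤ λ i → ∑ℤ λ j → sgn (suc j) * x j * (sgn i * y i * d i j))
      ≡⟨ sum-cong-≗ (λ i → sum-cong-≗ λ j → interchange (sgn j) (sgn i) (x j) (y i) (d i j)) ⟩
    (∑ℤ λ i → ∑ℤ λ j → sgn (suc i) * y i * (sgn j * x j * d i j))
      ≡⟨ sum-cong-≗ (λ i → trans (sym (*-distribˡ-sum (sgn (suc i) * y i) λ j → sgn j * x j * d i j))
           (cong (sgn (suc i) * y i *_) (sym (det-row-expansion λ r l → M (punchIn (suc i) r) (suc l))))) ⟩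
    (∑ℤ λ i → sgn (suc i) * y i * Det (λ r l → M (punchIn (suc i) r) (suc l)))
      ∎))
    where
    x : Fin (suc k) → ℤ
    x j = M zero (suc j)
    y : Fin (suc k) → ℤ
    y i = M (suc i) zero
    minor : Fin (suc k) → Matrix ℤ (suc k) (suc k)
    minor j r l = M (suc r) (punchIn (suc j) l)
    d : Fin (suc k) → Fin (suc k) → ℤ
    d i j = Det (λ r l → M (suc (punchIn i r)) (suc (punchIn j l)))
    interchange : ∀ s t x y d → -1ℤ * s * x * (t * y * d) ≡ -1ℤ * t * y * (s * x * d)
    interchange = solve-∀

  det-transpose : ∀ {k} (M : Matrix ℤ k k) → Det (λ i j → M j i) ≡ Det M
  det-transpose {zero}  M = trans (Det-empty _) (sym (Det-empty M))
  det-transpose {suc k} M = trans (det-column-expansion λ i j → M j i) (trans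
    (sum-cong-≗ λ j → cong (sgn j * M zero j *_) (det-transpose λ i l → M (suc i) (punchIn j l)))
    (sym (det-row-expansion M)))

  -- The first two terms of the row expansion trade places, and their signs are opposite. Every
  -- other minor still contains both exchanged columns in front and changes sign by induction.
  det-swap-columns : ∀ {k} (M : Matrix ℤ (suc (suc k)) (suc (suc k))) →
    Det (λ i j → M i (swap₀₁ j)) ≡ - Det M
  det-swap-columns {k} M = begin
    Det (λ i j → M i (swap₀₁ j))
      ≡⟨ det-row-expansion (λ i j → M i (swap₀₁ j)) ⟩
    1ℤ * b * Det M′₀ + (-1ℤ * 1ℤ * a * Det M′₁ + ∑ℤ λ j → s j * x j * d′ j)
      ≡⟨ cong₂ (λ u v → 1ℤ * b * u + (-1ℤ * 1ℤ * a * v + ∑ℤ λ j → s j * x j * d′ j))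
           (det-cong M′₀ (λ i l → M (suc i) (punchIn (suc zero) l)) λ { i zero → refl ; i (suc l) → refl })
           (det-cong M′₁ (λ i l → M (suc i) (punchIn zero l)) λ { i zero → refl ; i (suc l) → refl }) ⟩
    1ℤ * b * d₁ + (-1ℤ * 1ℤ * a * d₀ + ∑ℤ λ j → s j * x j * d′ j)
      ≡⟨ cong (λ z → 1ℤ * b * d₁ + (-1ℤ * 1ℤ * a * d₀ + z)) (rest M) ⟩
    1ℤ * b * d₁ + (-1ℤ * 1ℤ * a * d₀ + -1ℤ * R)
      ≡⟨ collect a b d₀ d₁ R ⟩
    - (1ℤ * a * d₀ + (-1ℤ * 1ℤ * b * d₁ + R))
      ≡⟨ cong -_ (det-row-expansion M) ⟨
    - Det M
      ∎
    where
    a = M zero zero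
    b = M zero (suc zero)
    d₀ = Det (λ i l → M (suc i) (punchIn zero l))
    d₁ = Det (λ i l → M (suc i) (punchIn (suc zero) l))
    M′₀ M′₁ : Matrix ℤ (suc k) (suc k)
    M′₀ i l = M (suc i) (swap₀₁ (punchIn zero l))
    M′₁ i l = M (suc i) (swap₀₁ (punchIn (suc zero) l))
    s x d′ : Fin k → ℤ
    s j = sgn (suc (suc j))
    x j = M zero (suc (suc j))
    d′ j = Det (λ i l → M (suc i) (swap₀₁ (punchIn (suc (suc j)) l)))
    R = ∑ℤ λ j → s j * x j * Det (λ i l → M (suc i) (punchIn (suc (suc j)) l))
    collect : ∀ a b d₀ d₁ R → 1ℤ * b * d₁ + (-1ℤ * 1ℤ * a * d₀ + -1ℤ * R) ≡
                              - (1ℤ * a * d₀ + (-1ℤ * 1ℤ * b * d₁ + R))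
    collect = solve-∀
    neg : ∀ s x d → s * x * - d ≡ -1ℤ * (s * x * d)
    neg = solve-∀
    rest : ∀ {k} (M : Matrix ℤ (suc (suc k)) (suc (suc k))) →
      ∑ℤ (λ j → sgn (suc (suc j)) * M zero (suc (suc j)) * Det (λ i l → M (suc i) (swap₀₁ (punchIn (suc (suc j)) l))))
      ≡ -1ℤ * ∑ℤ (λ j → sgn (suc (suc j)) * M zero (suc (suc j)) * Det (λ i l → M (suc i) (punchIn (suc (suc j)) l)))
    rest {zero}  M = refl
    rest {suc k} M = trans
      (sum-cong-≗ λ j → trans
        (cong (sgn (suc (suc j)) * M zero (suc (suc j)) *_) (trans
          (det-cong (λ i l → M (suc i) (swap₀₁ (punchIn (suc (suc j)) l)))
                    (λ i l → M (suc i) (punchIn (suc (suc j)) (swap₀₁ l)))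
                    λ { i zero → refl ; i (suc zero) → refl ; i (suc (suc l)) → refl })
          (det-swap-columns λ i l → M (suc i) (punchIn (suc (suc j)) l))))
        (neg (sgn (suc (suc j))) (M zero (suc (suc j))) (Det λ i l → M (suc i) (punchIn (suc (suc j)) l))))
      (sym (*-distribˡ-sum -1ℤ λ j →
        sgn (suc (suc j)) * M zero (suc (suc j)) * Det (λ i l → M (suc i) (punchIn (suc (suc j)) l))))

  det-swap : ∀ {k} (x y : Vector ℤ (suc (suc k))) (R : Matrix ℤ k (suc (suc k))) →
    Det (x ∷ y ∷ R) ≡ - Det (y ∷ x ∷ R)
  det-swap x y R = begin
    Det (x ∷ y ∷ R)                            ≡⟨ det-transpose (x ∷ y ∷ R) ⟨
    Det (λ i j → (x ∷ y ∷ R) j i)              ≡⟨ det-cong (λ i j → (x ∷ y ∷ R) j i) (λ i j → (y ∷ x ∷ R) (swap₀₁ j) i)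
      (λ { i zero → refl ; i (suc zero) → refl ; i (suc (suc j)) → refl }) ⟩
    Det (λ i j → (y ∷ x ∷ R) (swap₀₁ j) i)     ≡⟨ det-swap-columns (λ i j → (y ∷ x ∷ R) j i) ⟩
    - Det (λ i j → (y ∷ x ∷ R) j i)            ≡⟨ cong -_ (det-transpose (y ∷ x ∷ R)) ⟩
    - Det (y ∷ x ∷ R)                          ∎

  x≡-x⇒x≡0 : ∀ {x} → x ≡ - x → x ≡ 0ℤ
  x≡-x⇒x≡0 {+ zero} _ = refl

  det-equal₀₁ : ∀ {k} (x y : Vector ℤ (suc (suc k))) (R : Matrix ℤ k (suc (suc k))) →
    x ≗ y → Det (x ∷ y ∷ R) ≡ 0ℤ
  det-equal₀₁ x y R x≗y = x≡-x⇒x≡0 (trans (det-swap x y R) (cong -_ (det-cong (y ∷ x ∷ R) (x ∷ y ∷ R)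
    λ { zero j → sym (x≗y j) ; (suc zero) j → x≗y j ; (suc (suc i)) j → refl })))

  -- Mutual recursion with `det-move`: below a fixed first row the minors are smaller, so `det-move`
  -- applies to each of them, and bringing a row to the very front takes one further exchange of the
  -- first two rows.
  det-move-tail : ∀ {k} (x : Vector ℤ (suc (suc k))) (R : Matrix ℤ (suc k) (suc (suc k))) i →
    Det (x ∷ R) ≡ sgn i * Det (x ∷ R i ∷ removeAt R i)

  det-move : ∀ {k} (M : Matrix ℤ (suc k) (suc k)) i → Det M ≡ sgn i * Det (M i ∷ removeAt M i)
  det-move M zero = trans (det-cong M (M zero ∷ removeAt M zero) λ { zero j → refl ; (suc i) j → refl })
    (sym (ℤ.*-identityˡ (Det (M zero ∷ removeAt M zero))))
  det-move {suc k} M (suc i) = begin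
    Det M                                                        ≡⟨ det-cong M (M zero ∷ tail M) (λ { zero j → refl ; (suc i) j → refl }) ⟩
    Det (M zero ∷ tail M)                                        ≡⟨ det-move-tail (M zero) (tail M) i ⟩
    sgn i * Det (M zero ∷ M (suc i) ∷ removeAt (tail M) i)       ≡⟨ cong (sgn i *_) (det-swap (M zero) (M (suc i)) (removeAt (tail M) i)) ⟩
    sgn i * - Det (M (suc i) ∷ M zero ∷ removeAt (tail M) i)     ≡⟨ neg (sgn i) (Det (M (suc i) ∷ M zero ∷ removeAt (tail M) i)) ⟩
    sgn (suc i) * Det (M (suc i) ∷ M zero ∷ removeAt (tail M) i) ≡⟨ cong (sgn (suc i) *_) (det-cong
      (M (suc i) ∷ M zero ∷ removeAt (tail M) i) (M (suc i) ∷ removeAt M (suc i)) λ { zero j → refl ; (suc zero) j → refl ; (suc (suc r)) j → refl }) ⟩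
    sgn (suc i) * Det (M (suc i) ∷ removeAt M (suc i))           ∎
    where
    neg : ∀ s d → s * - d ≡ -1ℤ * s * d
    neg = solve-∀

  det-move-tail x R i = begin
    Det (x ∷ R)
      ≡⟨ det-row-expansion (x ∷ R) ⟩
    (∑ℤ λ j → sgn j * x j * Det (λ r l → R r (punchIn j l)))
      ≡⟨ sum-cong-≗ (λ j → trans (cong (sgn j * x j *_)
           (trans (det-move (λ r l → R r (punchIn j l)) i)
             (cong (sgn i *_) (det-cong ((λ l → R i (punchIn j l)) ∷ removeAt (λ r l → R r (punchIn j l)) i)
               (λ r l → (R i ∷ removeAt R i) r (punchIn j l)) λ { zero l → refl ; (suc r) l → refl }))))
           (assoc (sgn i) (sgn j) (x j) (Det λ r l → (R i ∷ removeAt R i) r (punchIn j l)))) ⟩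
    (∑ℤ λ j → sgn i * (sgn j * x j * Det (λ r l → (R i ∷ removeAt R i) r (punchIn j l))))
      ≡⟨ sym (*-distribˡ-sum (sgn i) λ j → sgn j * x j * Det (λ r l → (R i ∷ removeAt R i) r (punchIn j l))) ⟩
    sgn i * (∑ℤ λ j → sgn j * x j * Det (λ r l → (R i ∷ removeAt R i) r (punchIn j l)))
      ≡⟨ cong (sgn i *_) (det-row-expansion (x ∷ R i ∷ removeAt R i)) ⟨
    sgn i * Det (x ∷ R i ∷ removeAt R i)
      ∎
    where
    assoc : ∀ s t x d → t * x * (s * d) ≡ s * (t * x * d)
    assoc = solve-∀

  det-∷-equal : ∀ {k} (x : Vector ℤ (suc k)) (R : Matrix ℤ k (suc k)) i → x ≗ R i → Det (x ∷ R) ≡ 0ℤ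
  det-∷-equal {suc k} x R i x≗Ri = trans (det-move-tail x R i)
    (trans (cong (sgn i *_) (det-equal₀₁ x (R i) (removeAt R i) x≗Ri)) (ℤ.*-zeroʳ (sgn i)))

  det-equal-rows : ∀ {k} (M : Matrix ℤ k k) {p q} → p ≢ q → M p ≗ M q → Det M ≡ 0ℤ
  det-equal-rows {suc k} M {p} {q} p≢q Mp≗Mq = trans (det-move M p)
    (trans (cong (sgn p *_) (det-∷-equal (M p) (removeAt M p) (punchOut p≢q)
      λ j → trans (Mp≗Mq j) (cong (λ r → M r j) (sym (punchIn-punchOut p≢q)))))
    (ℤ.*-zeroʳ (sgn p)))

  det-∷-sum : ∀ {k n} (c : Vector ℤ n) (w : Matrix ℤ n (suc k)) (R : Matrix ℤ k (suc k)) →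
    Det ((λ j → ∑ℤ λ l → c l * w l j) ∷ R) ≡ ∑ℤ λ l → c l * Det (w l ∷ R)
  det-∷-sum {k} c w R = begin
    Det ((λ j → ∑ℤ λ l → c l * w l j) ∷ R)
      ≡⟨ det-row-expansion ((λ j → ∑ℤ λ l → c l * w l j) ∷ R) ⟩
    (∑ℤ λ j → sgn j * (∑ℤ λ l → c l * w l j) * d j)
      ≡⟨ sum-cong-≗ (λ j → trans (cong (_* d j) (*-distribˡ-sum (sgn j) λ l → c l * w l j))
           (*-distribʳ-sum (d j) λ l → sgn j * (c l * w l j))) ⟩
    (∑ℤ λ j → ∑ℤ λ l → sgn j * (c l * w l j) * d j)
      ≡⟨ ∑-comm (λ j l → sgn j * (c l * w l j) * d j) ⟩
    (∑ℤ λ l → ∑ℤ λ j → sgn j * (c l * w l j) * d j)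
      ≡⟨ sum-cong-≗ (λ l → sum-cong-≗ λ j → assoc (sgn j) (c l) (w l j) (d j)) ⟩
    (∑ℤ λ l → ∑ℤ λ j → c l * (sgn j * w l j * d j))
      ≡⟨ sum-cong-≗ (λ l → trans (sym (*-distribˡ-sum (c l) λ j → sgn j * w l j * d j))
           (cong (c l *_) (sym (det-row-expansion (w l ∷ R))))) ⟩
    (∑ℤ λ l → c l * Det (w l ∷ R))
      ∎
    where
    d : Fin (suc k) → ℤ
    d j = Det (λ i l → R i (punchIn j l))
    assoc : ∀ s c w d → s * (c * w) * d ≡ c * (s * w * d)
    assoc = solve-∀

  det-∷-+* : ∀ {k} (x y : Vector ℤ (suc k)) (c : ℤ) (R : Matrix ℤ k (suc k)) →
    Det ((λ j → x j + c * y j) ∷ R) ≡ Det (x ∷ R) + c * Det (y ∷ R)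
  det-∷-+* {k} x y c R = begin
    Det ((λ j → x j + c * y j) ∷ R)
      ≡⟨ det-cong ((λ j → x j + c * y j) ∷ R) ((λ j → ∑ℤ λ l → cs l * w l j) ∷ R)
           (λ { zero j → expand (x j) c (y j) ; (suc i) j → refl }) ⟩
    Det ((λ j → ∑ℤ λ l → cs l * w l j) ∷ R)  ≡⟨ det-∷-sum cs w R ⟩
    (∑ℤ λ l → cs l * Det (w l ∷ R))          ≡⟨ expand (Det (x ∷ R)) c (Det (y ∷ R)) ⟨
    Det (x ∷ R) + c * Det (y ∷ R)            ∎
    where
    cs : Vector ℤ 2
    cs = 1ℤ ∷ c ∷ λ ()
    w : Matrix ℤ 2 (suc k)
    w = x ∷ y ∷ λ ()
    expand : ∀ a c b → a + c * b ≡ 1ℤ * a + (c * b + 0ℤ)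
    expand = solve-∀

  -- The relation is the expansion of a determinant with a repeated column along that column.
  det-relation : ∀ {m} (w : Matrix ℤ (suc m) m) r → ∑ℤ (λ i → sgn i * w i r * Det (removeAt w i)) ≡ 0ℤ
  det-relation w r = trans (sym (det-column-expansion λ i → w i r ∷ w i))
    (trans (sym (det-transpose λ i → w i r ∷ w i))
      (det-equal-rows (λ j i → (w i r ∷ w i) j) {zero} {suc r} (λ ()) λ i → refl))

-- The Cauchy-Binet formula.

module CauchyBinet where

  open Determinant
  open import Defs hiding (_·_; _≈_)
  open import Data.Integer using (_+_; _*_; -_; _-_)
  open import Data.Integer.Tactic.RingSolver using (solve-∀)
  open import Data.List as List using (List)
  open import Data.Vec as Vec using (Vec; lookup)
  open import Data.Vec.Properties using (lookup-map)
  open import Algebra.Properties.Semiring.Sum ℤ.+-*-semiring using (sum-cong-≗; ∑-distrib-+; *-distribˡ-sum; *-distribʳ-sum)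
  open ≡-Reasoning

  det-add-row : ∀ {k} (x : Vector ℤ (suc k)) (R R′ : Matrix ℤ k (suc k)) i c →
    (∀ j → R′ i j ≡ R i j + c * x j) → (∀ r → r ≢ i → ∀ j → R′ r j ≡ R r j) →
    Det (x ∷ R′) ≡ Det (x ∷ R)
  det-add-row {suc k} x R R′ i c at-i off-i = begin
    Det (x ∷ R′)                               ≡⟨ front R′ ⟩
    s * - Det (R′ i ∷ x ∷ removeAt R′ i)       ≡⟨ cong (λ z → s * - z) (det-cong (R′ i ∷ x ∷ removeAt R′ i)
        ((λ j → R i j + c * x j) ∷ x ∷ removeAt R i)
        λ { zero j → at-i j ; (suc zero) j → refl ; (suc (suc r)) j → off-i (punchIn i r) (punchInᵢ≢i i r) j }) ⟩
    s * - Det ((λ j → R i j + c * x j) ∷ x ∷ removeAt R i)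
      ≡⟨ cong (λ z → s * - z) (det-∷-+* (R i) x c (x ∷ removeAt R i)) ⟩
    s * - (Det (R i ∷ x ∷ removeAt R i) + c * Det (x ∷ x ∷ removeAt R i))
      ≡⟨ cong (λ z → s * - (Det (R i ∷ x ∷ removeAt R i) + c * z)) (det-equal₀₁ x x (removeAt R i) λ _ → refl) ⟩
    s * - (Det (R i ∷ x ∷ removeAt R i) + c * 0ℤ)
      ≡⟨ cong (λ z → s * - z) (drop (Det (R i ∷ x ∷ removeAt R i)) c) ⟩
    s * - Det (R i ∷ x ∷ removeAt R i)         ≡⟨ front R ⟨
    Det (x ∷ R)                                ∎
    where
    open import Data.Fin.Properties using (punchInᵢ≢i)
    s = sgn i
    drop : ∀ d c → d + c * 0ℤ ≡ d
    drop = solve-∀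
    front : ∀ R → Det (x ∷ R) ≡ s * - Det (R i ∷ x ∷ removeAt R i)
    front R = trans (det-move-tail x R i) (cong (s *_) (det-swap x (R i) (removeAt R i)))

  -- The functional is arbitrary because the induction freezes the first row and continues with the
  -- functional of the remaining rows, which is no longer a determinant of the same shape.
  add-multiples-invariant : ∀ {k n} (x : Vector ℤ n) (F : Matrix ℤ k n → ℤ) →
    (∀ R R′ → (∀ i j → R′ i j ≡ R i j) → F R′ ≡ F R) →
    (∀ R R′ i c → (∀ j → R′ i j ≡ R i j + c * x j) → (∀ r → r ≢ i → ∀ j → R′ r j ≡ R r j) → F R′ ≡ F R) →
    ∀ (c : Vector ℤ k) R → F (λ i j → R i j + c i * x j) ≡ F R
  add-multiples-invariant {zero}  x F F-cong F-add c R = F-cong R _ λ ()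
  add-multiples-invariant {suc k} x F F-cong F-add c R = begin
    F (λ i j → R i j + c i * x j)                      ≡⟨ F-add (R zero ∷ R⁺) _ zero (c zero) (λ j → refl)
      (λ { zero 0≢0 → λ _ → contradiction refl 0≢0 ; (suc r) _ j → refl }) ⟩
    F (R zero ∷ R⁺)                                    ≡⟨ add-multiples-invariant x (λ R′ → F (R zero ∷ R′))
      (λ S S′ S≡S′ → F-cong _ _ λ { zero j → refl ; (suc i) j → S≡S′ i j })
      (λ S S′ i c at-i off-i → F-add _ _ (suc i) c at-i
        λ { zero _ j → refl ; (suc r) r≢i j → off-i r (r≢i ∘ cong suc) j })
      (tail c) (tail R) ⟩
    F (R zero ∷ tail R)                                ≡⟨ F-cong _ _ (λ { zero j → refl ; (suc i) j → refl }) ⟩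
    F R                                                ∎
    where
    open import Relation.Nullary using (contradiction)
    R⁺ : Matrix ℤ k _
    R⁺ i j = R (suc i) j + c (suc i) * x j

  det-add-multiples : ∀ {k} (x : Vector ℤ (suc k)) (c : Vector ℤ k) (R : Matrix ℤ k (suc k)) →
    Det (x ∷ λ i j → R i j + c i * x j) ≡ Det (x ∷ R)
  det-add-multiples x c R = add-multiples-invariant x (λ R → Det (x ∷ R))
    (λ R R′ R≡R′ → det-cong (x ∷ R′) (x ∷ R) λ { zero j → refl ; (suc i) j → R≡R′ i j })
    (det-add-row x) c R

  -- Both sides are values of the bordered determinant with first row (1, −b) and first column (1, a).
  det-rank-one : ∀ {k} (a b : Vector ℤ (suc k)) (G : Matrix ℤ (suc k) (suc k)) →
    Det (λ i j → a i * b j + G i j) ≡ Det G + ∑ℤ λ j → ∑ℤ λ i →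
      (sgn j * b j) * ((sgn i * a i) * Det (λ r l → G (punchIn i r) (punchIn j l)))
  det-rank-one {k} a b G = begin
    Det (λ i j → a i * b j + G i j)
      ≡⟨ det-transpose (λ i j → a i * b j + G i j) ⟨
    Det G+ab
      ≡⟨ pad (Det G+ab) ⟩
    1ℤ * 1ℤ * Det G+ab + 0ℤ
      ≡⟨ cong (λ z → 1ℤ * 1ℤ * Det G+ab + z) (sum-zero {f = λ i → sgn (suc i) * 0ℤ * minor i} λ i → vanish (sgn (suc i)) (minor i)) ⟨
    1ℤ * 1ℤ * Det G+ab + ∑ℤ (λ i → sgn (suc i) * 0ℤ * minor i)
      ≡⟨ det-column-expansion E′ ⟨
    Det E′
      ≡⟨ det-cong E′ ((1ℤ ∷ a) ∷ λ j i → W j i + b j * (1ℤ ∷ a) i)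
         (λ { zero i → refl ; (suc j) zero → cancel (b j) ; (suc j) (suc i) → swap (a i) (b j) (G i j) }) ⟩
    Det ((1ℤ ∷ a) ∷ λ j i → W j i + b j * (1ℤ ∷ a) i)
      ≡⟨ det-add-multiples (1ℤ ∷ a) b W ⟩
    Det E
      ≡⟨ det-column-expansion E ⟩
    1ℤ * 1ℤ * Det (λ j i → G i j) + ∑ℤ (λ j → sgn (suc j) * - b j * Det (λ r l → E (punchIn (suc j) r) (suc l)))
      ≡⟨ cong₂ _+_ (trans (one (Det λ j i → G i j)) (det-transpose G)) (sum-cong-≗ border) ⟩
    Det G + ∑ℤ (λ j → ∑ℤ λ i → (sgn j * b j) * ((sgn i * a i) * Det (λ r l → G (punchIn i r) (punchIn j l))))
      ∎
    where
    G+ab : Matrix ℤ (suc k) (suc k)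
    G+ab j i = a i * b j + G i j
    W : Matrix ℤ (suc k) (suc (suc k))
    W j = (- b j) ∷ λ i → G i j
    E E′ : Matrix ℤ (suc (suc k)) (suc (suc k))
    E = (1ℤ ∷ a) ∷ W
    E′ = (1ℤ ∷ a) ∷ λ j → 0ℤ ∷ G+ab j
    minor : Fin (suc k) → ℤ
    minor i = Det (λ r l → E′ (punchIn (suc i) r) (suc l))
    pad : ∀ d → d ≡ 1ℤ * 1ℤ * d + 0ℤ
    pad = solve-∀
    one : ∀ d → 1ℤ * 1ℤ * d ≡ d
    one = solve-∀
    vanish : ∀ s d → s * 0ℤ * d ≡ 0ℤ
    vanish = solve-∀
    cancel : ∀ b → 0ℤ ≡ - b + b * 1ℤ
    cancel = solve-∀
    swap : ∀ a b g → a * b + g ≡ g + b * a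
    swap = solve-∀
    neg : ∀ s b d → -1ℤ * s * - b * d ≡ s * b * d
    neg = solve-∀
    border : ∀ j → sgn (suc j) * - b j * Det (λ r l → E (punchIn (suc j) r) (suc l)) ≡
      ∑ℤ λ i → (sgn j * b j) * ((sgn i * a i) * Det (λ r l → G (punchIn i r) (punchIn j l)))
    border j = begin
      -1ℤ * sgn j * - b j * Det (λ r l → E (punchIn (suc j) r) (suc l))
        ≡⟨ neg (sgn j) (b j) (Det (λ r l → E (punchIn (suc j) r) (suc l))) ⟩
      sgn j * b j * Det (λ r l → E (punchIn (suc j) r) (suc l))
        ≡⟨ cong (sgn j * b j *_) (trans (det-row-expansion λ r l → E (punchIn (suc j) r) (suc l)) (sum-cong-≗ λ i → cong (sgn i * a i *_)
             (det-transpose λ r l → G (punchIn i r) (punchIn j l)))) ⟩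
      sgn j * b j * ∑ℤ (λ i → sgn i * a i * Det (λ r l → G (punchIn i r) (punchIn j l)))
        ≡⟨ *-distribˡ-sum (sgn j * b j) (λ i → sgn i * a i * Det (λ r l → G (punchIn i r) (punchIn j l))) ⟩
      ∑ℤ (λ i → (sgn j * b j) * ((sgn i * a i) * Det (λ r l → G (punchIn i r) (punchIn j l))))
        ∎

  sumOver : ∀ {X : Set} → List X → (X → ℤ) → ℤ
  sumOver xs f = List.foldr (λ x z → f x + z) 0ℤ xs

  module _ {X : Set} where

    sumOver-cong : ∀ (xs : List X) {f g} → (∀ x → f x ≡ g x) → sumOver xs f ≡ sumOver xs g
    sumOver-cong List.[]       f≡g = refl
    sumOver-cong (x List.∷ xs) f≡g = cong₂ _+_ (f≡g x) (sumOver-cong xs f≡g)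

    sumOver-++ : ∀ (xs ys : List X) f → sumOver (xs List.++ ys) f ≡ sumOver xs f + sumOver ys f
    sumOver-++ List.[]       ys f = sym (ℤ.+-identityˡ _)
    sumOver-++ (x List.∷ xs) ys f = trans (cong (λ z → f x + z) (sumOver-++ xs ys f))
      (sym (ℤ.+-assoc (f x) (sumOver xs f) (sumOver ys f)))

    sumOver-map : ∀ {Y : Set} (h : Y → X) ys f → sumOver (List.map h ys) f ≡ sumOver ys (f ∘ h)
    sumOver-map h List.[]       f = refl
    sumOver-map h (y List.∷ ys) f = cong (λ z → f (h y) + z) (sumOver-map h ys f)

    *-distribˡ-sumOver : ∀ c xs (f : X → ℤ) → c * sumOver xs f ≡ sumOver xs (λ x → c * f x)
    *-distribˡ-sumOver c List.[]       f = ℤ.*-zeroʳ c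
    *-distribˡ-sumOver c (x List.∷ xs) f = trans (ℤ.*-distribˡ-+ c (f x) (sumOver xs f))
      (cong (λ z → c * f x + z) (*-distribˡ-sumOver c xs f))

    sum-sumOver-comm : ∀ {n} xs (f : Fin n → X → ℤ) →
      ∑ℤ (λ i → sumOver xs (f i)) ≡ sumOver xs (λ x → ∑ℤ λ i → f i x)
    sum-sumOver-comm {n} List.[]   f = sum-zero {n} {f = λ _ → 0ℤ} (λ _ → refl)
    sum-sumOver-comm (x List.∷ xs) f = trans (∑-distrib-+ (λ i → f i x) (λ i → sumOver xs (f i)))
      (cong (λ z → ∑ℤ (λ i → f i x) + z) (sum-sumOver-comm xs f))

  columns : ∀ {m n k} → Matrix ℤ m n → (Fin k → Fin n) → Matrix ℤ m k
  columns A c i j = A i (c j)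

  ∑-* : ∀ {n p} (f : Vector ℤ n) (g : Vector ℤ p) → ∑ℤ f * ∑ℤ g ≡ ∑ℤ λ j → ∑ℤ λ i → f i * g j
  ∑-* f g = trans (*-distribˡ-sum (∑ℤ f) g) (sum-cong-≗ λ j → *-distribʳ-sum (g j) f)

  -- Induction on the number of columns. Splitting off the first column writes the product matrix as
  -- a rank-one term plus the product G of the remaining columns. In `det-rank-one` the term Det G
  -- accounts for the choices without the first column. The double sum, after the minors of G are
  -- expanded by induction, factors into two Laplace expansions and accounts for the choices with
  -- it. Two matrices are needed since the minors delete different rows from the two factors.
  cauchy-binet : ∀ {m n} (A B : Matrix ℤ m n) →
    Det (λ i j → ∑ℤ λ l → A i l * B j l) ≡
    sumOver (columnChoices m n) λ c → Det (columns A (lookup c)) * Det (columns B (lookup c))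
  cauchy-binet {zero}          A B = trans (Det-empty _) (sym (cong (_+ 0ℤ) (cong₂ _*_ (Det-empty _) (Det-empty _))))
  cauchy-binet {suc m} {zero}  A B = trans (det-row-expansion λ i j → 0ℤ) (sum-zero {f = λ j → sgn j * 0ℤ * d j} λ j →
    vanish (sgn j) (d j))
    where
    d : Fin (suc m) → ℤ
    d j = Det {m} λ i l → 0ℤ
    vanish : ∀ s d → s * 0ℤ * d ≡ 0ℤ
    vanish = solve-∀
  cauchy-binet {suc m} {suc n} A B = begin
    Det (λ i j → A i zero * B j zero + G i j)
      ≡⟨ det-rank-one (λ i → A i zero) (λ j → B j zero) G ⟩
    Det G + ∑ℤ (λ j → ∑ℤ λ i → b j * (a i * Det (λ r l → G (punchIn i r) (punchIn j l))))
      ≡⟨ cong (λ z → Det G + z) (sum-cong-≗ λ j → sum-cong-≗ λ i → trans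
           (cong (λ z → b j * (a i * z)) (cauchy-binet (λ r → A′ (punchIn i r)) (λ r → B′ (punchIn j r))))
           (trans (cong (b j *_) (*-distribˡ-sumOver (a i) cs (λ c → dA i c * dB j c)))
                  (*-distribˡ-sumOver (b j) cs (λ c → a i * (dA i c * dB j c))))) ⟩
    Det G + ∑ℤ (λ j → ∑ℤ λ i → sumOver cs λ c → b j * (a i * (dA i c * dB j c)))
      ≡⟨ cong (λ z → Det G + z) (trans
           (sum-cong-≗ λ j → sum-sumOver-comm cs λ i c → b j * (a i * (dA i c * dB j c)))
           (sum-sumOver-comm cs λ j c → ∑ℤ λ i → b j * (a i * (dA i c * dB j c)))) ⟩
    Det G + sumOver cs (λ c → ∑ℤ λ j → ∑ℤ λ i → b j * (a i * (dA i c * dB j c)))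
      ≡⟨ cong (λ z → Det G + z) (sumOver-cong cs λ c → begin
           ∑ℤ (λ j → ∑ℤ λ i → b j * (a i * (dA i c * dB j c)))
             ≡⟨ (sum-cong-≗ λ j → sum-cong-≗ λ i → regroup (b j) (a i) (dA i c) (dB j c)) ⟩
           ∑ℤ (λ j → ∑ℤ λ i → (a i * dA i c) * (b j * dB j c))
             ≡⟨ ∑-* (λ i → a i * dA i c) (λ j → b j * dB j c) ⟨
           ∑ℤ (λ i → a i * dA i c) * ∑ℤ (λ j → b j * dB j c)
             ≡⟨ cong₂ _*_ (with-zero A c) (with-zero B c) ⟨
           Det (columns A (lookup (zero Vec.∷ Vec.map suc c))) * Det (columns B (lookup (zero Vec.∷ Vec.map suc c)))
             ∎) ⟩
    Det G + sumOver cs (term ∘ λ c → zero Vec.∷ Vec.map suc c)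
      ≡⟨ cong₂ _+_ (trans (cauchy-binet A′ B′) (sumOver-cong cs′ λ c → sym (cong₂ _*_ (without-zero A c) (without-zero B c))))
                   (sym (sumOver-map (λ c → zero Vec.∷ Vec.map suc c) cs term)) ⟩
    sumOver cs′ (term ∘ Vec.map suc) + sumOver (List.map (λ c → zero Vec.∷ Vec.map suc c) cs) term
      ≡⟨ ℤ.+-comm (sumOver cs′ (term ∘ Vec.map suc)) _ ⟩
    sumOver (List.map (λ c → zero Vec.∷ Vec.map suc c) cs) term + sumOver cs′ (term ∘ Vec.map suc)
      ≡⟨ cong (λ z → sumOver (List.map (λ c → zero Vec.∷ Vec.map suc c) cs) term + z) (sumOver-map (Vec.map suc) cs′ term) ⟨
    sumOver (List.map (λ c → zero Vec.∷ Vec.map suc c) cs) term + sumOver (List.map (Vec.map suc) cs′) term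
      ≡⟨ sumOver-++ (List.map (λ c → zero Vec.∷ Vec.map suc c) cs) (List.map (Vec.map suc) cs′) term ⟨
    sumOver (columnChoices (suc m) (suc n)) term
      ∎
    where
    cs = columnChoices m n
    cs′ = columnChoices (suc m) n
    A′ B′ : Matrix ℤ (suc m) n
    A′ i l = A i (suc l)
    B′ i l = B i (suc l)
    G : Matrix ℤ (suc m) (suc m)
    G i j = ∑ℤ λ l → A′ i l * B′ j l
    term : Vec (Fin (suc n)) (suc m) → ℤ
    term c = Det (columns A (lookup c)) * Det (columns B (lookup c))
    a b : Fin (suc m) → ℤ
    a i = sgn i * A i zero
    b j = sgn j * B j zero
    dA dB : Fin (suc m) → Vec (Fin n) m → ℤ
    dA i c = Det (columns (λ r → A′ (punchIn i r)) (lookup c))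
    dB j c = Det (columns (λ r → B′ (punchIn j r)) (lookup c))
    regroup : ∀ b a x y → b * (a * (x * y)) ≡ (a * x) * (b * y)
    regroup = solve-∀
    without-zero : ∀ (C : Matrix ℤ (suc m) (suc n)) c →
      Det (columns C (lookup (Vec.map suc c))) ≡ Det (columns (λ i l → C i (suc l)) (lookup c))
    without-zero C c = det-cong (columns C (lookup (Vec.map suc c))) (columns (λ i l → C i (suc l)) (lookup c))
      λ i j → cong (C i) (lookup-map j suc c)
    with-zero : ∀ (C : Matrix ℤ (suc m) (suc n)) c → Det (columns C (lookup (zero Vec.∷ Vec.map suc c))) ≡
      ∑ℤ λ i → sgn i * C i zero * Det (columns (λ r l → C (punchIn i r) (suc l)) (lookup c))
    with-zero C c = trans (det-column-expansion (columns C (lookup (zero Vec.∷ Vec.map suc c))))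
      (sum-cong-≗ λ i → cong (sgn i * C i zero *_) (det-cong
        (columns (λ r → C (punchIn i r)) (lookup (Vec.map suc c))) (columns (λ r l → C (punchIn i r) (suc l)) (lookup c))
        λ r l → cong (C (punchIn i r)) (lookup-map l suc c)))

-- Minors as functions of a choice of columns, and complementary choices.

module Minors where

  open Determinant
  open import Defs hiding (_·_; _≈_)
  open import Data.Fin.Properties as Fin using (any?; punchInᵢ≢i; punchIn-injective; suc-injective)
  open import Data.Integer using (_+_; _*_; ∣_∣)
  import Data.List as List
  open import Data.List.Extrema.Nat using (xs≤max; min≤xs; argmax-sel)
  open import Data.List.Membership.Propositional using (_∈_)
  open import Data.List.Membership.Propositional.Properties using (∈-++⁺ˡ; ∈-++⁺ʳ; ∈-++⁻; ∈-map⁺; ∈-map⁻)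
  import Data.List.Relation.Unary.All as All
  open import Data.List.Relation.Unary.Any using (here)
  open import Data.Unit using (⊤; tt)
  open import Data.Vec as Vec using (lookup)
  open import Data.Vec.Properties using (lookup-map)
  open import Relation.Nullary.Decidable using (¬?; _×-dec_; decidable-stable)
  open ≡-Reasoning

  -- Moving single entries to the front generates all permutations, and `det-move` provides the
  -- symmetry of minors in exactly this form.
  MoveInvariant : ∀ {m n} → ((Fin m → Fin n) → ℕ) → Set
  MoveInvariant {zero}  F = ⊤
  MoveInvariant {suc m} F = ∀ c i → F c ≡ F (c i ∷ removeAt c i)

  avoids-zero : ∀ {m n} (c : Fin m → Fin (suc n)) → (∀ i → c i ≢ zero) → ∃ λ d → ∀ i → c i ≡ suc (d i)
  avoids-zero c c≢0 = (λ i → punchOut (c≢0 i ∘ sym)) , λ i → sym (Fin.punchIn-punchOut (c≢0 i ∘ sym))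

  -- Follows the recursion of `columnChoices`: an occurrence of column 0 is moved to the front and
  -- the rest is sorted behind it; without one, all indices are shifted down. This recursion changes
  -- the functional, hence the general `F`.
  sorted : ∀ {m n} (F : (Fin m → Fin n) → ℕ) → (∀ {c d} → c ≗ d → F c ≡ F d) → MoveInvariant F →
    ∀ c → Injective _≡_ _≡_ c → ∃ λ d → d ∈ columnChoices m n × F c ≡ F (lookup d)
  sorted {zero}          F F-cong F-move c c-inj = Vec.[] , here refl , F-cong λ ()
  sorted {suc m} {zero}  F F-cong F-move c c-inj with c zero
  ... | ()
  sorted {suc m} {suc n} F F-cong F-move c c-inj with any? (λ i → c i Fin.≟ zero)
  ... | no ∄i =
    let (d , c≡d) = avoids-zero c λ i ci≡0 → ∄i (i , ci≡0)
        (e , e∈ , Fe) = sorted (λ d → F (suc ∘ d)) (λ d≗e → F-cong λ i → cong suc (d≗e i))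
          (λ d i → trans (F-move (suc ∘ d) i) (F-cong λ { zero → refl ; (suc j) → refl })) d
          λ {i} {j} di≡dj → c-inj (trans (c≡d i) (trans (cong suc di≡dj) (sym (c≡d j))))
    in Vec.map suc e , ∈-++⁺ʳ _ (∈-map⁺ (Vec.map suc) e∈) ,
       trans (F-cong c≡d) (trans Fe (F-cong λ i → sym (lookup-map i suc e)))
  ... | yes (p , cp≡0) =
    let (d , c≡d) = avoids-zero (removeAt c p)
          λ i ci≡0 → punchInᵢ≢i p i (c-inj (trans ci≡0 (sym cp≡0)))
        (e , e∈ , Fe) = sorted (λ d → F (zero ∷ suc ∘ d))
          (λ d≗e → F-cong λ { zero → refl ; (suc i) → cong suc (d≗e i) }) (move-tail F F-cong F-move) d
          λ {i} {j} di≡dj → punchIn-injective p i j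
            (c-inj (trans (c≡d i) (trans (cong suc di≡dj) (sym (c≡d j)))))
    in zero Vec.∷ Vec.map suc e , ∈-++⁺ˡ (∈-map⁺ (λ c → zero Vec.∷ Vec.map suc c) e∈) ,
       trans (F-move c p) (trans (F-cong λ { zero → cp≡0 ; (suc i) → c≡d i })
         (trans Fe (F-cong λ { zero → refl ; (suc i) → sym (lookup-map i suc e) })))
    where
    move-tail : ∀ {m n} (F : (Fin (suc m) → Fin (suc n)) → ℕ) → (∀ {c d} → c ≗ d → F c ≡ F d) →
      MoveInvariant F → MoveInvariant {m} (λ d → F (zero ∷ suc ∘ d))
    move-tail {zero}  F F-cong F-move = tt
    -- Bringing `suc (d i)` to the front pushes `zero` to the second place; a second move restores
    -- it.
    move-tail {suc m} F F-cong F-move d i = begin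
      F (zero ∷ suc ∘ d)
        ≡⟨ F-move (zero ∷ suc ∘ d) (suc i) ⟩
      F (suc (d i) ∷ removeAt (zero ∷ suc ∘ d) (suc i))
        ≡⟨ F-move (suc (d i) ∷ removeAt (zero ∷ suc ∘ d) (suc i)) (suc zero) ⟩
      F (zero ∷ removeAt (suc (d i) ∷ removeAt (zero ∷ suc ∘ d) (suc i)) (suc zero))
        ≡⟨ F-cong (λ { zero → refl ; (suc zero) → refl ; (suc (suc j)) → refl }) ⟩
      F (zero ∷ suc ∘ (d i ∷ removeAt d i))
        ∎

  injective? : ∀ {m n} (c : Fin m → Fin n) → Injective _≡_ _≡_ c ⊎ ∃ λ i → ∃ λ j → i ≢ j × c i ≡ c j
  injective? c with any? (λ i → any? λ j → ¬? (i Fin.≟ j) ×-dec (c i Fin.≟ c j))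
  ... | yes found = inj₂ found
  ... | no  none  = inj₁ λ {i} {j} ci≡cj →
    decidable-stable (i Fin.≟ j) λ i≢j → none (i , j , i≢j , ci≡cj)

  ∣sgn*∣ : ∀ {n} (i : Fin n) d → ∣ sgn i * d ∣ ≡ ∣ d ∣
  ∣sgn*∣ zero    d = cong ∣_∣ (ℤ.*-identityˡ d)
  ∣sgn*∣ (suc i) d = trans (cong (λ s → ∣ s * d ∣) (sgn-suc i))
    (trans (cong ∣_∣ (sym (ℤ.neg-distribˡ-* (sgn i) d))) (trans (ℤ.∣-i∣≡∣i∣ (sgn i * d)) (∣sgn*∣ i d)))

  module _ {m n} (A : Matrix ℤ m n) where

    -- The columns of A become rows, so that the row operations on determinants act on them.
    column : Matrix ℤ n m
    column l i = A i l

    absMinor : (Fin m → Fin n) → ℕ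
    absMinor c = ∣ Det (column ∘ c) ∣

  absMinor-cong : ∀ {m n} (A : Matrix ℤ m n) {c d} → c ≗ d → absMinor A c ≡ absMinor A d
  absMinor-cong A {c} {d} c≗d = cong ∣_∣ (det-cong (column A ∘ c) (column A ∘ d) λ j i → cong (A i) (c≗d j))

  absMinor-move : ∀ {m n} (A : Matrix ℤ m n) → MoveInvariant (absMinor A)
  absMinor-move {zero}  A = tt
  absMinor-move {suc m} A c i = trans (cong ∣_∣ (det-move (column A ∘ c) i))
    (trans (∣sgn*∣ i (Det (column A (c i) ∷ removeAt (column A ∘ c) i)))
      (cong ∣_∣ (det-cong (column A (c i) ∷ removeAt (column A ∘ c) i) (column A ∘ (c i ∷ removeAt c i))
        λ { zero j → refl ; (suc r) j → refl })))

  module _ {m n} (A : Matrix ℤ m n) where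

    absMinor-∈ : ∀ c → Injective _≡_ _≡_ c → absMinor A c ∈ absMinors A
    absMinor-∈ c c-inj =
      let (d , d∈ , eq) = sorted (absMinor A) (absMinor-cong A) (absMinor-move A) c c-inj
      in subst (_∈ absMinors A)
           (trans (cong ∣_∣ (sym (trans (det-transpose (λ i j → A i (lookup d j))) (Det≡det _)))) (sym eq))
           (∈-map⁺ (λ c → ∣ det (λ i j → A i (lookup c j)) ∣) d∈)

    -- A repeated column makes the minor 0, so any column may later be exchanged for any other
    -- without a case distinction.
    absMinor≤max : ∀ c → absMinor A c ℕ.≤ maxMinor A
    absMinor≤max c with injective? c
    ... | inj₁ c-inj = All.lookup (xs≤max 0 (absMinors A)) (absMinor-∈ c c-inj)
    ... | inj₂ (i , j , i≢j , ci≡cj) = subst (ℕ._≤ maxMinor A)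
      (cong ∣_∣ (sym (det-equal-rows (column A ∘ c) i≢j λ r → cong (A r) ci≡cj))) ℕ.z≤n

    min≤absMinor : ∀ c → Injective _≡_ _≡_ c → minMinor A ℕ.≤ absMinor A c
    min≤absMinor c c-inj = All.lookup (min≤xs (maxMinor A) (absMinors A)) (absMinor-∈ c c-inj)

  record IsPartition {m k n} (c : Fin m → Fin n) (N : Fin k → Fin n) : Set where
    field
      split   : ∀ F → ∑ℤ F ≡ ∑ℤ (F ∘ c) + ∑ℤ (F ∘ N)
      cover   : ∀ l → (∃ λ i → c i ≡ l) ⊎ (∃ λ j → N j ≡ l)
      c-inj   : Injective _≡_ _≡_ c
      N-inj   : Injective _≡_ _≡_ N
      c≢N     : ∀ i j → c i ≢ N j

  partition : ∀ {m n} c → c ∈ columnChoices m n →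
    ∃ λ k → m ℕ.+ k ≡ n × ∃ λ (N : Fin k → Fin n) → IsPartition (lookup c) N
  partition {zero} {n} Vec.[] _ = n , refl , id , record
    { split = λ F → sym (ℤ.+-identityˡ (∑ℤ F))
    ; cover = λ l → inj₂ (l , refl)
    ; c-inj = λ { {()} }
    ; N-inj = id
    ; c≢N   = λ ()
    }
  partition {suc m} {suc n} c c∈ with ∈-++⁻ (List.map (λ c → zero Vec.∷ Vec.map suc c) (columnChoices m n)) c∈
  ... | inj₁ c∈ˡ with ∈-map⁻ (λ c → zero Vec.∷ Vec.map suc c) c∈ˡ
  ... | d , d∈ , refl with partition d d∈
  ... | k , m+k≡n , N , part = k , cong suc m+k≡n , suc ∘ N , record
    { split = λ F → trans (cong (λ z → F zero + z) (split (F ∘ suc)))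
        (trans (sym (ℤ.+-assoc (F zero) (∑ℤ (F ∘ suc ∘ lookup d)) (∑ℤ (F ∘ suc ∘ N))))
          (cong (λ z → F zero + z + ∑ℤ (F ∘ suc ∘ N)) (sum-cong-≗ λ i → cong F (sym (lookup-map i suc d)))))
    ; cover = λ { zero → inj₁ (zero , refl)
                ; (suc l) → lift (cover l) }
    ; c-inj = λ { {zero} {zero} _ → refl
                ; {zero} {suc j} eq → contradiction (trans eq (lookup-map j suc d)) λ ()
                ; {suc i} {zero} eq → contradiction (trans (sym eq) (lookup-map i suc d)) λ ()
                ; {suc i} {suc j} eq → cong suc (c-inj (suc-injective
                    (trans (sym (lookup-map i suc d)) (trans eq (lookup-map j suc d))))) }
    ; N-inj = λ eq → N-inj (suc-injective eq)
    ; c≢N   = λ { zero j () ; (suc i) j eq → c≢N i j (suc-injective (trans (sym (lookup-map i suc d)) eq)) }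
    }
    where
    open IsPartition part
    open import Algebra.Properties.Semiring.Sum ℤ.+-*-semiring using (sum-cong-≗)
    lift : ∀ {l} → (∃ λ i → lookup d i ≡ l) ⊎ (∃ λ j → N j ≡ l) →
      (∃ λ i → lookup (zero Vec.∷ Vec.map suc d) i ≡ suc l) ⊎ (∃ λ j → suc (N j) ≡ suc l)
    lift (inj₁ (i , eq)) = inj₁ (suc i , trans (lookup-map i suc d) (cong suc eq))
    lift (inj₂ (j , eq)) = inj₂ (j , cong suc eq)
  partition {suc m} {suc n} c c∈ | inj₂ c∈ʳ with ∈-map⁻ (Vec.map suc) c∈ʳ
  ... | d , d∈ , refl with partition d d∈
  ... | k , m+k≡n , N , part = suc k , trans (ℕ.+-suc (suc m) k) (cong suc m+k≡n) , zero ∷ suc ∘ N , record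
    { split = λ F → trans (cong (λ z → F zero + z) (split (F ∘ suc)))
        (trans (swap (F zero) (∑ℤ (F ∘ suc ∘ lookup d)) (∑ℤ (F ∘ suc ∘ N)))
          (cong (λ z → z + (F zero + ∑ℤ (F ∘ suc ∘ N))) (sum-cong-≗ λ i → cong F (sym (lookup-map i suc d)))))
    ; cover = λ { zero → inj₂ (zero , refl) ; (suc l) → lift (cover l) }
    ; c-inj = λ {i} {j} eq → c-inj (suc-injective (trans (sym (lookup-map i suc d)) (trans eq (lookup-map j suc d))))
    ; N-inj = λ { {zero} {zero} _ → refl ; {suc i} {suc j} eq → cong suc (N-inj (suc-injective eq)) }
    ; c≢N   = λ { i zero eq → contradiction (trans (sym eq) (lookup-map i suc d)) λ ()
                ; i (suc j) eq → c≢N i j (suc-injective (trans (sym (lookup-map i suc d)) eq)) }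
    }
    where
    open IsPartition part
    open import Algebra.Properties.Semiring.Sum ℤ.+-*-semiring using (sum-cong-≗)
    open import Data.Integer.Tactic.RingSolver using (solve-∀)
    swap : ∀ x y z → x + (y + z) ≡ y + (x + z)
    swap = solve-∀
    lift : ∀ {l} → (∃ λ i → lookup d i ≡ l) ⊎ (∃ λ j → N j ≡ l) →
      (∃ λ i → lookup (Vec.map suc d) i ≡ suc l) ⊎ (∃ λ j → (zero ∷ suc ∘ N) j ≡ suc l)
    lift (inj₁ (i , eq)) = inj₁ (i , trans (lookup-map i suc d) (cong suc eq))
    lift (inj₂ (j , eq)) = inj₂ (suc j , cong suc eq)

  maxMinor-attained : ∀ {m n} (A : Matrix ℤ m n) → ℕ.NonZero (maxMinor A) →
    ∃ λ c → c ∈ columnChoices m n × absMinor A (lookup c) ≡ maxMinor A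
  maxMinor-attained A M≢0 with argmax-sel id 0 (absMinors A)
  -- The maximum could be the default value 0 of `max` instead of a minor; M ≠ 0 excludes this.
  ... | inj₁ M≡0 = contradiction M≡0 (ℕ.≢-nonZero⁻¹ (maxMinor A) {{M≢0}})
  ... | inj₂ M∈ with ∈-map⁻ (λ c → ∣ det (λ i j → A i (lookup c j)) ∣) M∈
  ... | c , c∈ , eq = c , c∈ , trans (cong ∣_∣ (trans (det-transpose (λ i j → A i (lookup c j))) (Det≡det _))) (sym eq)

-- Numerical inequalities: binomial coefficients, factorials and powers.

module Estimates where

  open Determinant
  open CauchyBinet
  open Minors
  open import Defs using (Matrix; det; gram; columnChoices; maxMinor)
  open import Data.Integer using (∣_∣)
  open import Data.List as List using (List; length)
  import Data.List.Properties as List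
  open import Data.Nat
  open import Data.Nat.Properties
  open import Data.Nat.Tactic.RingSolver using (solve-∀)
  open import Data.Vec as Vec using (lookup)
  open ≤-Reasoning

  ∣sumOver∣≤ : ∀ {X : Set} (xs : List X) f b → (∀ x → ∣ f x ∣ ≤ b) → ∣ sumOver xs f ∣ ≤ length xs * b
  ∣sumOver∣≤ List.[]       f b f≤b = z≤n
  ∣sumOver∣≤ (x List.∷ xs) f b f≤b = ≤-trans (ℤ.∣i+j∣≤∣i∣+∣j∣ (f x) (sumOver xs f))
    (+-mono-≤ (f≤b x) (∣sumOver∣≤ xs f b f≤b))

  ∣det-gram∣≤ : ∀ {m n} (A : Matrix ℤ m n) →
    ∣ det (gram A) ∣ ≤ length (columnChoices m n) * (maxMinor A * maxMinor A)
  ∣det-gram∣≤ {m} {n} A = begin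
    ∣ det (gram A) ∣          ≡⟨ cong ∣_∣ (trans (sym (Det≡det (gram A))) (cauchy-binet A A)) ⟩
    ∣ sumOver (columnChoices m n) (λ c → Det (columns A (lookup c)) ℤ.* Det (columns A (lookup c))) ∣
      ≤⟨ ∣sumOver∣≤ (columnChoices m n) (λ c → Det (columns A (lookup c)) ℤ.* Det (columns A (lookup c))) (maxMinor A * maxMinor A) (λ c → begin
           ∣ Det (columns A (lookup c)) ℤ.* Det (columns A (lookup c)) ∣
             ≡⟨ ℤ.abs-* (Det (columns A (lookup c))) (Det (columns A (lookup c))) ⟩
           ∣ Det (columns A (lookup c)) ∣ * ∣ Det (columns A (lookup c)) ∣
             ≤⟨ *-mono-≤ (minor≤ c) (minor≤ c) ⟩
           maxMinor A * maxMinor A ∎) ⟩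
    length (columnChoices m n) * (maxMinor A * maxMinor A) ∎
    where
    minor≤ : ∀ c → ∣ Det (columns A (lookup c)) ∣ ≤ maxMinor A
    minor≤ c = subst (_≤ maxMinor A) (cong ∣_∣ (det-transpose (columns A (lookup c)))) (absMinor≤max A (lookup c))

  -- The first two terms of the binomial expansion. They drive the count of column choices, the
  -- simplex count and the estimate 2 kᵏ ≤ (k + 1)ᵏ.
  ^-bernoulli : ∀ x a k → x ^ suc k + suc k * (a * x ^ k) ≤ (x + a) ^ suc k
  ^-bernoulli x a zero    = ≤-reflexive (eq x a)
    where
    eq : ∀ x a → x * 1 + 1 * (a * 1) ≡ (x + a) * 1
    eq = solve-∀
  ^-bernoulli x a (suc k) = begin
    x * (x * x ^ k) + suc (suc k) * (a * (x * x ^ k))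
      ≤⟨ m≤m+n _ (suc k * (a * a * x ^ k)) ⟩
    x * (x * x ^ k) + suc (suc k) * (a * (x * x ^ k)) + suc k * (a * a * x ^ k)
      ≡⟨ eq x a (x ^ k) k ⟩
    (x + a) * (x ^ suc k + suc k * (a * x ^ k))
      ≤⟨ *-monoʳ-≤ (x + a) (^-bernoulli x a k) ⟩
    (x + a) * (x + a) ^ suc k
      ∎
    where
    eq : ∀ x a p k → x * (x * p) + (1 + (1 + k)) * (a * (x * p)) + (1 + k) * (a * a * p) ≡
                     (x + a) * (x * p + (1 + k) * (a * p))
    eq = solve-∀

  ^-distribʳ-* : ∀ k x y → (x * y) ^ k ≡ x ^ k * y ^ k
  ^-distribʳ-* zero    x y = refl
  ^-distribʳ-* (suc k) x y = trans (cong (x * y *_) (^-distribʳ-* k x y)) (eq x y (x ^ k) (y ^ k))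
    where
    eq : ∀ x y p q → x * y * (p * q) ≡ x * p * (y * q)
    eq = solve-∀

  n!≤n^n : ∀ n → n ! ≤ n ^ n
  n!≤n^n zero    = ≤-refl
  n!≤n^n (suc n) = *-monoʳ-≤ (suc n) (≤-trans (n!≤n^n n) (^-monoˡ-≤ n (n≤1+n n)))

  n≤n! : ∀ n → n ≤ n !
  n≤n! zero    = z≤n
  n≤n! (suc n) = ≤-trans (≤-reflexive (sym (*-identityʳ (suc n)))) (*-monoʳ-≤ (suc n) (1≤n! n))

  length-columnChoices-suc : ∀ m n → length (columnChoices (suc m) (suc n)) ≡
    length (columnChoices m n) + length (columnChoices (suc m) n)
  length-columnChoices-suc m n = trans (List.length-++ (List.map (λ c → Data.Fin.zero Vec.∷ Vec.map Data.Fin.suc c) (columnChoices m n)))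
    (cong₂ _+_ (List.length-map _ (columnChoices m n)) (List.length-map _ (columnChoices (suc m) n)))
    where import Data.Fin

  length-columnChoices-< : ∀ {m n} → n < m → length (columnChoices m n) ≡ 0
  length-columnChoices-< {suc m} {zero}  n<m = refl
  length-columnChoices-< {suc m} {suc n} (s≤s n<m) = trans (length-columnChoices-suc m n)
    (cong₂ _+_ (length-columnChoices-< n<m) (length-columnChoices-< (m<n⇒m<1+n n<m)))

  length-columnChoices-1 : ∀ n → length (columnChoices 1 n) ≡ n
  length-columnChoices-1 zero    = refl
  length-columnChoices-1 (suc n) = trans (length-columnChoices-suc 0 n) (cong suc (length-columnChoices-1 n))

  -- The left side is the product (m + 1) ⋯ (m + k). In the step from N to N + 1 columns, Pascal's
  -- rule leaves Nᵏ⁺¹ + (k + 1) Nᵏ ≤ (N + 1)ᵏ⁺¹.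
  length-columnChoices-≤ : ∀ m k → length (columnChoices m (m + k)) * k ! ≤ (m + k) ^ k
  length-columnChoices-≤ zero    k = ≤-trans (≤-reflexive (*-identityˡ (k !))) (n!≤n^n k)
  length-columnChoices-≤ (suc m) zero = begin
    length (columnChoices (suc m) (suc (m + 0))) * 1
      ≡⟨ cong (_* 1) (trans (length-columnChoices-suc m (m + 0))
           (trans (cong (λ l → length (columnChoices m (m + 0)) + l) (length-columnChoices-< (s≤s (≤-reflexive (+-identityʳ m)))))
             (+-identityʳ _))) ⟩
    length (columnChoices m (m + 0)) * 1  ≤⟨ length-columnChoices-≤ m zero ⟩
    1 ∎
  length-columnChoices-≤ (suc m) (suc k) = begin
    length (columnChoices (suc m) (suc (m + suc k))) * (suc k) !
      ≡⟨ cong (_* (suc k) !) (length-columnChoices-suc m (m + suc k)) ⟩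
    (length (columnChoices m (m + suc k)) + length (columnChoices (suc m) (m + suc k))) * (suc k) !
      ≡⟨ cong (λ l → (length (columnChoices m (m + suc k)) + length (columnChoices (suc m) l)) * (suc k) !) (+-suc m k) ⟩
    (length (columnChoices m (m + suc k)) + length (columnChoices (suc m) (suc m + k))) * (suc k) !
      ≡⟨ *-distribʳ-+ ((suc k) !) (length (columnChoices m (m + suc k))) _ ⟩
    length (columnChoices m (m + suc k)) * (suc k) ! + length (columnChoices (suc m) (suc m + k)) * (suc k * k !)
      ≤⟨ +-mono-≤ (length-columnChoices-≤ m (suc k)) (begin
           length (columnChoices (suc m) (suc m + k)) * (suc k * k !)
             ≡⟨ eq (length (columnChoices (suc m) (suc m + k))) (suc k) (k !) ⟩
           suc k * (1 * (length (columnChoices (suc m) (suc m + k)) * k !))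
             ≤⟨ *-monoʳ-≤ (suc k) (*-monoʳ-≤ 1 (length-columnChoices-≤ (suc m) k)) ⟩
           suc k * (1 * (suc m + k) ^ k) ∎) ⟩
    (m + suc k) ^ suc k + suc k * (1 * (suc m + k) ^ k)
      ≡⟨ cong (λ l → (m + suc k) ^ suc k + suc k * (1 * l ^ k)) (sym (+-suc m k)) ⟩
    (m + suc k) ^ suc k + suc k * (1 * (m + suc k) ^ k)
      ≤⟨ ^-bernoulli (m + suc k) 1 k ⟩
    (m + suc k + 1) ^ suc k
      ≡⟨ cong (_^ suc k) (+-comm (m + suc k) 1) ⟩
    suc (m + suc k) ^ suc k
      ∎
    where
    eq : ∀ l s f → l * (s * f) ≡ s * (1 * (l * f))
    eq = solve-∀

  -- (1 + 1/k)ʲ ≤ 1 + j/k + (j/k)² for j ≤ k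
  [1+1/k]^j≤ : ∀ k j → j ≤ k → suc k ^ j * (k * k) ≤ k ^ j * (k * k + j * k + j * j)
  [1+1/k]^j≤ k zero    j≤k = ≤-reflexive (cong (1 *_) (eq k))
    where
    eq : ∀ k → k * k ≡ k * k + 0 * k + 0 * 0
    eq = solve-∀
  [1+1/k]^j≤ k (suc j) j<k = begin
    suc k * suc k ^ j * (k * k)
      ≡⟨ *-assoc (suc k) (suc k ^ j) (k * k) ⟩
    suc k * (suc k ^ j * (k * k))
      ≤⟨ *-monoʳ-≤ (suc k) ([1+1/k]^j≤ k j (<⇒≤ j<k)) ⟩
    suc k * (k ^ j * (k * k + j * k + j * j))
      ≡⟨ expand k j (k ^ j) ⟩
    k ^ j * (k * (k * k + j * k + j * j) + k * k + j * k + j * j)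
      ≤⟨ *-monoʳ-≤ (k ^ j) (+-monoʳ-≤ (k * (k * k + j * k + j * j) + k * k + j * k) (*-monoʳ-≤ j (<⇒≤ j<k))) ⟩
    k ^ j * (k * (k * k + j * k + j * j) + k * k + j * k + j * k)
      ≤⟨ *-monoʳ-≤ (k ^ j) (m≤m+n _ k) ⟩
    k ^ j * (k * (k * k + j * k + j * j) + k * k + j * k + j * k + k)
      ≡⟨ collect k j (k ^ j) ⟩
    k * k ^ j * (k * k + suc j * k + suc j * suc j)
      ∎
    where
    expand : ∀ k j p → (1 + k) * (p * (k * k + j * k + j * j)) ≡ p * (k * (k * k + j * k + j * j) + k * k + j * k + j * j)
    expand = solve-∀
    collect : ∀ k j p → p * (k * (k * k + j * k + j * j) + k * k + j * k + j * k + k) ≡ k * p * (k * k + (1 + j) * k + (1 + j) * (1 + j))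
    collect = solve-∀

  [1+k]^k≤3*k^k : ∀ k → .{{NonZero k}} → suc k ^ k ≤ 3 * k ^ k
  [1+k]^k≤3*k^k k@(suc _) = *-cancelʳ-≤ _ _ (k * k) (begin
    suc k ^ k * (k * k)              ≤⟨ [1+1/k]^j≤ k k ≤-refl ⟩
    k ^ k * (k * k + k * k + k * k)  ≡⟨ eq (k ^ k) (k * k) ⟩
    3 * k ^ k * (k * k)              ∎)
    where
    eq : ∀ p s → p * (s + s + s) ≡ 3 * p * s
    eq = solve-∀

  -- The quotient of consecutive values of kᵏ / k! is (1 + 1/k)ᵏ, which tends to e, so 3 is the
  -- least integer that bounds it for all k.
  k^k≤k!*3^k : ∀ k → k ^ k ≤ k ! * 3 ^ k
  k^k≤k!*3^k zero          = ≤-refl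
  k^k≤k!*3^k (suc zero)    = s≤s z≤n
  k^k≤k!*3^k (suc k@(suc _)) = begin
    suc k * suc k ^ k          ≤⟨ *-monoʳ-≤ (suc k) ([1+k]^k≤3*k^k k) ⟩
    suc k * (3 * k ^ k)        ≤⟨ *-monoʳ-≤ (suc k) (*-monoʳ-≤ 3 (k^k≤k!*3^k k)) ⟩
    suc k * (3 * (k ! * 3 ^ k)) ≡⟨ eq (suc k) (k !) (3 ^ k) ⟩
    suc k * k ! * (3 * 3 ^ k)  ∎
    where
    eq : ∀ s f p → s * (3 * (f * p)) ≡ s * f * (3 * p)
    eq = solve-∀

  -- For m = 1 there are n = k + 1 minors, and the two factors k! of the squared simplex count have
  -- to pay for n (k/n)ᵏ. They do, because k + 1 ≤ 2k ≤ 2 (k!)² and 2 kᵏ ≤ (k + 1)ᵏ.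
  [1+k]*k^k≤ : ∀ k → .{{NonZero k}} → suc k * k ^ k ≤ suc k ^ k * (k ! * k !)
  [1+k]*k^k≤ (suc j) = begin
    suc k * k ^ k                      ≤⟨ *-monoˡ-≤ (k ^ k) (≤-trans (+-monoˡ-≤ k (s≤s z≤n)) (≤-reflexive (double k))) ⟩
    2 * k * k ^ k                      ≤⟨ *-monoˡ-≤ (k ^ k) (*-monoʳ-≤ 2 (≤-trans (≤-reflexive (sym (*-identityʳ k)))
                                            (*-mono-≤ (n≤n! k) (1≤n! k)))) ⟩
    2 * (k ! * k !) * k ^ k            ≡⟨ eq (k !) k (k ^ j) ⟩
    (k * k ^ j + k * (1 * k ^ j)) * (k ! * k !)  ≤⟨ *-monoˡ-≤ (k ! * k !) (^-bernoulli k 1 j) ⟩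
    (k + 1) ^ k * (k ! * k !)          ≡⟨ cong (λ l → l ^ k * (k ! * k !)) (+-comm k 1) ⟩
    suc k ^ k * (k ! * k !)            ∎
    where
    k = suc j
    double : ∀ k → k + k ≡ 2 * k
    double = solve-∀
    eq : ∀ f k p → 2 * (f * f) * (k * p) ≡ (k * p + k * (1 * p)) * (f * f)
    eq = solve-∀

  -- For a = μ and b = M this is (n choose k) (k/n)ᵏ ρ²ᵏ ≤ 1 without denominators. The number r
  -- bounds 1 / ρ² from below, and rᵏ makes up for kᵏ / k!, which is what (n choose k) k! ≤ nᵏ
  -- leaves over.
  choices*[m²k]^k≤ : ∀ m k a b r → r * (a * a) ≤ b * b → k ^ k ≤ k ! * r ^ k →
    length (columnChoices m (m + k)) * (a * a * k) ^ k ≤ (b * b * (m + k)) ^ k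
  choices*[m²k]^k≤ m k a b r ra²≤b² k^k≤ = begin
    L * (a * a * k) ^ k              ≡⟨ cong (L *_) (^-distribʳ-* k (a * a) k) ⟩
    L * ((a * a) ^ k * k ^ k)        ≤⟨ *-monoʳ-≤ L (*-monoʳ-≤ ((a * a) ^ k) k^k≤) ⟩
    L * ((a * a) ^ k * (k ! * r ^ k)) ≡⟨ eq L ((a * a) ^ k) (k !) (r ^ k) ⟩
    r ^ k * (a * a) ^ k * (L * k !)  ≡⟨ cong (_* (L * k !)) (^-distribʳ-* k r (a * a)) ⟨
    (r * (a * a)) ^ k * (L * k !)    ≤⟨ *-mono-≤ (^-monoˡ-≤ k ra²≤b²) (length-columnChoices-≤ m k) ⟩
    (b * b) ^ k * (m + k) ^ k        ≡⟨ ^-distribʳ-* k (b * b) (m + k) ⟨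
    (b * b * (m + k)) ^ k            ∎
    where
    L = length (columnChoices m (m + k))
    eq : ∀ L x f y → L * (x * (f * y)) ≡ y * x * (L * f)
    eq = solve-∀

  ^-distribʳ-*³ : ∀ k x y z → (x * y * z) ^ k ≡ x ^ k * y ^ k * z ^ k
  ^-distribʳ-*³ k x y z = trans (^-distribʳ-* k (x * y) z) (cong (_* z ^ k) (^-distribʳ-* k x y))

  -- Here a = μ, b = M and L is the number of minors. Of the four factors a, two go with the square
  -- of the lattice point count and two with the number of minors.
  box-bound : ∀ s G L a b k n q e →
    G ≤ L * (b * b) → L * (a * a * k) ^ k ≤ (b * b * n) ^ k → s * b * (q * a) ^ k ≤ e ^ k →
    s * s * G * (a * a * a * a * k * q * q) ^ k ≤ (n * e * e * b * b) ^ k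
  box-bound s G L a b k n q e G≤ L≤ s≤ = begin
    s * s * G * (a * a * a * a * k * q * q) ^ k
      ≤⟨ *-monoˡ-≤ _ (*-monoʳ-≤ (s * s) G≤) ⟩
    s * s * (L * (b * b)) * (a * a * a * a * k * q * q) ^ k
      ≡⟨ cong (λ x → s * s * (L * (b * b)) * x ^ k) (regroup a k q) ⟩
    s * s * (L * (b * b)) * (q * a * (q * a) * (a * a * k)) ^ k
      ≡⟨ cong (s * s * (L * (b * b)) *_) (^-distribʳ-*³ k (q * a) (q * a) (a * a * k)) ⟩
    s * s * (L * (b * b)) * ((q * a) ^ k * (q * a) ^ k * (a * a * k) ^ k)
      ≡⟨ split s L b ((q * a) ^ k) ((a * a * k) ^ k) ⟩
    s * b * (q * a) ^ k * (s * b * (q * a) ^ k) * (L * (a * a * k) ^ k)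
      ≤⟨ *-mono-≤ (*-mono-≤ s≤ s≤) L≤ ⟩
    e ^ k * e ^ k * (b * b * n) ^ k
      ≡⟨ ^-distribʳ-*³ k e e (b * b * n) ⟨
    (e * e * (b * b * n)) ^ k
      ≡⟨ cong (_^ k) (reorder e b n) ⟩
    (n * e * e * b * b) ^ k
      ∎
    where
    regroup : ∀ a k q → a * a * a * a * k * q * q ≡ q * a * (q * a) * (a * a * k)
    regroup = solve-∀
    split : ∀ s L b x y → s * s * (L * (b * b)) * (x * x * y) ≡ s * b * x * (s * b * x) * (L * y)
    split = solve-∀
    reorder : ∀ e b n → e * e * (b * b * n) ≡ n * e * e * b * b
    reorder = solve-∀

  simplex-bound : ∀ s G a b k q p → .{{NonZero k}} → a ≤ b →
    G ≤ suc k * (b * b) → s * b * k ! * (q * a) ^ k ≤ (p * (suc k * b)) ^ k →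
    s * s * G * (a * a * a * a * k * q * q) ^ k ≤
    (suc k * (p * (k * b + a)) * (p * (k * b + a)) * b * b) ^ k
  simplex-bound s G a b k q p a≤b G≤ s≤ = begin
    s * s * G * (a * a * a * a * k * q * q) ^ k
      ≤⟨ *-monoˡ-≤ _ (*-monoʳ-≤ (s * s) G≤) ⟩
    s * s * (suc k * (b * b)) * (a * a * a * a * k * q * q) ^ k
      ≡⟨ cong (λ x → s * s * (suc k * (b * b)) * x ^ k) (regroup a k q) ⟩
    s * s * (suc k * (b * b)) * (q * a * (q * a) * (a * a * k)) ^ k
      ≡⟨ cong (s * s * (suc k * (b * b)) *_) (trans (^-distribʳ-*³ k (q * a) (q * a) (a * a * k))
           (cong ((q * a) ^ k * (q * a) ^ k *_) (^-distribʳ-* k (a * a) k))) ⟩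
    s * s * (suc k * (b * b)) * ((q * a) ^ k * (q * a) ^ k * ((a * a) ^ k * k ^ k))
      ≡⟨ split s k b ((q * a) ^ k) ((a * a) ^ k) (k ^ k) ⟩
    s * b * (q * a) ^ k * (s * b * (q * a) ^ k) * (a * a) ^ k * (suc k * k ^ k)
      ≤⟨ *-monoʳ-≤ (s * b * (q * a) ^ k * (s * b * (q * a) ^ k) * (a * a) ^ k) ([1+k]*k^k≤ k) ⟩
    s * b * (q * a) ^ k * (s * b * (q * a) ^ k) * (a * a) ^ k * (suc k ^ k * (k ! * k !))
      ≡⟨ join (s * b) ((q * a) ^ k) ((a * a) ^ k) (suc k ^ k) (k !) ⟩
    s * b * k ! * (q * a) ^ k * (s * b * k ! * (q * a) ^ k) * (suc k ^ k * (a * a) ^ k)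
      ≤⟨ *-monoˡ-≤ _ (*-mono-≤ s≤ s≤) ⟩
    (p * (suc k * b)) ^ k * (p * (suc k * b)) ^ k * (suc k ^ k * (a * a) ^ k)
      ≡⟨ trans (^-distribʳ-*³ k (p * (suc k * b)) (p * (suc k * b)) (suc k * (a * a)))
           (cong ((p * (suc k * b)) ^ k * (p * (suc k * b)) ^ k *_) (^-distribʳ-* k (suc k) (a * a))) ⟨
    -- In the simplex case k! has already paid for the minors. The spare a² turns the two factors (k
    -- + 1) b of the count into (k + 1) a, which is at most the k b + a of the box case.
    (p * (suc k * b) * (p * (suc k * b)) * (suc k * (a * a))) ^ k
      ≡⟨ cong (_^ k) (reorder p k b a) ⟩
    (suc k * (p * (suc k * a)) * (p * (suc k * a)) * b * b) ^ k
      ≤⟨ ^-monoˡ-≤ k (*-monoˡ-≤ b (*-monoˡ-≤ b (*-mono-≤ (*-monoʳ-≤ (suc k) (*-monoʳ-≤ p ka≤)) (*-monoʳ-≤ p ka≤)))) ⟩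
    (suc k * (p * (k * b + a)) * (p * (k * b + a)) * b * b) ^ k
      ∎
    where
    ka≤ : suc k * a ≤ k * b + a
    ka≤ = ≤-trans (≤-reflexive (+-comm a (k * a))) (+-monoˡ-≤ a (*-monoʳ-≤ k a≤b))
    regroup : ∀ a k q → a * a * a * a * k * q * q ≡ q * a * (q * a) * (a * a * k)
    regroup = solve-∀
    split : ∀ s k b x y z → s * s * ((1 + k) * (b * b)) * (x * x * (y * z)) ≡ s * b * x * (s * b * x) * y * ((1 + k) * z)
    split = solve-∀
    join : ∀ t x y z f → t * x * (t * x) * y * (z * (f * f)) ≡ t * f * x * (t * f * x) * (z * y)
    join = solve-∀
    reorder : ∀ p k b a → p * ((1 + k) * b) * (p * ((1 + k) * b)) * ((1 + k) * (a * a)) ≡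
                          (1 + k) * (p * ((1 + k) * a)) * (p * ((1 + k) * a)) * b * b
    reorder = solve-∀

-- Residue classes modulo the lattice spanned by a square matrix.

module Lattice where

  open Determinant
  open CauchyBinet
  open Minors
  open import Defs using (Matrix; ∑ℤ)
  open import Data.Fin using (remQuot; combine)
  open import Data.Fin.Properties as Fin using (any?; punchInᵢ≢i; punchIn-punchOut; toℕ-injective; toℕ<n; combine-remQuot)
  open import Data.Integer using (_+_; _*_; -_; _-_; ∣_∣)
  import Data.Integer.DivMod as ℤ
  open import Data.Integer.Tactic.RingSolver using (solve-∀)
  open import Data.Product using (uncurry)
  open import Data.Vec.Functional using (updateAt)
  open import Data.Vec.Functional.Properties using (updateAt-updates; updateAt-minimal)
  open import Relation.Nullary.Decidable using (¬?; _×-dec_; decidable-stable)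
  open import Algebra.Properties.Semiring.Sum ℤ.+-*-semiring using (sum-cong-≗; ∑-distrib-+; ∑-comm; sum-remove; *-distribˡ-sum; *-distribʳ-sum)
  import Algebra.Properties.CommutativeMonoid.Sum ℕ.+-0-commutativeMonoid as ℕSum
  open ≡-Reasoning

  δ : ∀ {n} → Fin n → Fin n → ℤ
  δ zero    zero    = 1ℤ
  δ zero    (suc j) = 0ℤ
  δ (suc i) zero    = 0ℤ
  δ (suc i) (suc j) = δ i j

  ∑-δ : ∀ {n} i (x : Vector ℤ n) → ∑ℤ (λ j → δ i j * x j) ≡ x i
  ∑-δ {suc n} zero    x = trans (cong₂ _+_ (ℤ.*-identityˡ (x zero)) (sum-zero {n} {f = λ j → 0ℤ * x (suc j)} λ j → refl))
    (ℤ.+-identityʳ (x zero))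
  ∑-δ {suc n} (suc i) x = trans (ℤ.+-identityˡ (∑ℤ λ j → δ i j * x (suc j))) (∑-δ i (x ∘ suc))

  Span : ∀ {k m} → Matrix ℤ k m → Vector ℤ m → Set
  Span {k} w x = ∃ λ (t : Vector ℤ k) → ∀ r → x r ≡ ∑ℤ λ i → t i * w i r

  module _ {k m} (w : Matrix ℤ k m) where

    span-generator : ∀ i → Span w (w i)
    span-generator i = δ i , λ r → sym (∑-δ i λ j → w j r)

    span-+* : ∀ {x y} c → Span w x → Span w y → Span w (λ r → x r + c * y r)
    span-+* {x} {y} c (t , x≡) (u , y≡) = (λ i → t i + c * u i) , λ r → begin
      x r + c * y r
        ≡⟨ cong₂ (λ a b → a + c * b) (x≡ r) (y≡ r) ⟩
      ∑ℤ (λ i → t i * w i r) + c * ∑ℤ (λ i → u i * w i r)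
        ≡⟨ cong (λ z → ∑ℤ (λ i → t i * w i r) + z) (*-distribˡ-sum c λ i → u i * w i r) ⟩
      ∑ℤ (λ i → t i * w i r) + ∑ℤ (λ i → c * (u i * w i r))
        ≡⟨ ∑-distrib-+ (λ i → t i * w i r) (λ i → c * (u i * w i r)) ⟨
      ∑ℤ (λ i → t i * w i r + c * (u i * w i r))
        ≡⟨ sum-cong-≗ (λ i → collect (t i) c (u i) (w i r)) ⟩
      ∑ℤ (λ i → (t i + c * u i) * w i r)
        ∎
      where
      collect : ∀ t c u w → t * w + c * (u * w) ≡ (t + c * u) * w
      collect = solve-∀

    span-cong : ∀ {x y} → (∀ r → x r ≡ y r) → Span w x → Span w y
    span-cong x≡y (t , x≡) = t , λ r → trans (sym (x≡y r)) (x≡ r)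

  span-trans : ∀ {k l m} {w : Matrix ℤ k m} {w′ : Matrix ℤ l m} {x} →
    (∀ i → Span w′ (w i)) → Span w x → Span w′ x
  span-trans {w = w} {w′} {x} w⊆w′ (t , x≡) = (λ j → ∑ℤ λ i → t i * T i j) , λ r → begin
    x r
      ≡⟨ x≡ r ⟩
    ∑ℤ (λ i → t i * w i r)
      ≡⟨ sum-cong-≗ (λ i → trans (cong (t i *_) (proj₂ (w⊆w′ i) r)) (*-distribˡ-sum (t i) λ j → T i j * w′ j r)) ⟩
    ∑ℤ (λ i → ∑ℤ λ j → t i * (T i j * w′ j r))
      ≡⟨ ∑-comm (λ i j → t i * (T i j * w′ j r)) ⟩
    ∑ℤ (λ j → ∑ℤ λ i → t i * (T i j * w′ j r))
      ≡⟨ sum-cong-≗ (λ j → trans (sum-cong-≗ λ i → sym (ℤ.*-assoc (t i) (T i j) (w′ j r)))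
           (sym (*-distribʳ-sum (w′ j r) λ i → t i * T i j))) ⟩
    ∑ℤ (λ j → ∑ℤ (λ i → t i * T i j) * w′ j r)
      ∎
    where
    T = λ i → proj₁ (w⊆w′ i)

  addRow : ∀ {k m} → Matrix ℤ k m → Fin k → ℤ → Fin k → Matrix ℤ k m
  addRow w p c q = updateAt w p λ v r → v r + c * w q r

  module _ {k m} (w : Matrix ℤ k m) (p q : Fin k) (c : ℤ) where

    addRow-at : ∀ r → addRow w p c q p r ≡ w p r + c * w q r
    addRow-at r = cong (λ v → v r) (updateAt-updates p w)

    addRow-off : ∀ {i} → i ≢ p → ∀ r → addRow w p c q i r ≡ w i r
    addRow-off {i} i≢p r = cong (λ v → v r) (updateAt-minimal i p w i≢p)

    addRow-span : q ≢ p → ∀ {x} → Span w x → Span (addRow w p c q) x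
    addRow-span q≢p = span-trans generator
      where
      w′ = addRow w p c q
      cancel : ∀ a c b → a + c * b + - c * b ≡ a
      cancel = solve-∀
      generator : ∀ i → Span w′ (w i)
      generator i with i Fin.≟ p
      ... | yes refl = span-cong w′
        (λ r → trans (cong₂ (λ a b → a + - c * b) (addRow-at r) (addRow-off q≢p r)) (cancel (w i r) c (w q r)))
        (span-+* w′ (- c) (span-generator w′ i) (span-generator w′ q))
      ... | no i≢p = span-cong w′ (addRow-off i≢p) (span-generator w′ i)

  addRow-det : ∀ {m} (w : Matrix ℤ m m) p q c → q ≢ p → Det (addRow w p c q) ≡ Det w
  addRow-det {suc m} w p q c q≢p = begin
    Det w′                                    ≡⟨ det-move w′ q ⟩
    sgn q * Det (w′ q ∷ removeAt w′ q)        ≡⟨ cong (sgn q *_) (det-cong (w′ q ∷ removeAt w′ q) (w q ∷ removeAt w′ q)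
      λ { zero r → addRow-off w p q c q≢p r ; (suc i) r → refl }) ⟩
    sgn q * Det (w q ∷ removeAt w′ q)         ≡⟨ cong (sgn q *_) (det-add-row (w q) (removeAt w q) (removeAt w′ q)
      (punchOut q≢p) c at-p off-p) ⟩
    sgn q * Det (w q ∷ removeAt w q)          ≡⟨ det-move w q ⟨
    Det w                                     ∎
    where
    w′ = addRow w p c q
    at-p : ∀ j → w′ (punchIn q (punchOut q≢p)) j ≡ w (punchIn q (punchOut q≢p)) j + c * w q j
    at-p j rewrite punchIn-punchOut q≢p = addRow-at w p q c j
    off-p : ∀ i → i ≢ punchOut q≢p → ∀ j → w′ (punchIn q i) j ≡ w (punchIn q i) j
    off-p i i≢ = addRow-off w p q c λ eq → i≢ (Fin.punchIn-injective q i (punchOut q≢p) (trans eq (sym (punchIn-punchOut q≢p))))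

  -- Witnesses that the lattice spanned by the rows of `w` has index at least `N` in ℤᵐ.
  IncongruentFamily : ∀ {k m} → Matrix ℤ k m → ℕ → Set
  IncongruentFamily {m = m} w N = ∃ λ (ρ : Fin N → Vector ℤ m) → ∀ i j → Span w (λ r → ρ i r - ρ j r) → i ≡ j

  residue-unique : ∀ {d} (x y : Fin d) t w → ∣ w ∣ ≡ d → + toℕ x - + toℕ y ≡ t * w → x ≡ y × t ≡ 0ℤ
  residue-unique {d} x y t w ∣w∣≡d eq = x≡y , t≡0
    where
    ∣x-y∣<d : ∣ + toℕ x - + toℕ y ∣ ℕ.< d
    ∣x-y∣<d = subst (λ z → ∣ z ∣ ℕ.< d) (sym (ℤ.m-n≡m⊖n (toℕ x) (toℕ y)))
      (ℕ.≤-<-trans (ℤ.∣m⊝n∣≤m⊔n (toℕ x) (toℕ y)) (ℕ.⊔-pres-<m (toℕ<n x) (toℕ<n y)))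
    ∣t∣*d<d : ∣ t ∣ ℕ.* d ℕ.< 1 ℕ.* d
    ∣t∣*d<d = subst₂ ℕ._<_ (trans (cong ∣_∣ eq) (trans (ℤ.abs-* t w) (cong (∣ t ∣ ℕ.*_) ∣w∣≡d))) (sym (ℕ.*-identityˡ d)) ∣x-y∣<d
    t≡0 : t ≡ 0ℤ
    t≡0 = ℤ.∣i∣≡0⇒i≡0 (ℕ.n<1⇒n≡0 (ℕ.*-cancelʳ-< d ∣ t ∣ 1 ∣t∣*d<d))
    x≡y : x ≡ y
    x≡y = toℕ-injective (ℤ.+-injective (ℤ.i-j≡0⇒i≡j (+ toℕ x) (+ toℕ y)
      (trans eq (trans (cong (_* w) t≡0) refl))))

  sum-only : ∀ {n} (p : Fin (suc n)) (f : Vector ℤ (suc n)) → (∀ i → i ≢ p → f i ≡ 0ℤ) → ∑ℤ f ≡ f p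
  sum-only p f off = trans (sum-remove {i = p} f)
    (trans (cong (λ z → f p + z) (sum-zero {f = removeAt f p} λ i → off (punchIn p i) (punchInᵢ≢i p i))) (ℤ.+-identityʳ (f p)))

  reduce : ∀ a b → b ≢ 0ℤ → ∃ λ c → ∣ a + c * b ∣ ℕ.< ∣ b ∣
  reduce a b b≢0 = - (a ℤ./ b) , subst (ℕ._< ∣ b ∣) (cong ∣_∣ (sym eq)) (ℤ.n%d<d a b)
    where
    instance _ = ℤ.≢-nonZero b≢0
    cancel : ∀ r q b → r + q * b + - q * b ≡ r
    cancel = solve-∀
    eq : a + - (a ℤ./ b) * b ≡ + (a ℤ.% b)
    eq = trans (cong (λ z → z + - (a ℤ./ b) * b) (ℤ.a≡a%n+[a/n]*n a b)) (cancel (+ (a ℤ.% b)) (a ℤ./ b) b)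

  -- The Euclidean algorithm on the first column: row operations keep determinant and lattice and
  -- decrease the sum of the absolute values of that column, until at most one nonzero entry is
  -- left. With d its absolute value and e that of the complementary minor, the determinant is ±d e,
  -- and the family combines the residues 0, ..., d - 1 in the first coordinate with a family for
  -- the complementary minor.
  incongruentFamily : ∀ {m} (w : Matrix ℤ m m) → IncongruentFamily w ∣ Det w ∣
  incongruentFamily {zero}  w = subst (IncongruentFamily w) (cong ∣_∣ (sym (Det-empty w)))
    ((λ (_ : Fin 1) ()) , λ { zero zero _ → refl })
  incongruentFamily {suc m} w = euclid (size w) w ℕ.≤-refl
    where
    size : Matrix ℤ (suc m) (suc m) → ℕ
    size w = ℕSum.sum λ i → ∣ w i zero ∣

    module Eliminated (w : Matrix ℤ (suc m) (suc m)) (p : Fin (suc m)) (off : ∀ i → i ≢ p → w i zero ≡ 0ℤ) where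
      w° : Matrix ℤ m m
      w° i l = w (punchIn p i) (suc l)
      d = ∣ w p zero ∣
      e = ∣ Det w° ∣
      ρ° = proj₁ (incongruentFamily w°)
      ρ : Fin d × Fin e → Vector ℤ (suc m)
      ρ (x , y) = (+ toℕ x) ∷ ρ° y
      ∣det∣ : ∣ Det w ∣ ≡ d ℕ.* e
      ∣det∣ = begin
        ∣ Det w ∣                          ≡⟨ cong ∣_∣ (trans (det-column-expansion w) (sum-only p
          (λ i → sgn i * w i zero * Det (λ r l → w (punchIn i r) (suc l))) λ i i≢p →
            trans (cong (λ z → sgn i * z * Det (λ r l → w (punchIn i r) (suc l))) (off i i≢p))
              (cong (_* Det (λ r l → w (punchIn i r) (suc l))) (ℤ.*-zeroʳ (sgn i))))) ⟩
        ∣ sgn p * w p zero * Det w° ∣      ≡⟨ cong ∣_∣ (ℤ.*-assoc (sgn p) (w p zero) (Det w°)) ⟩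
        ∣ sgn p * (w p zero * Det w°) ∣    ≡⟨ ∣sgn*∣ p (w p zero * Det w°) ⟩
        ∣ w p zero * Det w° ∣              ≡⟨ ℤ.abs-* (w p zero) (Det w°) ⟩
        d ℕ.* e                            ∎
      distinct : ∀ x y x′ y′ → Span w (λ r → ρ (x , y) r - ρ (x′ , y′) r) → (x , y) ≡ (x′ , y′)
      distinct x y x′ y′ (t , eq) = cong₂ _,_ (proj₁ first) (proj₂ (incongruentFamily w°) y y′ (t ∘ punchIn p , rest))
        where
        -- The first coordinates differ by less than d, so they agree and row p enters with
        -- coefficient 0. What remains is a congruence modulo the lattice of `w°`.
        first : x ≡ x′ × t p ≡ 0ℤ
        first = residue-unique x x′ (t p) (w p zero) refl (trans (eq zero)
          (sum-only p (λ i → t i * w i zero) λ i i≢p → trans (cong (t i *_) (off i i≢p)) (ℤ.*-zeroʳ (t i))))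
        rest : ∀ r → ρ° y r - ρ° y′ r ≡ ∑ℤ λ i → t (punchIn p i) * w° i r
        rest r = begin
          ρ° y r - ρ° y′ r                                             ≡⟨ eq (suc r) ⟩
          ∑ℤ (λ i → t i * w i (suc r))                                 ≡⟨ sum-remove {i = p} (λ i → t i * w i (suc r)) ⟩
          t p * w p (suc r) + ∑ℤ (λ i → t (punchIn p i) * w° i r)      ≡⟨ cong (λ z → z * w p (suc r) + ∑ℤ (λ i → t (punchIn p i) * w° i r)) (proj₂ first) ⟩
          0ℤ + ∑ℤ (λ i → t (punchIn p i) * w° i r)                     ≡⟨ ℤ.+-identityˡ _ ⟩
          ∑ℤ (λ i → t (punchIn p i) * w° i r)                          ∎
      family : IncongruentFamily w ∣ Det w ∣
      family = subst (IncongruentFamily w) (sym ∣det∣) ((ρ ∘ remQuot e) , λ i j span →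
        trans (sym (combine-remQuot {d} e i)) (trans
          (cong (uncurry combine) (distinct _ _ _ _ span)) (combine-remQuot {d} e j)))

    euclid : ∀ fuel w → size w ℕ.≤ fuel → IncongruentFamily w ∣ Det w ∣

    step : ∀ fuel w → size w ℕ.≤ fuel → ∀ p q → q ≢ p → w q zero ≢ 0ℤ → ∣ w q zero ∣ ℕ.≤ ∣ w p zero ∣ →
      IncongruentFamily w ∣ Det w ∣
    step fuel w size≤ p q q≢p wq≢0 wq≤wp with reduce (w p zero) (w q zero) wq≢0
    ... | c , small = finish fuel size≤
      where
      w′ = addRow w p c q
      smaller : size w′ ℕ.< size w
      smaller = subst₂ ℕ._<_
        (sym (trans (ℕSum.sum-remove {i = p} (λ i → ∣ w′ i zero ∣)) (cong₂ ℕ._+_ (cong ∣_∣ (addRow-at w p q c zero))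
          (ℕSum.sum-cong-≗ λ i → cong ∣_∣ (addRow-off w p q c (punchInᵢ≢i p i) zero)))))
        (sym (ℕSum.sum-remove {i = p} (λ i → ∣ w i zero ∣)))
        (ℕ.+-monoˡ-< (ℕSum.sum λ i → ∣ w (punchIn p i) zero ∣) (ℕ.<-≤-trans small wq≤wp))
      finish : ∀ fuel → size w ℕ.≤ fuel → IncongruentFamily w ∣ Det w ∣
      finish zero       size≤ = contradiction (ℕ.<-≤-trans smaller size≤) λ ()
      finish (suc fuel) size≤ =
        let (ρ , distinct) = euclid fuel w′ (ℕ.s≤s⁻¹ (ℕ.<-≤-trans smaller size≤))
        in subst (λ z → IncongruentFamily w ∣ z ∣) (addRow-det w p q c q≢p)
             (ρ , λ i j span → distinct i j (addRow-span w p q c q≢p span))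

    euclid fuel w size≤ with any? (λ p → any? λ q → ¬? (q Fin.≟ p) ×-dec (¬? (w q zero ℤ.≟ 0ℤ) ×-dec ¬? (w p zero ℤ.≟ 0ℤ)))
    ... | yes (p , q , q≢p , wq≢0 , wp≢0) = choose (ℕ.≤-total ∣ w q zero ∣ ∣ w p zero ∣)
      where
      choose : _ → _
      choose (inj₁ wq≤wp) = step fuel w size≤ p q q≢p wq≢0 wq≤wp
      choose (inj₂ wp≤wq) = step fuel w size≤ q p (q≢p ∘ sym) wp≢0 wp≤wq
    ... | no none with any? (λ p → ¬? (w p zero ℤ.≟ 0ℤ))
    ... | yes (p , wp≢0) = Eliminated.family w p λ i i≢p →
      decidable-stable (w i zero ℤ.≟ 0ℤ) λ wi≢0 → none (p , i , i≢p , wi≢0 , wp≢0)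
    -- A zero first column is the case d = 0: the determinant is 0, the family is empty, and any row
    -- can serve as pivot.
    ... | no all-zero = Eliminated.family w zero λ i _ →
      decidable-stable (w i zero ℤ.≟ 0ℤ) λ wi≢0 → all-zero (i , wi≢0)

-- Relations between columns and passage to a basic solution.

module PointedMatrix where

  open Determinant
  open Minors
  open Lattice
  open import Defs using (Matrix; ∑ℤ; minMinor)
  open import Data.Fin.Properties as Fin using (any?; punchIn-injective)
  open import Data.Integer using (_+_; _*_; -_; _-_; ∣_∣; _≤_; _<_; _<?_)
  open import Data.Integer.Tactic.RingSolver using (solve-∀)
  open import Algebra.Properties.Semiring.Sum ℤ.+-*-semiring using (sum-cong-≗; ∑-distrib-+; ∑-comm; sum-remove; *-distribˡ-sum; *-distribʳ-sum)

  ∑-mono : ∀ {n} {f g : Vector ℤ n} → (∀ i → f i ≤ g i) → ∑ℤ f ≤ ∑ℤ g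
  ∑-mono {zero}  f≤g = ℤ.≤-refl
  ∑-mono {suc n} f≤g = ℤ.+-mono-≤ (f≤g zero) (∑-mono (f≤g ∘ suc))

  ∑-nonNeg : ∀ {n} {f : Vector ℤ n} → (∀ i → 0ℤ ≤ f i) → 0ℤ ≤ ∑ℤ f
  ∑-nonNeg {zero}  0≤f = ℤ.≤-refl
  ∑-nonNeg {suc n} 0≤f = ℤ.+-mono-≤ (0≤f zero) (∑-nonNeg (0≤f ∘ suc))

  ∑-≤* : ∀ {n} {f : Vector ℤ n} b → (∀ i → f i ≤ b) → ∑ℤ f ≤ + n * b
  ∑-≤* {zero}  b f≤b = ℤ.≤-refl
  ∑-≤* {suc n} {f} b f≤b = subst (∑ℤ f ≤_) (sym (ℤ.suc-* (+ n) b)) (ℤ.+-mono-≤ (f≤b zero) (∑-≤* b (f≤b ∘ suc)))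

  term≤∑ : ∀ {n} {f : Vector ℤ n} → (∀ i → 0ℤ ≤ f i) → ∀ i → f i ≤ ∑ℤ f
  term≤∑ {suc n} {f} 0≤f i = subst₂ _≤_ (ℤ.+-identityʳ (f i)) (sym (sum-remove {i = i} f))
    (ℤ.+-monoʳ-≤ (f i) (∑-nonNeg {f = removeAt f i} (0≤f ∘ punchIn i)))

  ∣∑∣≤∑∣∣ : ∀ {n} (f : Vector ℤ n) → + ∣ ∑ℤ f ∣ ≤ ∑ℤ λ i → + ∣ f i ∣
  ∣∑∣≤∑∣∣ {zero}  f = ℤ.≤-refl
  ∣∑∣≤∑∣∣ {suc n} f = ℤ.≤-trans (ℤ.+≤+ (ℤ.∣i+j∣≤∣i∣+∣j∣ (f zero) (∑ℤ (f ∘ suc))))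
    (ℤ.+-monoʳ-≤ (+ ∣ f zero ∣) (∣∑∣≤∑∣∣ (f ∘ suc)))

  0≤* : ∀ {x y} → 0ℤ ≤ x → 0ℤ ≤ y → 0ℤ ≤ x * y
  0≤* {x} {y} 0≤x 0≤y = subst (_≤ x * y) (ℤ.*-zeroʳ x) (ℤ.*-monoˡ-≤-nonNeg x {{ℤ.nonNegative 0≤x}} 0≤y)

  0<* : ∀ {x y} → 0ℤ < x → 0ℤ < y → 0ℤ < x * y
  0<* {x} {y} 0<x 0<y = subst (_< x * y) (ℤ.*-zeroʳ x) (ℤ.*-monoˡ-<-pos x {{ℤ.positive 0<x}} 0<y)

  z<0⇒0<-z : ∀ {z} → z < 0ℤ → 0ℤ < - z
  z<0⇒0<-z = ℤ.neg-mono-<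

  ratio-trans : ∀ {a b c p q r} → 0ℤ < p → 0ℤ < q → 0ℤ < r → a * q ≤ b * p → b * r ≤ c * q → a * r ≤ c * p
  ratio-trans {a} {b} {c} {p} {q} {r} 0<p 0<q 0<r aq≤bp br≤cq = ℤ.*-cancelˡ-≤-pos (a * r) (c * p) q {{ℤ.positive 0<q}} (begin
    q * (a * r)  ≡⟨ eq₁ q a r ⟩
    a * q * r    ≤⟨ ℤ.*-monoʳ-≤-nonNeg r {{ℤ.nonNegative (ℤ.<⇒≤ 0<r)}} aq≤bp ⟩
    b * p * r    ≡⟨ eq₂ b p r ⟩
    b * r * p    ≤⟨ ℤ.*-monoʳ-≤-nonNeg p {{ℤ.nonNegative (ℤ.<⇒≤ 0<p)}} br≤cq ⟩
    c * q * p    ≡⟨ eq₃ c q p ⟩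
    q * (c * p)  ∎)
    where
    open ℤ.≤-Reasoning
    eq₁ : ∀ q a r → q * (a * r) ≡ a * q * r
    eq₁ = solve-∀
    eq₂ : ∀ b p r → b * p * r ≡ b * r * p
    eq₂ = solve-∀
    eq₃ : ∀ c q p → c * q * p ≡ q * (c * p)
    eq₃ = solve-∀

  -- The index minimising yᵢ / (− zᵢ) over the negative entries of z.
  min-ratio : ∀ {n} (y z : Vector ℤ n) → (∃ λ i → z i < 0ℤ) →
    ∃ λ i → z i < 0ℤ × ∀ l → z l < 0ℤ → y i * - z l ≤ y l * - z i
  min-ratio {suc n} y z (i , zi<0) with any? (λ j → z (suc j) <? 0ℤ)
  min-ratio {suc n} y z (zero , z0<0) | no none = zero , z0<0 ,
    λ { zero _ → ℤ.≤-refl ; (suc l) zl<0 → contradiction (l , zl<0) none }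
  min-ratio {suc n} y z (suc i , zi<0) | no none = contradiction (i , zi<0) none
  min-ratio {suc n} y z _ | yes found with min-ratio (y ∘ suc) (z ∘ suc) found | z zero <? 0ℤ
  ... | j , zj<0 , min | no z0≮0 = suc j , zj<0 ,
    λ { zero z0<0 → contradiction z0<0 z0≮0 ; (suc l) zl<0 → min l zl<0 }
  ... | j , zj<0 , min | yes z0<0 with ℤ.≤-total (y zero * - z (suc j)) (y (suc j) * - z zero)
  ... | inj₂ j≤0 = suc j , zj<0 , λ { zero _ → j≤0 ; (suc l) zl<0 → min l zl<0 }
  ... | inj₁ 0≤j = zero , z0<0 , λ { zero _ → ℤ.≤-refl
    ; (suc l) zl<0 → ratio-trans {y zero} {y (suc j)} {y (suc l)} (z<0⇒0<-z z0<0) (z<0⇒0<-z zj<0) (z<0⇒0<-z zl<0) 0≤j (min l zl<0) }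

  δ-refl : ∀ {n} (i : Fin n) → δ i i ≡ 1ℤ
  δ-refl zero    = refl
  δ-refl (suc i) = δ-refl i

  δ-nonNeg : ∀ {n} (i j : Fin n) → 0ℤ ≤ δ i j
  δ-nonNeg zero    zero    = ℤ.+≤+ ℕ.z≤n
  δ-nonNeg zero    (suc j) = ℤ.≤-refl
  δ-nonNeg (suc i) zero    = ℤ.≤-refl
  δ-nonNeg (suc i) (suc j) = δ-nonNeg i j

  -- Hypothesis (ii) for integer vectors; all relations between columns used below are integral.
  Pointed : ∀ {m n} → Matrix ℤ m n → Set
  Pointed {n = n} A = ∀ (z : Vector ℤ n) → (∀ l → 0ℤ ≤ z l) → (∀ r → ∑ℤ (λ l → z l * A r l) ≡ 0ℤ) → ∀ l → z l ≡ 0ℤ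

  module _ {m n} (A : Matrix ℤ m n) (pointed : Pointed A) where

    -- The coefficients of a nonnegative relation, collected over equal columns, would form a
    -- nonzero nonnegative vector in the kernel of A.
    relation-not-nonNeg : ∀ {k} (c : Fin (suc k) → Fin n) (z : Vector ℤ (suc k)) → 0ℤ < z zero →
      (∀ r → ∑ℤ (λ i → z i * A r (c i)) ≡ 0ℤ) → ∃ λ i → z i < 0ℤ
    relation-not-nonNeg {k} c z 0<z0 rel with any? (λ i → z i <? 0ℤ)
    ... | yes found = found
    ... | no  none  = contradiction (ℤ.<-≤-trans 0<z0 (subst (z zero ≤_) (pointed Z Z≥0 AZ≡0 (c zero)) z0≤Z)) (ℤ.<-irrefl refl)
      where
      z≥0 : ∀ i → 0ℤ ≤ z i
      z≥0 i = ℤ.≮⇒≥ λ zi<0 → none (i , zi<0)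
      Z : Vector ℤ n
      Z l = ∑ℤ λ i → z i * δ (c i) l
      term≥0 : ∀ l i → 0ℤ ≤ z i * δ (c i) l
      term≥0 l i = 0≤* (z≥0 i) (δ-nonNeg (c i) l)
      Z≥0 : ∀ l → 0ℤ ≤ Z l
      Z≥0 l = ∑-nonNeg (term≥0 l)
      z0≤Z : z zero ≤ Z (c zero)
      z0≤Z = subst (_≤ Z (c zero)) (trans (cong (z zero *_) (δ-refl (c zero))) (ℤ.*-identityʳ (z zero)))
        (term≤∑ {f = λ i → z i * δ (c i) (c zero)} (term≥0 (c zero)) zero)
      open ≡-Reasoning
      AZ≡0 : ∀ r → ∑ℤ (λ l → Z l * A r l) ≡ 0ℤ
      AZ≡0 r = begin
        ∑ℤ (λ l → Z l * A r l)
          ≡⟨ sum-cong-≗ (λ l → *-distribʳ-sum (A r l) λ i → z i * δ (c i) l) ⟩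
        ∑ℤ (λ l → ∑ℤ λ i → z i * δ (c i) l * A r l)
          ≡⟨ ∑-comm (λ l i → z i * δ (c i) l * A r l) ⟩
        ∑ℤ (λ i → ∑ℤ λ l → z i * δ (c i) l * A r l)
          ≡⟨ sum-cong-≗ (λ i → trans (sum-cong-≗ λ l → ℤ.*-assoc (z i) (δ (c i) l) (A r l))
               (trans (sym (*-distribˡ-sum (z i) λ l → δ (c i) l * A r l)) (cong (z i *_) (∑-δ (c i) (A r))))) ⟩
        ∑ℤ (λ i → z i * A r (c i))
          ≡⟨ rel r ⟩
        0ℤ ∎

  module Support {m′ n} (A : Matrix ℤ (suc m′) n) (pointed : Pointed A) (0<min : 0 ℕ.< minMinor A) where

    private
      m = suc m′

    -- With m + 1 columns the coefficients are signed minors of the other columns, and the first one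
    -- is nonzero because μ > 0. Surplus columns get the coefficient 0.
    relation : ∀ r (c : Fin (suc (suc (r ℕ.+ m′))) → Fin n) → Injective _≡_ _≡_ c →
      ∃ λ (z : Vector ℤ (suc (suc (r ℕ.+ m′)))) → z zero ≢ 0ℤ × (∀ ρ → ∑ℤ (λ i → z i * A ρ (c i)) ≡ 0ℤ)
    relation zero c c-inj = z , z0≢0 , λ ρ → trans
      (sum-cong-≗ λ i → swap (sgn i) (Det (removeAt (column A ∘ c) i)) (A ρ (c i))) (det-relation (column A ∘ c) ρ)
      where
      z : Vector ℤ (suc m)
      z i = sgn i * Det (removeAt (column A ∘ c) i)
      swap : ∀ s d a → s * d * a ≡ s * a * d
      swap = solve-∀
      z0≢0 : z zero ≢ 0ℤ
      z0≢0 z0≡0 = contradiction (ℕ.<-≤-trans 0<min (min≤absMinor A (c ∘ suc) λ eq → Fin.suc-injective (c-inj eq)))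
        (subst (λ d → ¬ (0 ℕ.< d)) (sym (trans (sym (∣sgn*∣ {suc m} zero (Det (column A ∘ c ∘ suc)))) (cong ∣_∣ z0≡0))) λ ())
    relation (suc r) c c-inj =
      let (z , z0≢0 , rel) = relation r (c zero ∷ λ i → c (suc (suc i)))
            λ { {zero} {zero} _ → refl
              ; {zero} {suc j} eq → contradiction (c-inj eq) λ ()
              ; {suc i} {zero} eq → contradiction (c-inj eq) λ ()
              ; {suc i} {suc j} eq → Fin.suc-injective (c-inj eq) }
      in z zero ∷ 0ℤ ∷ z ∘ suc , z0≢0 , λ ρ → trans
        (cong (λ t → z zero * A ρ (c zero) + t) (ℤ.+-identityˡ (∑ℤ λ i → z (suc i) * A ρ (c (suc (suc i)))))) (rel ρ)

    positive-relation : ∀ r (c : Fin (suc (suc (r ℕ.+ m′))) → Fin n) → Injective _≡_ _≡_ c →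
      ∃ λ (z : Vector ℤ (suc (suc (r ℕ.+ m′)))) → 0ℤ < z zero × (∀ ρ → ∑ℤ (λ i → z i * A ρ (c i)) ≡ 0ℤ)
    positive-relation r c c-inj with relation r c c-inj
    ... | z , z0≢0 , rel with 0ℤ <? z zero
    ... | yes 0<z0 = z , 0<z0 , rel
    ... | no  0≮z0 = -_ ∘ z , z<0⇒0<-z (ℤ.≤∧≢⇒< (ℤ.≮⇒≥ 0≮z0) z0≢0) , λ ρ → trans
      (sum-cong-≗ λ i → neg (z i) (A ρ (c i)))
      (trans (sym (*-distribˡ-sum -1ℤ λ i → z i * A ρ (c i))) (cong (-1ℤ *_) (rel ρ)))
      where
      neg : ∀ z a → - z * a ≡ -1ℤ * (z * a)
      neg = solve-∀

    -- The basic solution is `y / scale`; multiplying by `scale` keeps its coordinates integral. The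
    -- column whose coordinate is to be bounded stays in the basis as its first member, ready for
    -- Cramer's rule.
    record Reduction {r} (c : Fin (suc (r ℕ.+ m′)) → Fin n) (β : Vector ℤ m) (y₀ : ℤ) : Set where
      field
        basis     : Fin m → Fin n
        injective : Injective _≡_ _≡_ basis
        first     : basis zero ≡ c zero
        removed   : Fin r → Fin n
        split     : ∀ F → ∑ℤ (F ∘ c) ≡ ∑ℤ (F ∘ basis) + ∑ℤ (F ∘ removed)
        scale     : ℤ
        scale>0   : 0ℤ < scale
        y         : Vector ℤ m
        solution  : ∀ ρ → ∑ℤ (λ i → y i * A ρ (basis i)) ≡ scale * β ρ
        increased : scale * y₀ ≤ y zero

    -- Move along a relation between the columns, increasing the first coordinate, until another coordinate vanishes.
    reduction : ∀ r (c : Fin (suc (r ℕ.+ m′)) → Fin n) → Injective _≡_ _≡_ c →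
      ∀ β (y : Vector ℤ (suc (r ℕ.+ m′))) → (∀ i → 0ℤ ≤ y i) → (∀ ρ → ∑ℤ (λ i → y i * A ρ (c i)) ≡ β ρ) → Reduction {r} c β (y zero)
    reduction zero c c-inj β y y≥0 sol = record
      { basis = c ; injective = c-inj ; first = refl ; removed = λ () ; split = λ F → sym (ℤ.+-identityʳ _)
      ; scale = 1ℤ ; scale>0 = ℤ.+<+ (ℕ.s≤s ℕ.z≤n) ; y = y
      ; solution = λ ρ → trans (sol ρ) (sym (ℤ.*-identityˡ (β ρ)))
      ; increased = ℤ.≤-reflexive (ℤ.*-identityˡ (y zero)) }
    reduction (suc r) c c-inj β y y≥0 sol with positive-relation r c c-inj
    ... | z , 0<z0 , rel with min-ratio y z (relation-not-nonNeg A pointed c z 0<z0 rel)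
    -- The relation has a positive coefficient at the first column, so that column never leaves.
    ... | zero  , z0<0 , _ = contradiction (ℤ.<-trans 0<z0 z0<0) (ℤ.<-irrefl refl)
    ... | suc i , zi<0 , min = record
      { basis = basis ; injective = injective ; first = first
      ; removed = c (suc i) ∷ removed
      ; split = λ F → trans (sum-remove {i = suc i} (F ∘ c))
          (trans (cong (λ t → F (c (suc i)) + t) (split F))
            (swap (F (c (suc i))) (∑ℤ (F ∘ basis)) (∑ℤ (F ∘ removed))))
      ; scale = scale * κ ; scale>0 = 0<* scale>0 0<κ ; y = y″
      ; solution = λ ρ → trans (solution ρ) (sym (ℤ.*-assoc scale κ (β ρ)))
      ; increased = ℤ.≤-trans
          (subst (_≤ scale * y₁ zero) (sym (ℤ.*-assoc scale κ (y zero)))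
            (ℤ.*-monoˡ-≤-nonNeg scale {{ℤ.nonNegative (ℤ.<⇒≤ scale>0)}} κy0≤))
          increased }
      where
      κ = - z (suc i)
      0<κ : 0ℤ < κ
      0<κ = z<0⇒0<-z zi<0
      yi = y (suc i)
      c₁ = removeAt c (suc i)
      -- The move by `yi / κ` along the relation, multiplied by κ: entry `suc i` becomes 0, and
      -- minimality of the ratio keeps all others nonnegative.
      y₊ : Vector ℤ (suc (suc (r ℕ.+ m′)))
      y₊ l = κ * y l + yi * z l
      y₁ : Vector ℤ (suc (r ℕ.+ m′))
      y₁ = removeAt y₊ (suc i)
      κy0≤ : κ * y zero ≤ y₁ zero
      κy0≤ = subst (_≤ y₁ zero) (ℤ.+-identityʳ (κ * y zero))
        (ℤ.+-monoʳ-≤ (κ * y zero) (0≤* (y≥0 (suc i)) (ℤ.<⇒≤ 0<z0)))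
      swap : ∀ x y z → x + (y + z) ≡ y + (x + z)
      swap = solve-∀
      y₊≥0 : ∀ l → 0ℤ ≤ y₊ l
      y₊≥0 l with z l <? 0ℤ
      ... | no zl≮0 = ℤ.+-mono-≤ (0≤* (ℤ.<⇒≤ 0<κ) (y≥0 l)) (0≤* (y≥0 (suc i)) (ℤ.≮⇒≥ zl≮0))
      ... | yes zl<0 = subst (0ℤ ≤_) (eq (y l) κ yi (z l)) (ℤ.i≤j⇒0≤j-i (min l zl<0))
        where
        eq : ∀ y κ yi z → y * κ - yi * - z ≡ κ * y + yi * z
        eq = solve-∀
      open ≡-Reasoning
      sol₁ : ∀ ρ → ∑ℤ (λ l → y₁ l * A ρ (c₁ l)) ≡ κ * β ρ
      sol₁ ρ = begin
        ∑ℤ (λ l → y₁ l * A ρ (c₁ l))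
          ≡⟨ ℤ.+-identityˡ _ ⟨
        0ℤ + ∑ℤ (λ l → y₁ l * A ρ (c₁ l))
          ≡⟨ cong (λ t → t + ∑ℤ (λ l → y₁ l * A ρ (c₁ l))) (vanish (z (suc i)) yi (A ρ (c (suc i)))) ⟨
        y₊ (suc i) * A ρ (c (suc i)) + ∑ℤ (λ l → y₁ l * A ρ (c₁ l))
          ≡⟨ sum-remove {i = suc i} (λ l → y₊ l * A ρ (c l)) ⟨
        ∑ℤ (λ l → y₊ l * A ρ (c l))
          ≡⟨ sum-cong-≗ (λ l → expand κ (y l) yi (z l) (A ρ (c l))) ⟩
        ∑ℤ (λ l → κ * (y l * A ρ (c l)) + yi * (z l * A ρ (c l)))
          ≡⟨ ∑-distrib-+ (λ l → κ * (y l * A ρ (c l))) (λ l → yi * (z l * A ρ (c l))) ⟩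
        ∑ℤ (λ l → κ * (y l * A ρ (c l))) + ∑ℤ (λ l → yi * (z l * A ρ (c l)))
          ≡⟨ cong₂ _+_ (*-distribˡ-sum κ λ l → y l * A ρ (c l)) (*-distribˡ-sum yi λ l → z l * A ρ (c l)) ⟨
        κ * ∑ℤ (λ l → y l * A ρ (c l)) + yi * ∑ℤ (λ l → z l * A ρ (c l))
          ≡⟨ cong₂ (λ s t → κ * s + yi * t) (sol ρ) (rel ρ) ⟩
        κ * β ρ + yi * 0ℤ
          ≡⟨ drop (κ * β ρ) yi ⟩
        κ * β ρ ∎
        where
        vanish : ∀ z y a → (- z * y + y * z) * a ≡ 0ℤ
        vanish = solve-∀
        expand : ∀ κ y yi z a → (κ * y + yi * z) * a ≡ κ * (y * a) + yi * (z * a)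
        expand = solve-∀
        drop : ∀ x y → x + y * 0ℤ ≡ x
        drop = solve-∀
      open Reduction (reduction r c₁ (λ eq → punchIn-injective (suc i) _ _ (c-inj eq)) (λ ρ → κ * β ρ) y₁
        (y₊≥0 ∘ punchIn (suc i)) sol₁) renaming (y to y″)

-- Cramer's rule and the bound on the coordinates outside B.

module CoordinateBound where

  open Determinant
  open Minors
  open Lattice
  open PointedMatrix
  open import Defs using (Matrix; ∑ℤ; maxMinor; minMinor)
  open import Data.Fin.Properties using (punchInᵢ≢i; punchIn-injective)
  open import Data.Integer using (_+_; _*_; -_; _-_; ∣_∣; _≤_)
  open import Data.Integer.Tactic.RingSolver using (solve-∀)
  import Data.Nat.Tactic.RingSolver as ℕSolver
  open import Algebra.Properties.Semiring.Sum ℤ.+-*-semiring using (sum-cong-≗; sum-remove; *-distribˡ-sum)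

  -- A bound x ≤ α + K / d only weakens when d decreases. This replaces the minor of the basic
  -- solution, which depends on the solution, by the minimum μ.
  affine-mono : ∀ x α {d K a} → a ℕ.≤ d → x ℕ.* d ℕ.≤ α ℕ.* d ℕ.+ K → x ℕ.* a ℕ.≤ α ℕ.* a ℕ.+ K
  affine-mono x α {d} {K} {a} a≤d le with ℕ.≤-total x α
  ... | inj₁ x≤α = ℕ.≤-trans (ℕ.*-monoˡ-≤ a x≤α) (ℕ.m≤m+n (α ℕ.* a) K)
  ... | inj₂ α≤x with ℕ.m≤n⇒∃[o]m+o≡n α≤x
  ... | t , refl = begin
    (α ℕ.+ t) ℕ.* a       ≡⟨ ℕ.*-distribʳ-+ a α t ⟩
    α ℕ.* a ℕ.+ t ℕ.* a   ≤⟨ ℕ.+-monoʳ-≤ (α ℕ.* a) (ℕ.≤-trans (ℕ.*-monoʳ-≤ t a≤d)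
                               (ℕ.+-cancelˡ-≤ (α ℕ.* d) (t ℕ.* d) K (subst (ℕ._≤ α ℕ.* d ℕ.+ K) (ℕ.*-distribʳ-+ d α t) le))) ⟩
    α ℕ.* a ℕ.+ K         ∎
    where open ℕ.≤-Reasoning

  +-cancelˡ-≤ : ∀ x {y z} → x + y ≤ x + z → y ≤ z
  +-cancelˡ-≤ x {y} {z} le = subst₂ _≤_ (cancel x y) (cancel x z) (ℤ.+-monoʳ-≤ (- x) le)
    where
    cancel : ∀ x y → - x + (x + y) ≡ y
    cancel = solve-∀

  det-∷-combination : ∀ {m n} (y : Vector ℤ n) (w : Matrix ℤ n (suc m)) (x : Vector ℤ (suc m)) (R : Matrix ℤ m (suc m)) →
    (∀ r → x r ≡ ∑ℤ λ i → y i * w i r) → Det (x ∷ R) ≡ ∑ℤ λ i → y i * Det (w i ∷ R)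
  det-∷-combination y w x R x≡ = trans
    (det-cong (x ∷ R) ((λ r → ∑ℤ λ i → y i * w i r) ∷ R) λ { zero r → x≡ r ; (suc i) r → refl }) (det-∷-sum y w R)

  cramer : ∀ {m} (y : Vector ℤ (suc m)) (w : Matrix ℤ (suc m) (suc m)) (x : Vector ℤ (suc m)) →
    (∀ r → x r ≡ ∑ℤ λ i → y i * w i r) → Det (x ∷ tail w) ≡ y zero * Det w
  cramer y w x x≡ = trans (det-∷-combination y w x (tail w) x≡) (trans
    (sum-only zero (λ i → y i * Det (w i ∷ tail w)) λ
      { zero 0≢0 → contradiction refl 0≢0
      ; (suc i) _ → trans (cong (y (suc i) *_) (det-∷-equal (w (suc i)) (tail w) i λ _ → refl)) (ℤ.*-zeroʳ (y (suc i))) })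
    (cong (y zero *_) (det-cong (w zero ∷ tail w) w λ { zero r → refl ; (suc i) r → refl })))

  module _ {m′ k} (A : Matrix ℤ (suc m′) (suc (k ℕ.+ m′))) (pointed : Pointed A) (0<min : 0 ℕ.< minMinor A) where

    private
      m n : ℕ
      m = suc m′
      n = suc (k ℕ.+ m′)
      a : Matrix ℤ n m
      a = column A
      M = maxMinor A

    open Support A pointed 0<min

    -- Let h l be the minor of the final basis with its first column exchanged for column l. By
    -- Cramer's rule, d times the increased coordinate is, up to sign and scale, E α Σ h + Σ Θᵢ h (B
    -- i). Now h vanishes at the other basis columns, is ±d at the first and at most M in absolute
    -- value elsewhere. Hence E q u d ≤ E α (d + k M) + E q k M.
    coordinate-bound : ∀ (B : Fin m → Fin n) (N : Fin k → Fin n) → IsPartition B N →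
      ∀ (E q α : ℕ) → 0 ℕ.< E → (Θ : Vector ℤ m) → (∀ i → 0ℤ ≤ Θ i × Θ i ≤ + (E ℕ.* q)) →
      (u : Vector ℤ n) → (∀ l → 0ℤ ≤ u l) →
      (∀ r → + (E ℕ.* q) * ∑ℤ (λ l → u l * A r l) ≡
             + (E ℕ.* α) * ∑ℤ (λ l → A r l) + ∑ℤ (λ i → Θ i * A r (B i))) →
      ∀ j → q ℕ.* ∣ u (N j) ∣ ℕ.* minMinor A ℕ.≤ α ℕ.* minMinor A ℕ.+ k ℕ.* (α ℕ.+ q) ℕ.* M
    coordinate-bound B N part E q α 0<E Θ Θ-bounds u u≥0 eq j = affine-mono (q ℕ.* ∣ u (N j) ∣) α
      (min≤absMinor A basis injective) (ℕ.*-cancelˡ-≤ E {{ℕ.>-nonZero 0<E}} (ℤ.drop‿+≤+ (begin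
        + (E ℕ.* (q ℕ.* ∣ u j₀ ∣ ℕ.* d))
          ≡⟨ trans (cong +_ (reassoc E q ∣ u j₀ ∣ d)) (trans (ℤ.pos-* (E ℕ.* q ℕ.* ∣ u j₀ ∣) d)
               (cong (_* + d) (trans (ℤ.pos-* (E ℕ.* q) ∣ u j₀ ∣) (cong (Eq *_) (ℤ.0≤i⇒+∣i∣≡i (u≥0 j₀)))))) ⟩
        Eq * u j₀ * + d
          ≤⟨ bound ⟩
        Eα * (+ d + + k * + M) + Eq * (+ k * + M)
          ≡⟨ collect ⟩
        + (E ℕ.* (α ℕ.* d ℕ.+ k ℕ.* (α ℕ.+ q) ℕ.* M)) ∎)))
      where
      open ℤ.≤-Reasoning
      j₀ = N j
      Eq = + (E ℕ.* q)
      Eα = + (E ℕ.* α)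
      c : Fin n → Fin n
      c = j₀ ∷ punchIn j₀
      c-inj : Injective _≡_ _≡_ c
      c-inj {zero}  {zero}   _  = refl
      c-inj {zero}  {suc j′} eq = contradiction (sym eq) (punchInᵢ≢i j₀ j′)
      c-inj {suc i} {zero}   eq = contradiction eq (punchInᵢ≢i j₀ i)
      c-inj {suc i} {suc j′} eq = cong suc (punchIn-injective j₀ i j′ eq)
      β : Vector ℤ m
      β r = Eq * ∑ℤ (λ l → u l * A r l)
      sol : ∀ r → ∑ℤ (λ i → Eq * u (c i) * A r (c i)) ≡ β r
      sol r = trans (sym (sum-remove {i = j₀} λ l → Eq * u l * A r l))
        (trans (sum-cong-≗ λ l → ℤ.*-assoc Eq (u l) (A r l)) (sym (*-distribˡ-sum Eq λ l → u l * A r l)))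
      open Reduction (reduction k c c-inj β (λ i → Eq * u (c i))
        (λ i → 0≤* {Eq} (ℤ.+≤+ ℕ.z≤n) (u≥0 (c i))) sol)
      d = absMinor A basis
      R : Matrix ℤ m′ m
      R = a ∘ tail basis
      h : Fin n → ℤ
      h l = Det (a l ∷ R)
      H : Fin n → ℤ
      H l = + ∣ h l ∣
      H≥0 : ∀ l → 0ℤ ≤ H l
      H≥0 l = ℤ.+≤+ ℕ.z≤n
      H≤M : ∀ l → H l ≤ + M
      H≤M l = ℤ.+≤+ (ℕ.≤-trans (ℕ.≤-reflexive (cong ∣_∣ (det-cong (a l ∷ R) (a ∘ (l ∷ tail basis))
        λ { zero r → refl ; (suc i) r → refl }))) (absMinor≤max A (l ∷ tail basis)))
      h-basis : ∀ i → h (basis (suc i)) ≡ 0ℤ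
      h-basis i = det-∷-equal (a (basis (suc i))) R i λ _ → refl
      h-first : h (basis zero) ≡ Det (a ∘ basis)
      h-first = det-cong (a (basis zero) ∷ R) (a ∘ basis) λ { zero r → refl ; (suc i) r → refl }
      -- Only the removed columns and j₀ contribute, the others give determinants with a repeated row.
      ∑H : ∑ℤ H ≡ + d + ∑ℤ (H ∘ removed)
      ∑H = trans (sum-remove {i = j₀} H) (trans (split H) (cong (λ z → z + ∑ℤ (H ∘ removed)) (trans
        (sum-only zero (H ∘ basis) λ { zero 0≢0 → contradiction refl 0≢0 ; (suc i) _ → cong (λ z → + ∣ z ∣) (h-basis i) })
        (cong (λ z → + ∣ z ∣) h-first))))
      removed≤ : ∑ℤ (H ∘ removed) ≤ + k * + M
      removed≤ = ∑-≤* (+ M) λ i → H≤M (removed i)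
      -- Column `N j` lies outside B and accounts for the summand d of the total, so the sum over B
      -- is at most the sum over the k removed columns.
      ∑HB≤ : ∑ℤ (H ∘ B) ≤ + k * + M
      ∑HB≤ = ℤ.≤-trans (+-cancelˡ-≤ (+ d) (begin
        + d + ∑ℤ (H ∘ B)                    ≡⟨ cong (λ z → z + ∑ℤ (H ∘ B)) (trans (cong (λ z → + ∣ z ∣) (sym h-first)) (cong H first)) ⟩
        H (N j) + ∑ℤ (H ∘ B)                ≤⟨ ℤ.+-monoˡ-≤ (∑ℤ (H ∘ B)) (term≤∑ {f = H ∘ N} (λ i → H≥0 (N i)) j) ⟩
        ∑ℤ (H ∘ N) + ∑ℤ (H ∘ B)             ≡⟨ ℤ.+-comm (∑ℤ (H ∘ N)) (∑ℤ (H ∘ B)) ⟩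
        ∑ℤ (H ∘ B) + ∑ℤ (H ∘ N)             ≡⟨ IsPartition.split part H ⟨
        ∑ℤ H                                ≡⟨ ∑H ⟩
        + d + ∑ℤ (H ∘ removed)              ∎)) removed≤
      S : ℤ
      S = Eα * ∑ℤ h + ∑ℤ (λ i → Θ i * h (B i))
      det-β : y zero * Det (a ∘ basis) ≡ scale * S
      det-β = begin-equality
        y zero * Det (a ∘ basis)
          ≡⟨ cramer y (a ∘ basis) (λ r → scale * β r) (λ r → sym (solution r)) ⟨
        Det ((λ r → scale * β r) ∷ R)
          ≡⟨ det-∷-combination (λ (_ : Fin 1) → scale) (λ _ → β) (λ r → scale * β r) R (λ r → sym (ℤ.+-identityʳ (scale * β r))) ⟩
        scale * Det (β ∷ R) + 0ℤ
          ≡⟨ ℤ.+-identityʳ (scale * Det (β ∷ R)) ⟩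
        scale * Det (β ∷ R)
          ≡⟨ cong (scale *_) (det-cong (β ∷ R) ((λ r → Y r + Eα * X r) ∷ R)
               λ { zero r → trans (eq r) (ℤ.+-comm (Eα * ∑ℤ (λ l → A r l)) (Y r)) ; (suc i) r → refl }) ⟩
        scale * Det ((λ r → Y r + Eα * X r) ∷ R)
          ≡⟨ cong (scale *_) (det-∷-+* Y X Eα R) ⟩
        scale * (Det (Y ∷ R) + Eα * Det (X ∷ R))
          ≡⟨ cong₂ (λ s t → scale * (s + Eα * t)) (det-∷-sum Θ (a ∘ B) R)
               (trans (det-∷-combination (λ _ → 1ℤ) a X R (λ r → sum-cong-≗ λ l → sym (ℤ.*-identityˡ (A r l))))
                      (sum-cong-≗ λ l → ℤ.*-identityˡ (h l))) ⟩
        scale * (∑ℤ (λ i → Θ i * h (B i)) + Eα * ∑ℤ h)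
          ≡⟨ cong (scale *_) (ℤ.+-comm (∑ℤ (λ i → Θ i * h (B i))) (Eα * ∑ℤ h)) ⟩
        scale * S ∎
        where
        X Y : Vector ℤ m
        X r = ∑ℤ (λ l → A r l)
        Y r = ∑ℤ (λ i → Θ i * A r (B i))
      ∣S∣≤ : + ∣ S ∣ ≤ Eα * (+ d + + k * + M) + Eq * (+ k * + M)
      ∣S∣≤ = begin
        + ∣ S ∣
          ≤⟨ ℤ.+≤+ (ℤ.∣i+j∣≤∣i∣+∣j∣ (Eα * ∑ℤ h) (∑ℤ (λ i → Θ i * h (B i)))) ⟩
        + ∣ Eα * ∑ℤ h ∣ + + ∣ ∑ℤ (λ i → Θ i * h (B i)) ∣
          ≤⟨ ℤ.+-mono-≤ (begin
               + ∣ Eα * ∑ℤ h ∣         ≡⟨ trans (cong +_ (ℤ.abs-* Eα (∑ℤ h))) (ℤ.pos-* (E ℕ.* α) ∣ ∑ℤ h ∣) ⟩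
               Eα * + ∣ ∑ℤ h ∣         ≤⟨ ℤ.*-monoˡ-≤-nonNeg Eα (∣∑∣≤∑∣∣ h) ⟩
               Eα * ∑ℤ H               ≡⟨ cong (Eα *_) ∑H ⟩
               Eα * (+ d + ∑ℤ (H ∘ removed)) ≤⟨ ℤ.*-monoˡ-≤-nonNeg Eα (ℤ.+-monoʳ-≤ (+ d) removed≤) ⟩
               Eα * (+ d + + k * + M)  ∎)
             (begin
               + ∣ ∑ℤ (λ i → Θ i * h (B i)) ∣     ≤⟨ ∣∑∣≤∑∣∣ (λ i → Θ i * h (B i)) ⟩
               ∑ℤ (λ i → + ∣ Θ i * h (B i) ∣)     ≤⟨ ∑-mono {f = λ i → + ∣ Θ i * h (B i) ∣} {g = λ i → Eq * H (B i)} (λ i → begin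
                 + ∣ Θ i * h (B i) ∣              ≡⟨ trans (cong +_ (ℤ.abs-* (Θ i) (h (B i)))) (ℤ.pos-* ∣ Θ i ∣ ∣ h (B i) ∣) ⟩
                 + ∣ Θ i ∣ * H (B i)              ≡⟨ cong (_* H (B i)) (ℤ.0≤i⇒+∣i∣≡i (proj₁ (Θ-bounds i))) ⟩
                 Θ i * H (B i)                    ≤⟨ ℤ.*-monoʳ-≤-nonNeg (H (B i)) (proj₂ (Θ-bounds i)) ⟩
                 Eq * H (B i)                     ∎) ⟩
               ∑ℤ (λ i → Eq * H (B i))            ≡⟨ *-distribˡ-sum Eq (H ∘ B) ⟨
               Eq * ∑ℤ (H ∘ B)                    ≤⟨ ℤ.*-monoˡ-≤-nonNeg Eq ∑HB≤ ⟩
               Eq * (+ k * + M)                   ∎) ⟩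
        Eα * (+ d + + k * + M) + Eq * (+ k * + M) ∎
      i≤∣i∣ : ∀ i → i ≤ + ∣ i ∣
      i≤∣i∣ (+ i)    = ℤ.≤-refl
      i≤∣i∣ -[1+ i ] = ℤ.-≤+
      bound : Eq * u j₀ * + d ≤ Eα * (+ d + + k * + M) + Eq * (+ k * + M)
      bound = ℤ.≤-trans (ℤ.*-cancelˡ-≤-pos (Eq * u j₀ * + d) (+ ∣ S ∣) scale {{ℤ.positive scale>0}} (begin
        scale * (Eq * u j₀ * + d)      ≡⟨ ℤ.*-assoc scale (Eq * u j₀) (+ d) ⟨
        scale * (Eq * u j₀) * + d      ≤⟨ ℤ.*-monoʳ-≤-nonNeg (+ d) (ℤ.≤-trans increased (i≤∣i∣ (y zero))) ⟩
        + ∣ y zero ∣ * + d             ≡⟨ ℤ.pos-* ∣ y zero ∣ d ⟨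
        + (∣ y zero ∣ ℕ.* d)           ≡⟨ cong +_ (ℤ.abs-* (y zero) (Det (a ∘ basis))) ⟨
        + ∣ y zero * Det (a ∘ basis) ∣ ≡⟨ cong (λ z → + ∣ z ∣) det-β ⟩
        + ∣ scale * S ∣                ≡⟨ trans (cong +_ (ℤ.abs-* scale S)) (ℤ.pos-* ∣ scale ∣ ∣ S ∣) ⟩
        + ∣ scale ∣ * + ∣ S ∣          ≡⟨ cong (_* + ∣ S ∣) (ℤ.0≤i⇒+∣i∣≡i (ℤ.<⇒≤ scale>0)) ⟩
        scale * + ∣ S ∣                ∎)) ∣S∣≤
      reassoc : ∀ E q u d → E ℕ.* (q ℕ.* u ℕ.* d) ≡ E ℕ.* q ℕ.* u ℕ.* d
      reassoc = ℕSolver.solve-∀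
      collectℕ : ∀ E α q d k M → E ℕ.* α ℕ.* (d ℕ.+ k ℕ.* M) ℕ.+ E ℕ.* q ℕ.* (k ℕ.* M) ≡
        E ℕ.* (α ℕ.* d ℕ.+ k ℕ.* (α ℕ.+ q) ℕ.* M)
      collectℕ = ℕSolver.solve-∀
      collect : Eα * (+ d + + k * + M) + Eq * (+ k * + M) ≡ + (E ℕ.* (α ℕ.* d ℕ.+ k ℕ.* (α ℕ.+ q) ℕ.* M))
      collect = trans (cong₂ _+_ (trans (cong (λ z → Eα * (+ d + z)) (sym (ℤ.pos-* k M))) (sym (ℤ.pos-* (E ℕ.* α) (d ℕ.+ k ℕ.* M))))
        (trans (cong (Eq *_) (sym (ℤ.pos-* k M))) (sym (ℤ.pos-* (E ℕ.* q) (k ℕ.* M)))))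
        (cong +_ (collectℕ E α q d k M))

-- Plücker relations and upper bounds for the ratio of the minors.

module MinorRatio where

  open Determinant
  open Minors
  open Estimates
  open PointedMatrix
  open CoordinateBound
  open import Defs using (Matrix; ∑ℤ; maxMinor; minMinor; columnChoices)
  open import Data.Bool using (Bool)
  import Data.Bool.Properties as Bool
  open import Data.Fin using (_↑ˡ_)
  open import Data.Fin.Properties as Fin using (any?; ↑ˡ-injective)
  open import Data.Fin.Subset using (Subset)
  open import Data.Fin.Subset.Properties using (anySubset?)
  open import Data.Integer using (_+_; _*_; -_; _-_; ∣_∣; _≤_; _≤?_)
  open import Data.Integer.Tactic.RingSolver using (solve-∀)
  open import Data.List using (length)
  import Data.Nat.Tactic.RingSolver as ℕSolver
  open import Data.Sum as Sum using (_⊎_; inj₁; inj₂; [_,_]′)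
  open import Data.Vec using (lookup; tabulate)
  open import Data.Vec.Properties using (lookup∘tabulate)
  open import Relation.Nullary using (does)
  open import Relation.Nullary.Decidable using (¬?; _×-dec_; decidable-stable; from-no)
  open import Algebra.Properties.Semiring.Sum ℤ.+-*-semiring using (sum-cong-≗)

  -- The vectors x, y, z and the rows of S are one more than the dimension. Applying Det (· ∷ p ∷ S)
  -- to their linear relation leaves three terms, since those from S have a repeated row.
  plücker : ∀ {m} (S : Matrix ℤ m (suc (suc m))) (p x y z : Vector ℤ (suc (suc m))) →
    Det (y ∷ z ∷ S) * Det (x ∷ p ∷ S) - Det (x ∷ z ∷ S) * Det (y ∷ p ∷ S) + Det (x ∷ y ∷ S) * Det (z ∷ p ∷ S) ≡ 0ℤ
  plücker {m} S p x y z = begin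
    f y z * f x p - f x z * f y p + f x y * f z p
      ≡⟨ expand (f y z) (f x p) (f x z) (f y p) (f x y) (f z p) ⟩
    1ℤ * f y z * f x p + (-1ℤ * 1ℤ * f x z * f y p + (-1ℤ * (-1ℤ * 1ℤ) * f x y * f z p + 0ℤ))
      ≡⟨ cong₂ _+_ (cong (λ d → 1ℤ * d * f x p) (det-cong (y ∷ z ∷ S) (removeAt w zero) λ { zero r → refl ; (suc zero) r → refl ; (suc (suc i)) r → refl }))
           (cong₂ _+_ (cong (λ d → -1ℤ * 1ℤ * d * f y p) (det-cong (x ∷ z ∷ S) (removeAt w (suc zero)) λ { zero r → refl ; (suc zero) r → refl ; (suc (suc i)) r → refl }))
             (cong₂ _+_ (cong (λ d → -1ℤ * (-1ℤ * 1ℤ) * d * f z p) (det-cong (x ∷ y ∷ S) (removeAt w (suc (suc zero))) λ { zero r → refl ; (suc zero) r → refl ; (suc (suc i)) r → refl }))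
               (sym (sum-zero {f = λ i → c (suc (suc (suc i))) * Det (S i ∷ p ∷ S)} λ i → trans
                 (cong (c (suc (suc (suc i))) *_) (det-∷-equal (S i) (p ∷ S) (suc i) λ _ → refl)) (ℤ.*-zeroʳ (c (suc (suc (suc i))))))))) ⟩
    ∑ℤ (λ i → c i * Det (w i ∷ p ∷ S))
      ≡⟨ det-∷-sum c w (p ∷ S) ⟨
    Det ((λ r → ∑ℤ λ i → c i * w i r) ∷ p ∷ S)
      ≡⟨ det-∷-combination (λ (_ : Fin 0) → 0ℤ) (λ ()) (λ r → ∑ℤ λ i → c i * w i r) (p ∷ S)
           (λ r → trans (sum-cong-≗ λ i → swap (sgn i) (Det (removeAt w i)) (w i r)) (det-relation w r)) ⟩
    0ℤ ∎
    where
    open ≡-Reasoning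
    f : Vector ℤ (suc (suc m)) → Vector ℤ (suc (suc m)) → ℤ
    f u v = Det (u ∷ v ∷ S)
    w : Matrix ℤ (suc (suc (suc m))) (suc (suc m))
    w = x ∷ y ∷ z ∷ S
    c : Vector ℤ (suc (suc (suc m)))
    c i = sgn i * Det (removeAt w i)
    swap : ∀ s d a → s * d * a ≡ s * a * d
    swap = solve-∀
    expand : ∀ a a′ b b′ c c′ → a * a′ - b * b′ + c * c′ ≡ 1ℤ * a * a′ + (-1ℤ * 1ℤ * b * b′ + (-1ℤ * (-1ℤ * 1ℤ) * c * c′ + 0ℤ))
    expand = solve-∀

  ∣i-j∣-same-sign : ∀ i j → 0ℤ ≤ i * j → ∣ i ∣ ≡ ∣ j ∣ ℕ.+ ∣ i - j ∣ ⊎ ∣ j ∣ ≡ ∣ i ∣ ℕ.+ ∣ i - j ∣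
  ∣i-j∣-same-sign (+ zero)  j _ = inj₂ (trans (sym (ℤ.∣-i∣≡∣i∣ j)) (cong ∣_∣ (sym (ℤ.+-identityˡ (- j)))))
  ∣i-j∣-same-sign i@(+ suc _) (+ zero) _ = inj₁ (cong ∣_∣ (sym (ℤ.+-identityʳ i)))
  ∣i-j∣-same-sign -[1+ i ] (+ zero) _ = inj₁ refl
  ∣i-j∣-same-sign (+ suc i) -[1+ j ] ()
  ∣i-j∣-same-sign -[1+ i ] (+ suc j) ()
  ∣i-j∣-same-sign (+ suc i) (+ suc j) _ = ∣⊖∣ (suc i) (suc j)
    where
    ∣⊖∣ : ∀ i j → i ≡ j ℕ.+ ∣ i ℤ.⊖ j ∣ ⊎ j ≡ i ℕ.+ ∣ i ℤ.⊖ j ∣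
    ∣⊖∣ i j with ℕ.≤-total j i
    ... | inj₁ j≤i = inj₁ (trans (sym (ℕ.m+[n∸m]≡n j≤i)) (cong (λ z → j ℕ.+ ∣ z ∣) (sym (ℤ.⊖-≥ j≤i))))
    ... | inj₂ i≤j = inj₂ (trans (sym (ℕ.m+[n∸m]≡n i≤j)) (cong (i ℕ.+_) (sym (trans (cong ∣_∣ (ℤ.⊖-≤ i≤j)) (ℤ.∣-i∣≡∣i∣ (+ (j ℕ.∸ i)))))))
  ∣i-j∣-same-sign -[1+ i ] -[1+ j ] _ = ∣⊖∣ i j
    where
    ∣⊖∣ : ∀ i j → suc i ≡ suc j ℕ.+ ∣ suc j ℤ.⊖ suc i ∣ ⊎ suc j ≡ suc i ℕ.+ ∣ suc j ℤ.⊖ suc i ∣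
    ∣⊖∣ i j with ℕ.≤-total (suc j) (suc i)
    ... | inj₁ j≤i = inj₁ (trans (sym (ℕ.m+[n∸m]≡n j≤i)) (cong (suc j ℕ.+_) (sym (trans (cong ∣_∣ (ℤ.⊖-≤ j≤i)) (ℤ.∣-i∣≡∣i∣ (+ (suc i ℕ.∸ suc j)))))))
    ... | inj₂ i≤j = inj₂ (trans (sym (ℕ.m+[n∸m]≡n i≤j)) (cong (λ z → suc i ℕ.+ ∣ z ∣) (sym (ℤ.⊖-≥ i≤j))))

  ∣i-j∣-opposite-sign : ∀ i j → i * j ≤ 0ℤ → ∣ i - j ∣ ≡ ∣ i ∣ ℕ.+ ∣ j ∣
  ∣i-j∣-opposite-sign (+ zero) j _ = trans (cong ∣_∣ (ℤ.+-identityˡ (- j))) (ℤ.∣-i∣≡∣i∣ j)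
  ∣i-j∣-opposite-sign i@(+ suc n) (+ zero) _ = trans (cong ∣_∣ (ℤ.+-identityʳ i)) (sym (ℕ.+-identityʳ (suc n)))
  ∣i-j∣-opposite-sign -[1+ i ] (+ zero) _ = cong suc (sym (ℕ.+-identityʳ i))
  ∣i-j∣-opposite-sign (+ suc i) (+ suc j) (ℤ.+≤+ ())
  ∣i-j∣-opposite-sign -[1+ i ] -[1+ j ] (ℤ.+≤+ ())
  ∣i-j∣-opposite-sign (+ suc i) -[1+ j ] _ = refl
  ∣i-j∣-opposite-sign -[1+ i ] (+ suc j) _ = cong suc (sym (ℕ.+-suc i j))

  ThreeAlike : ∀ {n} → Subset n → Set
  ThreeAlike p = ∃ λ i → ∃ λ j → ∃ λ l → i ≢ j × j ≢ l × i ≢ l × lookup p i ≡ lookup p j × lookup p j ≡ lookup p l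

  threeAlike? : ∀ {n} (p : Subset n) → Dec (ThreeAlike p)
  threeAlike? p = any? λ i → any? λ j → any? λ l → ¬? (i Fin.≟ j) ×-dec ¬? (j Fin.≟ l) ×-dec ¬? (i Fin.≟ l) ×-dec
    (lookup p i Bool.≟ lookup p j) ×-dec (lookup p j Bool.≟ lookup p l)

  opaque

    -- The pigeonhole principle for two colours, decided by a search through all 32 subsets; opaque
    -- so that the search is not unfolded later.
    threeAlike : (p : Subset 5) → ThreeAlike p
    threeAlike p = decidable-stable (threeAlike? p) λ none →
      from-no (anySubset? λ p → ¬? (threeAlike? {5} p)) (p , none)

  module _ {m′ n k} (A : Matrix ℤ (suc (suc m′)) n) (B : Fin (suc (suc m′)) → Fin n) (N : Fin k → Fin n)
           (part : IsPartition B N) (max : absMinor A B ≡ maxMinor A) where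

    open IsPartition part

    private
      a : Matrix ℤ n (suc (suc m′))
      a = column A
      M μ : ℕ
      M = maxMinor A
      μ = minMinor A
      C : Fin m′ → Fin n
      C i = B (suc (suc i))
      S : Matrix ℤ m′ (suc (suc m′))
      S = a ∘ C
      f : Fin n → Fin n → ℤ
      f p q = Det (a p ∷ a q ∷ S)

      f≡ : ∀ p q → ∣ f p q ∣ ≡ absMinor A (p ∷ q ∷ C)
      f≡ p q = cong ∣_∣ (det-cong (a p ∷ a q ∷ S) (a ∘ (p ∷ q ∷ C))
        λ { zero r → refl ; (suc zero) r → refl ; (suc (suc i)) r → refl })

      f≤ : ∀ p q → ∣ f p q ∣ ℕ.≤ M
      f≤ p q = subst (ℕ._≤ M) (sym (f≡ p q)) (absMinor≤max A (p ∷ q ∷ C))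

      ≤f : ∀ p q → p ≢ q → (∀ i → p ≢ C i) → (∀ i → q ≢ C i) → μ ℕ.≤ ∣ f p q ∣
      ≤f p q p≢q p≢C q≢C = subst (μ ℕ.≤_) (sym (f≡ p q)) (min≤absMinor A (p ∷ q ∷ C) inj)
        where
        inj : Injective _≡_ _≡_ (p ∷ q ∷ C)
        inj {zero}        {zero}        _  = refl
        inj {zero}        {suc zero}    eq = contradiction eq p≢q
        inj {zero}        {suc (suc j)} eq = contradiction eq (p≢C j)
        inj {suc zero}    {zero}        eq = contradiction (sym eq) p≢q
        inj {suc zero}    {suc zero}    _  = refl
        inj {suc zero}    {suc (suc j)} eq = contradiction eq (q≢C j)
        inj {suc (suc i)} {zero}        eq = contradiction (sym eq) (p≢C i)
        inj {suc (suc i)} {suc zero}    eq = contradiction (sym eq) (q≢C i)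
        inj {suc (suc i)} {suc (suc j)} eq = c-inj eq

      -- Modulo the m - 2 columns C the remaining columns become plane vectors. Up to sign and the
      -- factor M, β i and α i are the coordinates of `N i` in the frame `B zero`, `B (suc zero)`,
      -- and γ i j is the absolute value of the determinant of two such vectors.
      α β : Fin k → ℤ
      α i = f (B zero) (N i)
      β i = f (B (suc zero)) (N i)
      γ : Fin k → Fin k → ℕ
      γ i j = ∣ f (N i) (N j) ∣

      ≤α : ∀ i → μ ℕ.≤ ∣ α i ∣
      ≤α i = ≤f (B zero) (N i) (c≢N zero i) (λ j eq → contradiction (c-inj eq) λ ()) λ j eq → c≢N (suc (suc j)) i (sym eq)
      ≤β : ∀ i → μ ℕ.≤ ∣ β i ∣
      ≤β i = ≤f (B (suc zero)) (N i) (c≢N (suc zero) i) (λ j eq → contradiction (c-inj eq) λ ()) λ j eq → c≢N (suc (suc j)) i (sym eq)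
      ≤γ : ∀ {i j} → i ≢ j → μ ℕ.≤ γ i j
      ≤γ {i} {j} i≢j = ≤f (N i) (N j) (i≢j ∘ N-inj) (λ l eq → c≢N (suc (suc l)) i (sym eq)) λ l eq → c≢N (suc (suc l)) j (sym eq)

      α≤ : ∀ i → ∣ α i ∣ ℕ.≤ M
      α≤ i = f≤ (B zero) (N i)
      β≤ : ∀ i → ∣ β i ∣ ℕ.≤ M
      β≤ i = f≤ (B (suc zero)) (N i)
      γ≤ : ∀ i j → γ i j ℕ.≤ M
      γ≤ i j = f≤ (N i) (N j)

      ∣δ∣ : ∣ f (B zero) (B (suc zero)) ∣ ≡ M
      ∣δ∣ = trans (f≡ (B zero) (B (suc zero))) (trans (absMinor-cong A λ { zero → refl ; (suc zero) → refl ; (suc (suc i)) → refl }) max)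

      αβ-difference : ∀ i j → ∣ α i * β j - α j * β i ∣ ≡ γ i j ℕ.* M
      αβ-difference i j = trans (cong ∣_∣ (trans
        (solve (f (N i) (N j)) (f (B zero) (B (suc zero))) (α i) (β j) (α j) (β i)
          (subst₂ (λ x y → f (N i) (N j) * f (B zero) (B (suc zero)) - α j * x + α i * y ≡ 0ℤ)
            (det-swap (a (N i)) (a (B (suc zero))) S) (det-swap (a (N j)) (a (B (suc zero))) S)
            (plücker S (a (B (suc zero))) (a (B zero)) (a (N i)) (a (N j)))))
        refl))
        (trans (ℤ.abs-* (f (N i) (N j)) (f (B zero) (B (suc zero)))) (cong (γ i j ℕ.*_) ∣δ∣))
        where
        rearrange : ∀ g d ai bj aj bi → ai * bj - aj * bi ≡ g * d - (g * d - aj * - bi + ai * - bj)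
        rearrange = solve-∀
        solve : ∀ g d ai bj aj bi → g * d - aj * - bi + ai * - bj ≡ 0ℤ → ai * bj - aj * bi ≡ g * d
        solve g d ai bj aj bi eq = trans (rearrange g d ai bj aj bi) (trans (cong (λ z → g * d - z) eq) (ℤ.+-identityʳ (g * d)))

      μ≤M : ∀ {i : Fin k} → μ ℕ.≤ M
      μ≤M {i} = ℕ.≤-trans (≤α i) (f≤ (B zero) (N i))

      -- In the quadrant picture: the slope β/α of column i is smaller than that of column j by a definite amount.
      _⇝_ : Fin k → Fin k → Set
      i ⇝ j = ∣ α j ∣ ℕ.* ∣ β i ∣ ℕ.+ μ ℕ.* M ℕ.≤ ∣ α i ∣ ℕ.* ∣ β j ∣

      cross : ∀ a b c d → a * b * (c * d) ≡ a * d * (c * b)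
      cross = solve-∀

      -- The hypothesis says that αᵢ βⱼ and αⱼ βᵢ do not differ in sign. So the absolute value γ M
      -- of their difference, at least μ M, is the distance of their absolute values.
      connected : ∀ {i j} → i ≢ j → 0ℤ ≤ α i * β i * (α j * β j) → i ⇝ j ⊎ j ⇝ i
      connected {i} {j} i≢j same = Sum.map (λ eq → subst₂ (λ x y → x ℕ.+ μ ℕ.* M ℕ.≤ y) (ℤ.abs-* (α j) (β i)) (ℤ.abs-* (α i) (β j))
        (ℕ.≤-trans (ℕ.+-monoʳ-≤ ∣ α j * β i ∣ (ℕ.*-monoˡ-≤ M (≤γ i≢j)))
          (ℕ.≤-reflexive (sym (trans eq (cong (∣ α j * β i ∣ ℕ.+_) (αβ-difference i j)))))))
        (λ eq → subst₂ (λ x y → x ℕ.+ μ ℕ.* M ℕ.≤ y) (ℤ.abs-* (α i) (β j)) (ℤ.abs-* (α j) (β i))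
        (ℕ.≤-trans (ℕ.+-monoʳ-≤ ∣ α i * β j ∣ (ℕ.*-monoˡ-≤ M (≤γ i≢j)))
          (ℕ.≤-reflexive (sym (trans eq (cong (∣ α i * β j ∣ ℕ.+_) (αβ-difference i j)))))))
        (∣i-j∣-same-sign (α i * β j) (α j * β i) (subst (0ℤ ≤_) (cross (α i) (β i) (α j) (β j)) same))

      open ℕ.≤-Reasoning

      edge-bound : ∀ {i j} → i ⇝ j → 2 ℕ.* (μ ℕ.* μ) ℕ.≤ M ℕ.* M
      edge-bound {i} {j} i⇝j = begin
        2 ℕ.* (μ ℕ.* μ)                       ≡⟨ cong (μ ℕ.* μ ℕ.+_) (ℕ.+-identityʳ (μ ℕ.* μ)) ⟩
        μ ℕ.* μ ℕ.+ μ ℕ.* μ                   ≤⟨ ℕ.+-mono-≤ (ℕ.*-mono-≤ (≤α j) (≤β i)) (ℕ.*-monoʳ-≤ μ (μ≤M {i})) ⟩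
        ∣ α j ∣ ℕ.* ∣ β i ∣ ℕ.+ μ ℕ.* M       ≤⟨ i⇝j ⟩
        ∣ α i ∣ ℕ.* ∣ β j ∣                   ≤⟨ ℕ.*-mono-≤ (α≤ i) (β≤ j) ⟩
        M ℕ.* M                               ∎

      -- All slopes |β| / |α| lie between μ / M and M / μ. Each of the two steps raises the slope by
      -- at least μ M / M² = μ / M, so the last one is at least 3 μ / M.
      path-bound : ∀ {i j l} → 0 ℕ.< μ → i ⇝ j → j ⇝ l → 3 ℕ.* (μ ℕ.* μ) ℕ.≤ M ℕ.* M
      path-bound {i} {j} {l} 0<μ i⇝j j⇝l = begin
        3 ℕ.* (μ ℕ.* μ)       ≡⟨ ℕ.*-assoc 3 μ μ ⟨
        3 ℕ.* μ ℕ.* μ         ≤⟨ ℕ.*-monoʳ-≤ (3 ℕ.* μ) (≤α l) ⟩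
        3 ℕ.* μ ℕ.* al        ≤⟨ ℕ.*-cancelˡ-≤ aj {{ℕ.>-nonZero (ℕ.<-≤-trans 0<μ (≤α j))}} (begin
          aj ℕ.* (3 ℕ.* μ ℕ.* al)                              ≡⟨ eq₁ aj μ al ⟩
          al ℕ.* (2 ℕ.* μ ℕ.* aj) ℕ.+ μ ℕ.* (aj ℕ.* al)        ≤⟨ ℕ.+-mono-≤ (ℕ.*-monoʳ-≤ al slope-j) (ℕ.*-monoʳ-≤ μ (ℕ.*-mono-≤ (α≤ j) (α≤ l))) ⟩
          al ℕ.* (M ℕ.* bj) ℕ.+ μ ℕ.* (M ℕ.* M)                ≡⟨ eq₂ al M bj μ ⟩
          M ℕ.* (al ℕ.* bj ℕ.+ μ ℕ.* M)                        ≤⟨ ℕ.*-monoʳ-≤ M j⇝l ⟩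
          M ℕ.* (aj ℕ.* bl)                                    ≡⟨ eq₃ M aj bl ⟩
          aj ℕ.* (M ℕ.* bl)                                    ∎) ⟩
        M ℕ.* bl              ≤⟨ ℕ.*-monoʳ-≤ M (β≤ l) ⟩
        M ℕ.* M               ∎
        where
        ai = ∣ α i ∣
        aj = ∣ α j ∣
        al = ∣ α l ∣
        bj = ∣ β j ∣
        bl = ∣ β l ∣
        eq₁ : ∀ aj μ al → aj ℕ.* (3 ℕ.* μ ℕ.* al) ≡ al ℕ.* (2 ℕ.* μ ℕ.* aj) ℕ.+ μ ℕ.* (aj ℕ.* al)
        eq₁ = ℕSolver.solve-∀
        eq₂ : ∀ al M bj μ → al ℕ.* (M ℕ.* bj) ℕ.+ μ ℕ.* (M ℕ.* M) ≡ M ℕ.* (al ℕ.* bj ℕ.+ μ ℕ.* M)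
        eq₂ = ℕSolver.solve-∀
        eq₃ : ∀ M aj bl → M ℕ.* (aj ℕ.* bl) ≡ aj ℕ.* (M ℕ.* bl)
        eq₃ = ℕSolver.solve-∀
        eq₄ : ∀ μ aj → 2 ℕ.* μ ℕ.* aj ≡ aj ℕ.* μ ℕ.+ μ ℕ.* aj
        eq₄ = ℕSolver.solve-∀
        slope-j : 2 ℕ.* μ ℕ.* aj ℕ.≤ M ℕ.* bj
        slope-j = begin
          2 ℕ.* μ ℕ.* aj                ≡⟨ eq₄ μ aj ⟩
          aj ℕ.* μ ℕ.+ μ ℕ.* aj         ≤⟨ ℕ.+-mono-≤ (ℕ.*-monoʳ-≤ aj (≤β i)) (ℕ.*-monoʳ-≤ μ (α≤ j)) ⟩
          aj ℕ.* ∣ β i ∣ ℕ.+ μ ℕ.* M    ≤⟨ i⇝j ⟩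
          ai ℕ.* bj                     ≤⟨ ℕ.*-monoˡ-≤ bj (α≤ i) ⟩
          M ℕ.* bj                      ∎

    -- If αᵢ βᵢ and αⱼ βⱼ agree in sign, one step between slopes suffices. Otherwise |αᵢ βⱼ| and |αⱼ
    -- βᵢ|, each at least μ², add up to γ M ≤ M².
    2min²≤max² : ∀ {i j} → i ≢ j → 2 ℕ.* (μ ℕ.* μ) ℕ.≤ M ℕ.* M
    2min²≤max² {i} {j} i≢j = [ (λ same → [ edge-bound {i} {j} , edge-bound {j} {i} ]′ (connected i≢j same)) , opposite-bound ]′
      (ℤ.≤-total 0ℤ (α i * β i * (α j * β j)))
      where
      opposite-bound : α i * β i * (α j * β j) ≤ 0ℤ → 2 ℕ.* (μ ℕ.* μ) ℕ.≤ M ℕ.* M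
      opposite-bound opposite = begin
        2 ℕ.* (μ ℕ.* μ)                                  ≡⟨ cong (μ ℕ.* μ ℕ.+_) (ℕ.+-identityʳ (μ ℕ.* μ)) ⟩
        μ ℕ.* μ ℕ.+ μ ℕ.* μ                              ≤⟨ ℕ.+-mono-≤ (ℕ.*-mono-≤ (≤α i) (≤β j)) (ℕ.*-mono-≤ (≤α j) (≤β i)) ⟩
        ∣ α i ∣ ℕ.* ∣ β j ∣ ℕ.+ ∣ α j ∣ ℕ.* ∣ β i ∣      ≡⟨ cong₂ ℕ._+_ (ℤ.abs-* (α i) (β j)) (ℤ.abs-* (α j) (β i)) ⟨
        ∣ α i * β j ∣ ℕ.+ ∣ α j * β i ∣                  ≡⟨ ∣i-j∣-opposite-sign (α i * β j) (α j * β i) (subst (_≤ 0ℤ) (cross (α i) (β i) (α j) (β j)) opposite) ⟨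
        ∣ α i * β j - α j * β i ∣                        ≡⟨ αβ-difference i j ⟩
        γ i j ℕ.* M                                      ≤⟨ ℕ.*-monoˡ-≤ M (γ≤ i j) ⟩
        M ℕ.* M                                          ∎

    -- Three of the five columns share the sign of α β and are pairwise comparable by `⇝`. A
    -- tournament on three vertices contains a path with two edges.
    3min²≤max² : 0 ℕ.< μ → (e : Fin 5 → Fin k) → Injective _≡_ _≡_ e → 3 ℕ.* (μ ℕ.* μ) ℕ.≤ M ℕ.* M
    3min²≤max² 0<μ e e-inj =
      let (i , j , l , i≢j , j≢l , i≢l , si≡sj , sj≡sl) = threeAlike (tabulate s)
      in path (e i) (e j) (e l) (link i j i≢j si≡sj) (link j l j≢l sj≡sl) (link i l i≢l (trans si≡sj sj≡sl))
      where
      s : Fin 5 → Bool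
      s i = does (0ℤ ≤? α (e i) * β (e i))
      same-sign : ∀ x y → does (0ℤ ≤? x) ≡ does (0ℤ ≤? y) → 0ℤ ≤ x * y
      same-sign x y eq with 0ℤ ≤? x | 0ℤ ≤? y
      ... | yes 0≤x | yes 0≤y = 0≤* 0≤x 0≤y
      ... | no  0≰x | no  0≰y = subst (0ℤ ≤_) (neg x y) (0≤* (ℤ.neg-mono-≤ (ℤ.<⇒≤ (ℤ.≰⇒> 0≰x))) (ℤ.neg-mono-≤ (ℤ.<⇒≤ (ℤ.≰⇒> 0≰y))))
        where
        neg : ∀ x y → - x * - y ≡ x * y
        neg = solve-∀
      link : ∀ i j → i ≢ j → lookup (tabulate s) i ≡ lookup (tabulate s) j → e i ⇝ e j ⊎ e j ⇝ e i
      link i j i≢j eq = connected (i≢j ∘ e-inj) (same-sign (α (e i) * β (e i)) (α (e j) * β (e j))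
        (trans (sym (lookup∘tabulate s i)) (trans eq (lookup∘tabulate s j))))
      path : ∀ i j l → i ⇝ j ⊎ j ⇝ i → j ⇝ l ⊎ l ⇝ j → i ⇝ l ⊎ l ⇝ i → 3 ℕ.* (μ ℕ.* μ) ℕ.≤ M ℕ.* M
      path i j l (inj₁ ij) (inj₁ jl) _         = path-bound {i} {j} {l} 0<μ ij jl
      path i j l (inj₁ ij) (inj₂ lj) (inj₁ il) = path-bound {i} {l} {j} 0<μ il lj
      path i j l (inj₁ ij) (inj₂ lj) (inj₂ li) = path-bound {l} {i} {j} 0<μ li ij
      path i j l (inj₂ ji) _         (inj₁ il) = path-bound {j} {i} {l} 0<μ ji il
      path i j l (inj₂ ji) (inj₁ jl) (inj₂ li) = path-bound {j} {l} {i} 0<μ jl li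
      path i j l (inj₂ ji) (inj₂ lj) (inj₂ li) = path-bound {l} {j} {i} 0<μ lj ji

  -- For one column outside B, r = 1 is enough. For two to four columns r = 2 is, the last case
  -- being 256 ≤ 24 · 16. From five columns on r = 3 is available, and it serves every exponent.
  minor-ratio : ∀ {m′ n} k (A : Matrix ℤ (suc (suc m′)) n) B (N : Fin (suc k) → Fin n) →
    IsPartition B N → absMinor A B ≡ maxMinor A → 0 ℕ.< minMinor A →
    ∃ λ r → r ℕ.* (minMinor A ℕ.* minMinor A) ℕ.≤ maxMinor A ℕ.* maxMinor A × suc k ℕ.^ suc k ℕ.≤ suc k ℕ.! ℕ.* r ℕ.^ suc k
  minor-ratio 0 A B N part max 0<μ = 1 , ℕ.≤-trans (ℕ.≤-reflexive (ℕ.*-identityˡ _)) (ℕ.*-mono-≤ μ≤M μ≤M) , ℕ.≤-refl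
    where
    μ≤M : minMinor A ℕ.≤ maxMinor A
    μ≤M = subst (minMinor A ℕ.≤_) max (min≤absMinor A B (IsPartition.c-inj part))
  minor-ratio 1 A B N part max 0<μ = 2 , 2min²≤max² A B N part max {zero} {suc zero} (λ ()) , ℕ.≤ᵇ⇒≤ _ _ _
  minor-ratio 2 A B N part max 0<μ = 2 , 2min²≤max² A B N part max {zero} {suc zero} (λ ()) , ℕ.≤ᵇ⇒≤ _ _ _
  minor-ratio 3 A B N part max 0<μ = 2 , 2min²≤max² A B N part max {zero} {suc zero} (λ ()) , ℕ.≤ᵇ⇒≤ _ _ _
  minor-ratio (suc (suc (suc (suc o)))) A B N part max 0<μ = 3 ,
    3min²≤max² A B N part max 0<μ (_↑ˡ o) (λ {i} {j} → ↑ˡ-injective o i j) , k^k≤k!*3^k (5 ℕ.+ o)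

  choices-minors-bound : ∀ {m′ k} (A : Matrix ℤ (suc (suc m′)) (suc (suc m′) ℕ.+ suc k)) B (N : Fin (suc k) → Fin (suc (suc m′) ℕ.+ suc k)) →
    IsPartition B N → absMinor A B ≡ maxMinor A → 0 ℕ.< minMinor A →
    length (columnChoices (suc (suc m′)) (suc (suc m′) ℕ.+ suc k)) ℕ.* (minMinor A ℕ.* minMinor A ℕ.* suc k) ℕ.^ suc k
      ℕ.≤ (maxMinor A ℕ.* maxMinor A ℕ.* (suc (suc m′) ℕ.+ suc k)) ℕ.^ suc k
  choices-minors-bound {m′} {k} A B N part max 0<μ =
    let (r , ratio , k^k≤) = minor-ratio k A B N part max 0<μ
    in choices*[m²k]^k≤ (suc (suc m′)) (suc k) (minMinor A) (maxMinor A) r ratio k^k≤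

-- Counting lattice points in boxes and simplices.

module LatticePoints where

  open Estimates using (^-bernoulli; ^-distribʳ-*)
  open import Data.Fin as Fin using (Fin; zero; suc; funToFin; finToFun; fromℕ<)
  import Data.Fin.Properties as Fin
  open import Data.List as List using (List; length)
  import Data.List.Properties as List
  open import Data.List.Membership.Propositional using (_∈_)
  open import Data.List.Membership.Propositional.Properties using (∈-++⁺ˡ; ∈-++⁺ʳ; ∈-map⁺)
  open import Data.List.Relation.Unary.Any using (here; index)
  open import Data.List.Relation.Unary.Any.Properties using (lookup-index)
  open import Data.Nat
  open import Data.Nat.Properties
  open import Data.Nat.DivMod using (_/_; m/n*n≤m; /-monoˡ-≤; m*n/n≡m)
  open import Data.Nat.Tactic.RingSolver using (solve-∀)
  open import Data.Vec as Vec using (Vec)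
  open import Data.Vec.Functional using (toVec)
  open import Data.Vec.Properties using (lookup∘tabulate)
  open import Algebra.Properties.CommutativeMonoid.Sum +-0-commutativeMonoid using (sum)
  open ≤-Reasoning

  box-count : ∀ {T k} (h : Fin T → Vector ℕ k) → Injective _≡_ _≗_ h →
    ∀ x y → (∀ i j → h i j * x ≤ y) → T * x ^ k ≤ (y + x) ^ k
  box-count {T} {k} h h-inj zero      y h≤ with k
  -- For x = 0 the coordinates are unbounded, but the left side is then 0 unless k = 0, where
  -- injectivity forces T ≤ 1.
  ... | zero  = ≤-trans (≤-reflexive (*-identityʳ T)) (Fin.injective⇒≤ {f = λ (_ : Fin T) → zero} λ {i} {j} _ → h-inj λ ())
  ... | suc _ = ≤-trans (≤-reflexive (*-zeroʳ T)) z≤n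
  box-count {T} {k} h h-inj x@(suc _) y h≤ = begin
    T * x ^ k          ≤⟨ *-monoˡ-≤ (x ^ k) (Fin.injective⇒≤ {f = funToFin ∘ h′} inj) ⟩
    K ^ k * x ^ k      ≡⟨ ^-distribʳ-* k K x ⟨
    (K * x) ^ k        ≤⟨ ^-monoˡ-≤ k (≤-trans (+-monoʳ-≤ x (m/n*n≤m y x)) (≤-reflexive (+-comm x y))) ⟩
    (y + x) ^ k        ∎
    where
    K = suc (y / x)
    h<K : ∀ i j → h i j < K
    h<K i j = s≤s (≤-trans (≤-reflexive (sym (m*n/n≡m (h i j) x))) (/-monoˡ-≤ x (h≤ i j)))
    h′ : Fin T → Fin k → Fin K
    h′ i j = fromℕ< (h<K i j)
    inj : Injective _≡_ _≡_ (funToFin ∘ h′)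
    inj {i} {i′} eq = h-inj λ j → Fin.fromℕ<-injective (h i j) (h i′ j) (h<K i j) (h<K i′ j)
      (trans (sym (Fin.finToFun-funToFin (h′ i) j)) (trans (cong (λ c → finToFun c j) eq) (Fin.finToFun-funToFin (h′ i′) j)))

  bump : ∀ {k} → Vec ℕ (suc k) → Vec ℕ (suc k)
  bump (x Vec.∷ v) = suc x Vec.∷ v

  -- The vectors v ∈ ℕᵏ with a · v ≤ β; the extra argument of slices is fuel, a strict bound on the first entry.
  simplex : ∀ k → Vector ℕ k → ℕ → List (Vec ℕ k)
  slices : ∀ {k} → Vector ℕ (suc k) → ℕ → ℕ → List (Vec ℕ (suc k))

  simplex zero    a β = Vec.[] List.∷ List.[]
  simplex (suc k) a β = slices a (suc β) β

  slices a zero    β = List.[]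
  slices a (suc f) β with a zero ≤? β
  ... | yes _ = List.map (0 Vec.∷_) (simplex _ (a ∘ suc) β) List.++ List.map bump (slices a f (β ∸ a zero))
  ... | no  _ = List.map (0 Vec.∷_) (simplex _ (a ∘ suc) β)

  -- The unit cubes attached to the counted points lie in the simplex a · x ≤ β + Σ a of volume (β +
  -- Σ a)ᵏ / (k! Π a), and Π a ≥ cᵏ. Volumes are replaced by an induction over slices: the points
  -- with first entry 0 give the second term of Bernoulli's inequality, the others, shifted down by
  -- one, the first.
  length-simplex : ∀ k (a : Vector ℕ k) β c → (∀ j → c ≤ a j) → k ! * c ^ k * length (simplex k a β) ≤ (β + sum a) ^ k
  length-slices : ∀ {k} (a : Vector ℕ (suc k)) f β c → (∀ j → c ≤ a j) →
    suc k ! * c ^ suc k * length (slices a f β) ≤ (β + sum (a ∘ suc) + a zero) ^ suc k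

  first-slice : ∀ {k} (a : Vector ℕ (suc k)) β c → (∀ j → c ≤ a j) →
    suc k ! * c ^ suc k * length (simplex k (a ∘ suc) β) ≤ suc k * (a zero * (β + sum (a ∘ suc)) ^ k)

  length-simplex zero    a β c c≤a = ≤-refl
  length-simplex (suc k) a β c c≤a = ≤-trans (length-slices a (suc β) β c c≤a)
    (≤-reflexive (cong (_^ suc k) (reorder β (sum (a ∘ suc)) (a zero))))
    where
    reorder : ∀ β s a → β + s + a ≡ β + (a + s)
    reorder = solve-∀

  first-slice {k} a β c c≤a = begin
    suc k * k ! * (c * c ^ k) * length (simplex k (a ∘ suc) β)     ≡⟨ regroup (suc k) (k !) c (c ^ k) (length (simplex k (a ∘ suc) β)) ⟩
    suc k * (c * (k ! * c ^ k * length (simplex k (a ∘ suc) β)))   ≤⟨ *-monoʳ-≤ (suc k) (*-mono-≤ (c≤a zero) (length-simplex k (a ∘ suc) β c (c≤a ∘ suc))) ⟩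
    suc k * (a zero * (β + sum (a ∘ suc)) ^ k)                     ∎
    where
    regroup : ∀ s f c p l → s * f * (c * p) * l ≡ s * (c * (f * p * l))
    regroup = solve-∀

  length-slices {k} a zero    β c c≤a = ≤-trans (≤-reflexive (*-zeroʳ (suc k ! * c ^ suc k))) z≤n
  length-slices {k} a (suc f) β c c≤a with a zero ≤? β
  ... | yes a≤β = begin
    suc k ! * c ^ suc k * length (List.map (0 Vec.∷_) l₁ List.++ List.map bump l₂)
      ≡⟨ cong (suc k ! * c ^ suc k *_) (trans (List.length-++ (List.map (0 Vec.∷_) l₁))
           (cong₂ _+_ (List.length-map _ l₁) (List.length-map _ l₂))) ⟩
    suc k ! * c ^ suc k * (length l₁ + length l₂)
      ≡⟨ *-distribˡ-+ (suc k ! * c ^ suc k) (length l₁) (length l₂) ⟩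
    suc k ! * c ^ suc k * length l₁ + suc k ! * c ^ suc k * length l₂
      ≤⟨ +-mono-≤ (first-slice a β c c≤a) (length-slices a f (β ∸ a zero) c c≤a) ⟩
    suc k * (a zero * s ^ k) + (β ∸ a zero + sum (a ∘ suc) + a zero) ^ suc k
      ≡⟨ cong (λ t → suc k * (a zero * s ^ k) + t ^ suc k) (trans (reorder (β ∸ a zero) (sum (a ∘ suc)) (a zero))
           (cong (_+ sum (a ∘ suc)) (m∸n+n≡m a≤β))) ⟩
    suc k * (a zero * s ^ k) + s ^ suc k
      ≡⟨ +-comm (suc k * (a zero * s ^ k)) (s ^ suc k) ⟩
    s ^ suc k + suc k * (a zero * s ^ k)
      ≤⟨ ^-bernoulli s (a zero) k ⟩
    (s + a zero) ^ suc k
      ∎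
    where
    s = β + sum (a ∘ suc)
    l₁ = simplex k (a ∘ suc) β
    l₂ = slices a f (β ∸ a zero)
    reorder : ∀ x y z → x + y + z ≡ x + z + y
    reorder = solve-∀
  ... | no _ = begin
    suc k ! * c ^ suc k * length (List.map (0 Vec.∷_) (simplex k (a ∘ suc) β))
      ≡⟨ cong (suc k ! * c ^ suc k *_) (List.length-map _ (simplex k (a ∘ suc) β)) ⟩
    suc k ! * c ^ suc k * length (simplex k (a ∘ suc) β)
      ≤⟨ first-slice a β c c≤a ⟩
    suc k * (a zero * (β + sum (a ∘ suc)) ^ k)
      ≤⟨ m≤n+m _ ((β + sum (a ∘ suc)) ^ suc k) ⟩
    (β + sum (a ∘ suc)) ^ suc k + suc k * (a zero * (β + sum (a ∘ suc)) ^ k)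
      ≤⟨ ^-bernoulli (β + sum (a ∘ suc)) (a zero) k ⟩
    (β + sum (a ∘ suc) + a zero) ^ suc k
      ∎

  ∈-simplex : ∀ k (a : Vector ℕ k) β → (∀ j → 0 < a j) → (v : Vector ℕ k) → sum (λ j → a j * v j) ≤ β → toVec v ∈ simplex k a β
  ∈-slices : ∀ {k} (a : Vector ℕ (suc k)) f β → (∀ j → 0 < a j) → ∀ x (v : Vector ℕ k) → x < f →
    a zero * x + sum (λ j → a (suc j) * v j) ≤ β → x Vec.∷ toVec v ∈ slices a f β

  ∈-simplex zero    a β 0<a v le = here refl
  -- As `a zero` is at least 1, the first entry is at most β, so the fuel `suc β` suffices.
  ∈-simplex (suc k) a β 0<a v le = ∈-slices a (suc β) β 0<a (v zero) (v ∘ suc)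
    (s≤s (≤-trans (≤-trans (≤-reflexive (sym (*-identityˡ (v zero)))) (*-monoˡ-≤ (v zero) (0<a zero))) (m+n≤o⇒m≤o (a zero * v zero) le))) le

  ∈-slices {k} a (suc f) β 0<a zero    v x<f le with a zero ≤? β
  ... | yes _ = ∈-++⁺ˡ (∈-map⁺ (0 Vec.∷_) (∈-simplex k (a ∘ suc) β (0<a ∘ suc) v (m+n≤o⇒n≤o (a zero * 0) le)))
  ... | no  _ = ∈-map⁺ (0 Vec.∷_) (∈-simplex k (a ∘ suc) β (0<a ∘ suc) v (m+n≤o⇒n≤o (a zero * 0) le))
  ∈-slices {k} a (suc f) β 0<a (suc x) v x<f le with a zero ≤? β
  ... | yes _ = ∈-++⁺ʳ _ (∈-map⁺ bump (∈-slices a f (β ∸ a zero) 0<a x v (s≤s⁻¹ x<f)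
    (≤-trans (≤-reflexive (sym (m+n∸m≡n (a zero) _))) (∸-monoˡ-≤ (a zero) (≤-trans (≤-reflexive (eq (a zero) x (sum λ j → a (suc j) * v j))) le)))))
    where
    eq : ∀ a x s → a + (a * x + s) ≡ a * (1 + x) + s
    eq = solve-∀
  ... | no a≰β = contradiction (≤-trans (≤-trans (m≤m*n (a zero) (suc x)) (m≤m+n _ _)) le) a≰β

  simplex-count : ∀ {T k} (h : Fin T → Vector ℕ k) → Injective _≡_ _≗_ h →
    ∀ (a : Vector ℕ k) β c → 0 < c → (∀ j → c ≤ a j) → (∀ i → sum (λ j → a j * h i j) ≤ β) →
    k ! * c ^ k * T ≤ (β + sum a) ^ k
  simplex-count {T} {k} h h-inj a β c 0<c c≤a h≤ = ≤-trans (*-monoʳ-≤ (k ! * c ^ k) T≤) (length-simplex k a β c c≤a)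
    where
    mem : ∀ i → toVec (h i) ∈ simplex k a β
    mem i = ∈-simplex k a β (λ j → <-≤-trans 0<c (c≤a j)) (h i) (h≤ i)
    T≤ : T ≤ length (simplex k a β)
    T≤ = Fin.injective⇒≤ {f = index ∘ mem} λ {i} {j} eq → h-inj λ l →
      trans (sym (lookup∘tabulate (h i) l)) (trans (cong (λ v → Vec.lookup v l)
        (trans (lookup-index (mem i)) (trans (cong (List.lookup (simplex k a β)) eq) (sym (lookup-index (mem j))))))
      (lookup∘tabulate (h j) l))

-- Cell representatives of the residue classes and their solutions.

module CellSolutions where

  open Determinant
  open Minors
  open Lattice
  open CoordinateBound
  open import Defs using (Matrix; ∑ℤ)
  open import Data.Fin using (remQuot; combine)
  open import Data.Fin.Properties using (combine-remQuot)
  open import Data.Integer using (_+_; _*_; -_; _-_; ∣_∣; _≤_; _<_; _/ℕ_; _%ℕ_)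
  import Data.Integer.DivMod as ℤ
  open import Data.Integer.Tactic.RingSolver using (solve-∀)
  open import Algebra.Properties.Semiring.Sum ℤ.+-*-semiring using (sum-cong-≗; ∑-distrib-+; sum-remove; *-distribˡ-sum)
  open ≡-Reasoning

  det-∷-zero : ∀ {m} (R : Matrix ℤ m (suc m)) → Det ((λ _ → 0ℤ) ∷ R) ≡ 0ℤ
  det-∷-zero R = det-∷-combination (λ (_ : Fin 0) → 0ℤ) (λ ()) (λ _ → 0ℤ) R λ r → refl

  det-independent : ∀ {m} (w : Matrix ℤ m m) → Det w ≢ 0ℤ → (y : Vector ℤ m) →
    (∀ r → ∑ℤ (λ i → y i * w i r) ≡ 0ℤ) → ∀ i → y i ≡ 0ℤ
  det-independent {suc m} w det≢0 y rel i = [ id , (λ d≡0 → contradiction (det≡0 d≡0) det≢0) ]′ (ℤ.i*j≡0⇒i≡0∨j≡0 (y i) y*d≡0)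
    where
    d : ℤ
    d = Det (w i ∷ removeAt w i)
    rel′ : ∀ r → 0ℤ ≡ ∑ℤ λ j → (y i ∷ removeAt y i) j * (w i ∷ removeAt w i) j r
    rel′ r = trans (sym (rel r)) (sum-remove {i = i} λ j → y j * w j r)
    y*d≡0 : y i * d ≡ 0ℤ
    y*d≡0 = trans (sym (cramer (y i ∷ removeAt y i) (w i ∷ removeAt w i) (λ _ → 0ℤ) rel′)) (det-∷-zero (removeAt w i))
    det≡0 : d ≡ 0ℤ → Det w ≡ 0ℤ
    det≡0 d≡0 = trans (det-move w i) (trans (cong (sgn i *_) d≡0) (ℤ.*-zeroʳ (sgn i)))

  -- In the linear relation between x and the rows of `w` the coefficient of x is Det w.
  det-spans : ∀ {m} (w : Matrix ℤ m m) (x : Vector ℤ m) → Span w (λ r → Det w * x r)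
  det-spans {m} w x = c , λ r → solve (Det w) (x r) (∑ℤ λ i → c i * w i r) (trans (cong (λ z → 1ℤ * x r * Det w + z)
      (trans (*-distribˡ-sum -1ℤ λ i → c i * w i r) (sum-cong-≗ λ i → sign (sgn i) (Det (removeAt (x ∷ w) (suc i))) (w i r))))
      (det-relation (x ∷ w) r))
    where
    c : Vector ℤ m
    c i = sgn i * Det (removeAt (x ∷ w) (suc i))
    expand : ∀ d x s → d * x ≡ 1ℤ * x * d + -1ℤ * s + s
    expand = solve-∀
    solve : ∀ d x s → 1ℤ * x * d + -1ℤ * s ≡ 0ℤ → d * x ≡ s
    solve d x s eq = trans (expand d x s) (trans (cong (λ z → z + s) eq) (ℤ.+-identityˡ s))
    sign : ∀ s d w → -1ℤ * (s * d * w) ≡ -1ℤ * s * w * d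
    sign = solve-∀

  ∣det∣-spans : ∀ {m} (w : Matrix ℤ m m) (x : Vector ℤ m) → Span w (λ r → + ∣ Det w ∣ * x r)
  ∣det∣-spans w x with ℤ.+∣i∣≡i⊎+∣i∣≡-i (Det w)
  ... | inj₁ ∣d∣≡d = span-cong w (λ r → cong (_* x r) (sym ∣d∣≡d)) (det-spans w x)
  ... | inj₂ ∣d∣≡-d = span-cong w
    (λ r → trans (neg (Det w) (x r)) (cong (_* x r) (sym ∣d∣≡-d))) (det-spans w (-_ ∘ x))
    where
    neg : ∀ d x → d * - x ≡ - d * x
    neg = solve-∀

  module Fibres {m n k} (A : Matrix ℤ m n) (B : Fin m → Fin n) (N : Fin k → Fin n) (part : IsPartition B N)
                (E : ℕ) (E≡ : absMinor A B ≡ E) (q α : ℕ) where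

    private
      w : Matrix ℤ m m
      w = column A ∘ B
      Eq Eα : ℤ
      Eq = + (E ℕ.* q)
      Eα = + (E ℕ.* α)
      v : Vector ℤ m
      v r = ∑ℤ λ l → A r l

    -- b = (α / q) v + A_B (Θ / E q) with Θ / E q in (0, 1]ᵐ
    record InCell (b : Vector ℤ m) : Set where
      field
        Θ     : Vector ℤ m
        lower : ∀ i → 0ℤ < Θ i
        upper : ∀ i → Θ i ≤ Eq
        value : ∀ r → Eq * b r ≡ Eα * v r + ∑ℤ (λ i → Θ i * A r (B i))

    record Solution (b : Vector ℤ m) (u : Vector ℤ n) : Set where
      field
        nonNeg : ∀ l → 0ℤ ≤ u l
        solves : ∀ r → ∑ℤ (λ l → u l * A r l) ≡ b r

    -- E times an integer vector lies in the lattice of A_B, so E (q x - α v) has integer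
    -- coordinates C in its columns. Division by E q leaves the remainders Θ, and the quotients tell
    -- by which lattice vector x has to be moved.
    reduce-to-cell : 0 ℕ.< E ℕ.* q → ∀ (x : Vector ℤ m) → ∃ λ b → InCell b × Span w (λ r → b r - x r)
    reduce-to-cell 0<Eq x = b , record { Θ = Θ ; lower = lower ; upper = upper ; value = value } , t , λ r → cancel (x r) (∑ℤ λ i → t i * w i r)
      where
      instance _ = ℕ.>-nonZero 0<Eq
      y : Vector ℤ m
      y r = + q * x r - + α * v r
      spans : Span w (λ r → + E * y r)
      spans = subst (λ e → Span w (λ r → + e * y r)) E≡ (∣det∣-spans w y)
      C : Vector ℤ m
      C = proj₁ spans
      Θ t b : Vector ℤ m
      -- The shift by 1 produces remainders from 1 to E q instead of 0 to E q - 1, that is, the cell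
      -- (0, 1]ᵐ.
      Θ i = 1ℤ + + ((C i - 1ℤ) %ℕ (E ℕ.* q))
      t i = - ((C i - 1ℤ) /ℕ (E ℕ.* q))
      b r = x r + ∑ℤ λ i → t i * w i r
      cancel : ∀ x s → x + s - x ≡ s
      cancel = solve-∀
      lower : ∀ i → 0ℤ < Θ i
      lower i = ℤ.+<+ (ℕ.s≤s ℕ.z≤n)
      upper : ∀ i → Θ i ≤ Eq
      upper i = ℤ.+≤+ (ℤ.n%ℕd<d (C i - 1ℤ) (E ℕ.* q))
      Θ≡ : ∀ i → Θ i ≡ C i + Eq * t i
      Θ≡ i = trans (shift (+ ((C i - 1ℤ) %ℕ (E ℕ.* q))) ((C i - 1ℤ) /ℕ (E ℕ.* q)) Eq)
        (trans (cong (λ z → 1ℤ + z + Eq * t i) (sym (ℤ.a≡a%ℕn+[a/ℕn]*n (C i - 1ℤ) (E ℕ.* q)))) (unshift (C i) (Eq * t i)))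
        where
        shift : ∀ r p e → 1ℤ + r ≡ 1ℤ + (r + p * e) + e * - p
        shift = solve-∀
        unshift : ∀ c z → 1ℤ + (c - 1ℤ) + z ≡ c + z
        unshift = solve-∀
      value : ∀ r → Eq * b r ≡ Eα * v r + ∑ℤ (λ i → Θ i * A r (B i))
      value r = begin
        Eq * (x r + T)                               ≡⟨ cong (λ e → e * (x r + T)) (ℤ.pos-* E q) ⟩
        + E * + q * (x r + T)                        ≡⟨ expand (+ E) (+ q) (+ α) (x r) (v r) T ⟩
        + E * + α * v r + (+ E * y r + + E * + q * T) ≡⟨ cong₂ (λ e e′ → e * v r + (+ E * y r + e′ * T)) (ℤ.pos-* E α) (ℤ.pos-* E q) ⟨
        Eα * v r + (+ E * y r + Eq * T)              ≡⟨ cong (λ z → Eα * v r + z) (begin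
          + E * y r + Eq * T                                     ≡⟨ cong₂ _+_ (proj₂ spans r) (*-distribˡ-sum Eq λ i → t i * w i r) ⟩
          ∑ℤ (λ i → C i * w i r) + ∑ℤ (λ i → Eq * (t i * w i r)) ≡⟨ ∑-distrib-+ (λ i → C i * w i r) (λ i → Eq * (t i * w i r)) ⟨
          ∑ℤ (λ i → C i * w i r + Eq * (t i * w i r))            ≡⟨ sum-cong-≗ (λ i → trans (collect (C i) (w i r) Eq (t i)) (cong (_* w i r) (sym (Θ≡ i)))) ⟩
          ∑ℤ (λ i → Θ i * A r (B i))                             ∎) ⟩
        Eα * v r + ∑ℤ (λ i → Θ i * A r (B i))        ∎
        where
        T = ∑ℤ λ i → t i * w i r
        expand : ∀ E q α x v T → E * q * (x + T) ≡ E * α * v + (E * (q * x - α * v) + E * q * T)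
        expand = solve-∀
        collect : ∀ c w e t → c * w + e * (t * w) ≡ (c + e * t) * w
        collect = solve-∀

    Solution-difference : ∀ {b b′ u u′} → Solution b u → Solution b′ u′ → u ∘ N ≗ u′ ∘ N →
      ∀ r → b r - b′ r ≡ ∑ℤ λ i → (u (B i) - u′ (B i)) * w i r
    Solution-difference {b} {b′} {u} {u′} sol sol′ uN≗u′N r = begin
      b r - b′ r
        ≡⟨ cong₂ _-_ (trans (sym (solves sol r)) (split _)) (trans (sym (solves sol′ r)) (split _)) ⟩
      (∑ℤ (λ i → u (B i) * w i r) + ∑ℤ (λ j → u (N j) * A r (N j))) - (∑ℤ (λ i → u′ (B i) * w i r) + ∑ℤ (λ j → u′ (N j) * A r (N j)))
        ≡⟨ cong (λ z → (∑ℤ (λ i → u (B i) * w i r) + ∑ℤ (λ j → u (N j) * A r (N j))) - (∑ℤ (λ i → u′ (B i) * w i r) + z))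
             (sum-cong-≗ λ j → cong (_* A r (N j)) (sym (uN≗u′N j))) ⟩
      (∑ℤ (λ i → u (B i) * w i r) + ∑ℤ (λ j → u (N j) * A r (N j))) - (∑ℤ (λ i → u′ (B i) * w i r) + ∑ℤ (λ j → u (N j) * A r (N j)))
        ≡⟨ cancel (∑ℤ λ i → u (B i) * w i r) (∑ℤ λ i → u′ (B i) * w i r) (∑ℤ λ j → u (N j) * A r (N j)) ⟩
      ∑ℤ (λ i → u (B i) * w i r) + -1ℤ * ∑ℤ (λ i → u′ (B i) * w i r)
        ≡⟨ cong (λ z → ∑ℤ (λ i → u (B i) * w i r) + z) (*-distribˡ-sum -1ℤ λ i → u′ (B i) * w i r) ⟩
      ∑ℤ (λ i → u (B i) * w i r) + ∑ℤ (λ i → -1ℤ * (u′ (B i) * w i r))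
        ≡⟨ ∑-distrib-+ (λ i → u (B i) * w i r) (λ i → -1ℤ * (u′ (B i) * w i r)) ⟨
      ∑ℤ (λ i → u (B i) * w i r + -1ℤ * (u′ (B i) * w i r))
        ≡⟨ sum-cong-≗ (λ i → collect (u (B i)) (u′ (B i)) (w i r)) ⟩
      ∑ℤ (λ i → (u (B i) - u′ (B i)) * w i r)
        ∎
      where
      open Solution
      open IsPartition part using (split)
      cancel : ∀ x y z → (x + z) - (y + z) ≡ x + -1ℤ * y
      cancel = solve-∀
      collect : ∀ u u′ w → u * w + -1ℤ * (u′ * w) ≡ (u - u′) * w
      collect = solve-∀

    -- Modulo the lattice spanned by the columns of A_B the vector A u is determined by the coordinates of u outside B.
    restriction-injective : ∀ {s} → Det w ≢ 0ℤ → (family : IncongruentFamily w E) (b : Fin E → Vector ℤ m) →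
      (∀ x → Span w (λ r → b x r - proj₁ family x r)) →
      (h : Fin E → Fin s → Vector ℤ n) → (∀ x → Injective _≡_ _≗_ (h x)) → (∀ x t → Solution (b x) (h x t)) →
      ∀ x t x′ t′ → h x t ∘ N ≗ h x′ t′ ∘ N → x ≡ x′ × t ≡ t′
    restriction-injective {s} det≢0 (ρ , incongruent) b near h h-inj sol x t x′ t′ eq =
      x≡x′ , h-inj x′ (agree x≡x′)
      where
      difference : ∀ r → b x r - b x′ r ≡ ∑ℤ λ i → (h x t (B i) - h x′ t′ (B i)) * w i r
      difference = Solution-difference (sol x t) (sol x′ t′) eq
      rearrange : ∀ b b′ x x′ → b - b′ + -1ℤ * (b - x) + 1ℤ * (b′ - x′) ≡ x - x′
      rearrange = solve-∀
      x≡x′ : x ≡ x′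
      x≡x′ = incongruent x x′ (span-cong w (λ r → rearrange (b x r) (b x′ r) (ρ x r) (ρ x′ r))
        (span-+* w {λ r → b x r - b x′ r + -1ℤ * (b x r - ρ x r)} {λ r → b x′ r - ρ x′ r} 1ℤ
          (span-+* w {λ r → b x r - b x′ r} {λ r → b x r - ρ x r} -1ℤ ((λ i → h x t (B i) - h x′ t′ (B i)) , difference) (near x)) (near x′)))
      on-B : x ≡ x′ → ∀ i → h x t (B i) ≡ h x′ t′ (B i)
      on-B refl i = ℤ.i-j≡0⇒i≡j (h x t (B i)) (h x′ t′ (B i)) (det-independent w det≢0 (λ i → h x t (B i) - h x′ t′ (B i))
        (λ r → trans (sym (difference r)) (ℤ.+-inverseʳ (b x r))) i)
      everywhere : x ≡ x′ → ∀ l → (∃ λ i → B i ≡ l) ⊎ (∃ λ j → N j ≡ l) → h x t l ≡ h x′ t′ l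
      everywhere x≡x′ l (inj₁ (i , refl)) = on-B x≡x′ i
      everywhere x≡x′ l (inj₂ (j , refl)) = eq j
      agree : x ≡ x′ → h x′ t ≗ h x′ t′
      agree refl l = everywhere refl l (IsPartition.cover part l)

    solution-family : ∀ s → 0 ℕ.< E ℕ.* q →
      (∀ b → InCell b → ∃ λ (f : Fin s → Vector ℤ n) → Injective _≡_ _≗_ f × ∀ i → Solution b (f i)) →
      ∃ λ (h : Fin (E ℕ.* s) → Vector ℤ n) → Injective _≡_ _≗_ (λ i → h i ∘ N) × ∀ i → ∃ λ b → InCell b × Solution b (h i)
    solution-family s 0<Eq solutions = (λ i → h (quotient i) (remainder i)) , inj ,
      λ i → b (quotient i) , cell (quotient i) , sol (quotient i) (remainder i)
      where
      family : IncongruentFamily w E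
      family = subst (IncongruentFamily w) E≡ (incongruentFamily w)
      reduced : ∀ x → ∃ λ b → InCell b × Span w (λ r → b r - proj₁ family x r)
      reduced x = reduce-to-cell 0<Eq (proj₁ family x)
      b : Fin E → Vector ℤ m
      b x = proj₁ (reduced x)
      cell : ∀ x → InCell (b x)
      cell x = proj₁ (proj₂ (reduced x))
      h : Fin E → Fin s → Vector ℤ n
      h x = proj₁ (solutions (b x) (cell x))
      sol : ∀ x t → Solution (b x) (h x t)
      sol x = proj₂ (proj₂ (solutions (b x) (cell x)))
      det≢0 : Det w ≢ 0ℤ
      det≢0 det≡0 = ℕ.<-irrefl (sym (cong (ℕ._* q) (trans (sym E≡) (cong ∣_∣ det≡0)))) 0<Eq
      quotient : Fin (E ℕ.* s) → Fin E
      quotient i = proj₁ (remQuot {E} s i)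
      remainder : Fin (E ℕ.* s) → Fin s
      remainder i = proj₂ (remQuot {E} s i)
      injective : ∀ x t x′ t′ → h x t ∘ N ≗ h x′ t′ ∘ N → x ≡ x′ × t ≡ t′
      injective = restriction-injective det≢0 family b (λ x → proj₂ (proj₂ (reduced x))) h
        (λ x → proj₁ (proj₂ (solutions (b x) (cell x)))) sol
      inj : Injective _≡_ _≗_ (λ i → h (quotient i) (remainder i) ∘ N)
      inj {i} {j} eq =
        let (x≡ , t≡) = injective (quotient i) (remainder i) (quotient j) (remainder j) eq
        in trans (sym (combine-remQuot {E} s i)) (trans (cong₂ combine x≡ t≡) (combine-remQuot {E} s j))

-- Integers inside the rationals and the reals.

module Embedding where

  open PointedMatrix
  open import Defs
  open Rational using (fromℕ; unitFraction)
  open Real using (ℝ; seq; fromℚ; fromℤ; 0ℝ; 1ℝ; ∑)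
  import Algebra.Bundles
  import Data.Integer.Tactic.RingSolver as ℤSolver
  import Data.Nat.Coprimality as Coprime
  open import Data.Rational as ℚ using (ℚ; mkℚ; 0ℚ; 1ℚ; ½; _+_; _*_; _-_; -_; _≤_; _<_; ∣_∣)
  import Data.Rational.Properties as ℚ
  open import Data.Rational.Solver using (module +-*-Solver)
  import Data.Rational.Unnormalised as ℚᵘ
  import Data.Rational.Unnormalised.Properties as ℚᵘ
  open import Relation.Unary using (_∈_; _≐_)
  import Algebra.Properties.Semiring.Sum (Algebra.Bundles.CommutativeRing.semiring ℚ.+-*-commutativeRing) as ℚSum

  opaque

    -- Opaque, so that later proofs see only the homomorphism laws and not the normalisation of
    -- fractions inside `z ℚ./ 1`.
    ι : ℤ → ℚ
    ι z = z ℚ./ 1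

    ι≡ : ∀ z → ι z ≡ z ℚ./ 1
    ι≡ z = refl

    private
      ι≡mkℚ : ∀ z → ι z ≡ mkℚ z 0 (Coprime.sym (Coprime.1-coprimeTo ℤ.∣ z ∣))
      ι≡mkℚ z = ℚ.↥p/↧p≡p (mkℚ z 0 (Coprime.sym (Coprime.1-coprimeTo ℤ.∣ z ∣)))

      toℚᵘ-ι : ∀ z → ℚ.toℚᵘ (ι z) ≡ ℚᵘ.mkℚᵘ z 0
      toℚᵘ-ι z = cong ℚ.toℚᵘ (ι≡mkℚ z)

    ι-+ : ∀ a b → ι (a ℤ.+ b) ≡ ι a + ι b
    ι-+ a b = ℚ.toℚᵘ-injective (ℚᵘ.≃-trans (ℚᵘ.≃-reflexive (toℚᵘ-ι (a ℤ.+ b))) (ℚᵘ.≃-sym (ℚᵘ.≃-trans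
      (ℚ.toℚᵘ-homo-+ (ι a) (ι b)) (ℚᵘ.≃-trans (ℚᵘ.≃-reflexive (cong₂ ℚᵘ._+_ (toℚᵘ-ι a) (toℚᵘ-ι b))) (ℚᵘ.*≡* (eq a b))))))
      where
      eq : ∀ a b → (a ℤ.* + 1 ℤ.+ b ℤ.* + 1) ℤ.* + 1 ≡ (a ℤ.+ b) ℤ.* + 1
      eq = ℤSolver.solve-∀

    ι-* : ∀ a b → ι (a ℤ.* b) ≡ ι a * ι b
    ι-* a b = ℚ.toℚᵘ-injective (ℚᵘ.≃-trans (ℚᵘ.≃-reflexive (toℚᵘ-ι (a ℤ.* b))) (ℚᵘ.≃-sym (ℚᵘ.≃-trans
      (ℚ.toℚᵘ-homo-* (ι a) (ι b)) (ℚᵘ.≃-reflexive (cong₂ ℚᵘ._*_ (toℚᵘ-ι a) (toℚᵘ-ι b))))))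

    ι-mono : ∀ {a b} → a ℤ.≤ b → ι a ≤ ι b
    ι-mono {a} {b} a≤b = subst₂ _≤_ (sym (ι≡mkℚ a)) (sym (ι≡mkℚ b)) (ℚ.*≤* (ℤ.*-monoʳ-≤-nonNeg (+ 1) a≤b))

    ι-cancel-≤ : ∀ {a b} → ι a ≤ ι b → a ℤ.≤ b
    ι-cancel-≤ {a} {b} ιa≤ιb = ℤ.*-cancelʳ-≤-pos a b (+ 1) (ℚ.drop-*≤* (subst₂ _≤_ (ι≡mkℚ a) (ι≡mkℚ b) ιa≤ιb))

    ι-0 : ι 0ℤ ≡ 0ℚ
    ι-0 = refl

    ι-1 : ι 1ℤ ≡ 1ℚ
    ι-1 = refl

    ι-fromℕ : ∀ n → ι (+ n) ≡ fromℕ n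
    ι-fromℕ n = ι≡mkℚ (+ n)

    /-ι : ∀ a n .{{_ : ℕ.NonZero n}} → (a ℚ./ n) * ι (+ n) ≡ ι a
    /-ι a n@(suc n-1) = ℚ.toℚᵘ-injective (ℚᵘ.≃-trans (ℚ.toℚᵘ-homo-* (a ℚ./ n) (ι (+ n))) (ℚᵘ.≃-trans
      (ℚᵘ.*-cong (ℚ.toℚᵘ-fromℚᵘ (ℚᵘ.mkℚᵘ a n-1)) (ℚᵘ.≃-reflexive (toℚᵘ-ι (+ n))))
      (ℚᵘ.≃-trans (ℚᵘ.*≡* (eq a (+ n))) (ℚᵘ.≃-reflexive (sym (toℚᵘ-ι a))))))
      where
      eq : ∀ a n → a ℤ.* n ℤ.* + 1 ≡ a ℤ.* (n ℤ.* + 1)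
      eq = ℤSolver.solve-∀

  nonNeg-fraction : ∀ p → 0ℚ ≤ p → ∃ λ α → ∃ λ q → 0 ℕ.< q × p * ι (+ q) ≡ ι (+ α)
  nonNeg-fraction p@(mkℚ (+ α) d _) _ = α , suc d , ℕ.s≤s ℕ.z≤n , trans (cong (_* ι (+ suc d)) (sym (ℚ.↥p/↧p≡p p))) (/-ι (+ α) (suc d))
  nonNeg-fraction (mkℚ -[1+ _ ] _ _) (ℚ.*≤* ())

  ι-∑ : ∀ {n} (f : Vector ℤ n) → ι (∑ℤ f) ≡ ℚSum.sum (ι ∘ f)
  ι-∑ {zero}  f = ι-0
  ι-∑ {suc n} f = trans (ι-+ (f zero) (∑ℤ (f ∘ suc))) (cong (λ z → ι (f zero) + z) (ι-∑ (f ∘ suc)))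

  ι-∑* : ∀ {n} (f g : Vector ℤ n) → ι (∑ℤ λ i → f i ℤ.* g i) ≡ ℚSum.sum λ i → ι (f i) * ι (g i)
  ι-∑* f g = trans (ι-∑ λ i → f i ℤ.* g i) (ℚSum.sum-cong-≗ λ i → ι-* (f i) (g i))

  seq-∑ : ∀ {n} (f : Vector ℝ n) t → seq (∑ f) t ≡ ℚSum.sum λ i → seq (f i) t
  seq-∑ {zero}  f t = refl
  seq-∑ {suc n} f t = cong (λ z → seq (f zero) t + z) (seq-∑ (f ∘ suc) t)

  seq-*ᵥ : ∀ {m n} (A : Matrix ℤ m n) (x : Vector ℝ n) r t →
    seq ((A *ᵥ x) r) t ≡ ℚSum.sum λ l → ι (A r l) * seq (x l) t
  seq-*ᵥ A x r t = trans (seq-∑ (λ l → fromℤ (A r l) Real.* x l) t)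
    (ℚSum.sum-cong-≗ λ l → cong (_* seq (x l) t) (sym (ι≡ (A r l))))

  ≤-pointwise : ∀ {x y} → (∀ t → seq x t ≤ seq y t) → x Real.≤ y
  ≤-pointwise {x} {y} x≤y ε 0<ε = 0 , λ t _ → ℚ.≤-trans (x≤y t) (Rational.x≤x+y (seq y t) (ℚ.<⇒≤ 0<ε))

  ≃-pointwise : ∀ {x y} → (∀ t → seq x t ≡ seq y t) → x Real.≃ y
  ≃-pointwise {x} {y} x≡y = ≤-pointwise {x} {y} (λ t → ℚ.≤-reflexive (x≡y t)) , ≤-pointwise {y} {x} λ t → ℚ.≤-reflexive (sym (x≡y t))

  ≤+ε⇒≤ : ∀ {p q} → (∀ ε → 0ℚ < ε → p ≤ q + ε) → p ≤ q
  ≤+ε⇒≤ {p} {q} p≤q+ε with p ℚ.≤? q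
  ... | yes p≤q = p≤q
  ... | no  p≰q = contradiction (ℚ.≤-<-trans (p≤q+ε ε (Rational.0<½* 0<d)) q+ε<p) (ℚ.<-irrefl refl)
    where
    open +-*-Solver using (solve; _:+_; _:*_; _:-_; _:=_; con)
    d = p - q
    ε = ½ * d
    q<p : q < p
    q<p = ℚ.≰⇒> p≰q
    0<d : 0ℚ < d
    0<d = subst (_< d) (ℚ.+-inverseʳ q) (ℚ.+-monoˡ-< (- q) q<p)
    q+ε<p : q + ε < p
    q+ε<p = subst₂ _<_ (ℚ.+-identityʳ (q + ε)) (trans (ℚ.+-assoc q ε ε) (trans (cong (λ z → q + z) (Rational.½*+½* d))
      (solve 2 (λ p q → q :+ (p :- q) := p) refl p q))) (ℚ.+-monoʳ-< (q + ε) (Rational.0<½* 0<d))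

  fromℚ-cancel-≤ : ∀ {p q} → fromℚ p Real.≤ fromℚ q → p ≤ q
  fromℚ-cancel-≤ p≤q = ≤+ε⇒≤ λ ε 0<ε → let (N , le) = p≤q ε 0<ε in le N ℕ.≤-refl

  fromℤ-cancel-≤ : ∀ {a b} → fromℤ a Real.≤ fromℤ b → a ℤ.≤ b
  fromℤ-cancel-≤ {a} {b} a≤b = ι-cancel-≤ (subst₂ _≤_ (sym (ι≡ a)) (sym (ι≡ b)) (fromℚ-cancel-≤ a≤b))

  fromℤ-injective : ∀ {a b} → fromℤ a Real.≃ fromℤ b → a ≡ b
  fromℤ-injective (a≤b , b≤a) = ℤ.≤-antisym (fromℤ-cancel-≤ a≤b) (fromℤ-cancel-≤ b≤a)

  fromℤ-mono : ∀ {a b} → a ℤ.≤ b → fromℤ a Real.≤ fromℤ b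
  fromℤ-mono {a} {b} a≤b = ≤-pointwise {fromℤ a} {fromℤ b} λ _ → subst₂ _≤_ (ι≡ a) (ι≡ b) (ι-mono a≤b)

  seq-*ᵥ-embed : ∀ {m n} (A : Matrix ℤ m n) (z : Vector ℤ n) r t →
    seq ((A *ᵥ embed z) r) t ≡ seq (fromℤ (∑ℤ λ l → z l ℤ.* A r l)) t
  seq-*ᵥ-embed A z r t = trans (seq-*ᵥ A (embed z) r t) (trans
    (ℚSum.sum-cong-≗ λ l → trans (cong (λ x → ι (A r l) * x) (sym (ι≡ (z l)))) (ℚ.*-comm (ι (A r l)) (ι (z l))))
    (trans (sym (ι-∑* z (A r))) (ι≡ (∑ℤ λ l → z l ℤ.* A r l))))

  integer-point⁻ : ∀ {m n} (A : Matrix ℤ m n) b z → embed z ∈ P A b →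
    (∀ l → 0ℤ ℤ.≤ z l) × (∀ r → ∑ℤ (λ l → z l ℤ.* A r l) ≡ b r)
  integer-point⁻ A b z (z≥0 , (Az≈b)) = (λ l → fromℤ-cancel-≤ {0ℤ} {z l} (z≥0 l)) , λ r → ℤ.≤-antisym
    (fromℤ-cancel-≤ λ ε 0<ε → let (N , le) = proj₁ (Az≈b r) ε 0<ε in N , λ t t≥ →
      subst (_≤ seq (fromℤ (b r)) t + ε) (seq-*ᵥ-embed A z r t) (le t t≥))
    (fromℤ-cancel-≤ λ ε 0<ε → let (N , le) = proj₂ (Az≈b r) ε 0<ε in N , λ t t≥ →
      subst (λ x → seq (fromℤ (b r)) t ≤ x + ε) (seq-*ᵥ-embed A z r t) (le t t≥))

  pointed : ∀ {m n} (A : Matrix ℤ m n) → P A (λ _ → 0ℤ) ≐ (λ x → x ≈ 0ᵥ) → Pointed A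
  pointed A (P⊆0 , _) z z≥0 Az≡0 l = fromℤ-injective {z l} {0ℤ} (P⊆0 {embed z}
    ((λ l → fromℤ-mono {0ℤ} {z l} (z≥0 l)) , λ r → ≃-pointwise {(A *ᵥ embed z) r} {fromℤ 0ℤ} λ t →
      trans (seq-*ᵥ-embed A z r t) (cong (λ a → seq (fromℤ a) t) (Az≡0 r))) l)

-- The points of a cell are interior points of g v + C.

module InteriorCells where

  open Determinant
  open Minors
  open Lattice
  open PointedMatrix
  open CellSolutions
  open Embedding
  open import Defs
  open Rational using (unitFraction)
  open Real using (ℝ; seq; fromℚ; fromℤ; 0ℝ; 1ℝ; ∑)
  open import Data.Rational as ℚ using (ℚ; 0ℚ; 1ℚ; _+_; _*_; _-_; -_; _≤_; _<_)
  import Data.Rational.Properties as ℚ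
  open import Data.Rational.Solver using (module +-*-Solver)
  open import Relation.Unary using (_∈_)
  import Algebra.Bundles
  import Algebra.Properties.Semiring.Sum (Algebra.Bundles.CommutativeRing.semiring ℚ.+-*-commutativeRing) as ℚSum
  open +-*-Solver using (solve; _:+_; _:*_; _:-_; :-_; _:=_; con)

  ∑ℚ : ∀ {n} → Vector ℚ n → ℚ
  ∑ℚ = ℚSum.sum

  ∑ℚ-zero : ∀ {n} {f : Vector ℚ n} → (∀ i → f i ≡ 0ℚ) → ∑ℚ f ≡ 0ℚ
  ∑ℚ-zero {zero}  f≡0 = refl
  ∑ℚ-zero {suc n} f≡0 = cong₂ _+_ (f≡0 zero) (∑ℚ-zero (f≡0 ∘ suc))

  ∑ℚ-mono : ∀ {n} {f g : Vector ℚ n} → (∀ i → f i ≤ g i) → ∑ℚ f ≤ ∑ℚ g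
  ∑ℚ-mono {zero}  f≤g = ℚ.≤-refl
  ∑ℚ-mono {suc n} f≤g = ℚ.+-mono-≤ (f≤g zero) (∑ℚ-mono (f≤g ∘ suc))

  ∑ℚ-δ : ∀ {n} i (x : Vector ℚ n) → ∑ℚ (λ j → ι (δ i j) * x j) ≡ x i
  ∑ℚ-δ {suc n} zero x = trans (cong₂ _+_
      (trans (cong (_* x zero) ι-1) (ℚ.*-identityˡ (x zero)))
      (∑ℚ-zero {n} λ j → trans (cong (_* x (suc j)) ι-0) (ℚ.*-zeroˡ (x (suc j)))))
    (ℚ.+-identityʳ (x zero))
  ∑ℚ-δ {suc n} (suc i) x = trans (cong₂ _+_ (trans (cong (_* x zero) ι-0) (ℚ.*-zeroˡ (x zero))) (∑ℚ-δ i (x ∘ suc)))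
    (ℚ.+-identityˡ (x (suc i)))

  δ-sym : ∀ {n} (i j : Fin n) → δ i j ≡ δ j i
  δ-sym zero    zero    = refl
  δ-sym zero    (suc j) = refl
  δ-sym (suc i) zero    = refl
  δ-sym (suc i) (suc j) = δ-sym i j

  -- One row a of A, applied to the vector with all entries h and ω added on the columns in B.
  row-value : ∀ {m n} (a : Vector ℤ n) (B : Fin m → Fin n) (h : ℚ) (ω : Vector ℚ m) →
    ∑ℚ (λ l → ι (a l) * (h + ∑ℚ λ i → ι (δ (B i) l) * ω i)) ≡ h * ι (∑ℤ a) + ∑ℚ λ i → ι (a (B i)) * ω i
  row-value a B h ω = begin
    ∑ℚ (λ l → ι (a l) * (h + ∑ℚ λ i → ι (δ (B i) l) * ω i))
      ≡⟨ ℚSum.sum-cong-≗ (λ l → trans (ℚ.*-distribˡ-+ (ι (a l)) h (∑ℚ λ i → ι (δ (B i) l) * ω i)) (cong₂ _+_ (ℚ.*-comm (ι (a l)) h)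
           (trans (ℚSum.*-distribˡ-sum (ι (a l)) λ i → ι (δ (B i) l) * ω i) (ℚSum.sum-cong-≗ λ i → swap (ι (a l)) (ι (δ (B i) l)) (ω i))))) ⟩
    ∑ℚ (λ l → h * ι (a l) + ∑ℚ λ i → ι (δ (B i) l) * ι (a l) * ω i)
      ≡⟨ ℚSum.∑-distrib-+ (λ l → h * ι (a l)) (λ l → ∑ℚ λ i → ι (δ (B i) l) * ι (a l) * ω i) ⟩
    ∑ℚ (λ l → h * ι (a l)) + ∑ℚ (λ l → ∑ℚ λ i → ι (δ (B i) l) * ι (a l) * ω i)
      ≡⟨ cong₂ _+_ (trans (sym (ℚSum.*-distribˡ-sum h (ι ∘ a))) (cong (h *_) (sym (ι-∑ a))))
           (ℚSum.∑-comm λ l i → ι (δ (B i) l) * ι (a l) * ω i) ⟩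
    h * ι (∑ℤ a) + ∑ℚ (λ i → ∑ℚ λ l → ι (δ (B i) l) * ι (a l) * ω i)
      ≡⟨ cong (λ z → h * ι (∑ℤ a) + z) (ℚSum.sum-cong-≗ λ i → trans (sym (ℚSum.*-distribʳ-sum (ω i) λ l → ι (δ (B i) l) * ι (a l)))
           (cong (_* ω i) (∑ℚ-δ (B i) (ι ∘ a)))) ⟩
    h * ι (∑ℤ a) + ∑ℚ (λ i → ι (a (B i)) * ω i)
      ∎
    where
    open ≡-Reasoning
    swap : ∀ x y z → x * (y * z) ≡ y * x * z
    swap = solve 3 (λ x y z → x :* (y :* z) := y :* x :* z) refl

  eventually-all : ∀ {m} {Q : Fin m → ℕ → Set} → (∀ i → ∃ λ N → ∀ t → N ℕ.≤ t → Q i t) → ∃ λ N → ∀ t → N ℕ.≤ t → ∀ i → Q i t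
  eventually-all {zero}  ev = 0 , λ _ _ ()
  eventually-all {suc m} {Q} ev =
    let (N , q) = ev zero
        (N′ , q′) = eventually-all {m} {Q ∘ suc} (ev ∘ suc)
    in N ℕ.⊔ N′ , λ t t≥ → λ { zero → q t (ℕ.m⊔n≤o⇒m≤o N N′ t≥) ; (suc i) → q′ t (ℕ.m⊔n≤o⇒n≤o N N′ t≥) i }

  scaled-lower : ∀ c {x ε} → - ε ≤ x → x ≤ ε → - (ι (+ ℤ.∣ c ∣) * ε) ≤ ι c * x
  scaled-lower c@(+ n) {x} {ε} -ε≤x x≤ε = subst (_≤ ι c * x) (sym (ℚ.neg-distribʳ-* (ι c) ε))
    (ℚ.*-monoˡ-≤-nonNeg (ι c) {{ℚ.nonNegative (subst (_≤ ι c) ι-0 (ι-mono (ℤ.+≤+ ℕ.z≤n)))}} -ε≤x)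
  scaled-lower c@(-[1+ n ]) {x} {ε} -ε≤x x≤ε = subst₂ _≤_ (sym (ℚ.neg-distribʳ-* d ε)) eq
    (ℚ.*-monoˡ-≤-nonNeg d {{ℚ.nonNegative (subst (_≤ d) ι-0 (ι-mono (ℤ.+≤+ ℕ.z≤n)))}} (ℚ.neg-antimono-≤ x≤ε))
    where
    d = ι (+ suc n)
    ιc : ι c ≡ - d
    ιc = trans (solve 2 (λ a b → a := :- b :+ (a :+ b)) refl (ι c) d)
      (trans (cong (λ z → - d + z) (trans (sym (ι-+ c (+ suc n))) (trans (cong ι (ℤ.+-inverseˡ (+ suc n))) ι-0))) (ℚ.+-identityʳ (- d)))
    eq : d * - x ≡ ι c * x
    eq = trans (solve 2 (λ d x → d :* :- x := :- d :* x) refl d x) (cong (_* x) (sym ιc))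

  module Interior {m n k} (A : Matrix ℤ m n) (B : Fin m → Fin n) (N : Fin k → Fin n) (part : IsPartition B N)
                  (E : ℕ) (E≡ : absMinor A B ≡ E) (q α : ℕ) (0<Eq : 0 ℕ.< E ℕ.* q)
                  (g′ : ℚ) (g′q≡α : g′ * ι (+ q) ≡ ι (+ α))
                  (g : ℝ) (T : ℕ) (g≤g′ : ∀ t → T ℕ.≤ t → seq g t ≤ g′) where

    open Fibres A B N part E E≡ q α

    private
      -- With integral C, the matrix C / E is the transposed inverse of A_B.
      C : Matrix ℤ m m
      C r′ = proj₁ (subst (λ e → Span (column A ∘ B) (λ r → + e ℤ.* δ r′ r)) E≡ (∣det∣-spans (column A ∘ B) (δ r′)))
      C-inverse : ∀ r′ r → + E ℤ.* δ r′ r ≡ ∑ℤ λ i → C r′ i ℤ.* A r (B i)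
      C-inverse r′ = proj₂ (subst (λ e → Span (column A ∘ B) (λ r → + e ℤ.* δ r′ r)) E≡ (∣det∣-spans (column A ∘ B) (δ r′)))

      -- A perturbation of b by at most ε₀ changes the i-th scaled coordinate by at most q ε₀ Σ |C
      -- r′ i|, summed over r′. The total sum over i and r′ bounds all of these, so ε₀ = 1 / (K + 1)
      -- keeps every change at most 1.
      K : ℕ
      K = q ℕ.* ℤ.∣ ∑ℤ (λ i → ∑ℤ λ r′ → + ℤ.∣ C r′ i ∣) ∣

      ε₀ : ℚ
      ε₀ = unitFraction K

      0<ε₀ : 0ℚ < ε₀
      0<ε₀ = ℚ.positive⁻¹ ε₀

      inverse : ∃ λ κ → 0ℚ < κ × ι (+ (E ℕ.* q)) * κ ≡ 1ℚ
      inverse = Rational.divide (ι (+ (E ℕ.* q))) 1ℚ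
        (subst (_< ι (+ (E ℕ.* q))) ι-0 (ℚ.≰⇒> λ le → ℕ.<⇒≱ 0<Eq (ℤ.drop‿+≤+ (ι-cancel-≤ le)))) (ℚ.positive⁻¹ 1ℚ)
      κ : ℚ
      κ = proj₁ inverse
      0≤κ : 0ℚ ≤ κ
      0≤κ = ℚ.<⇒≤ (proj₁ (proj₂ inverse))

      Σ∣C∣ : Fin m → ℤ
      Σ∣C∣ i = ∑ℤ λ r′ → + ℤ.∣ C r′ i ∣

      Σ∣C∣≥0 : ∀ i → 0ℤ ℤ.≤ Σ∣C∣ i
      Σ∣C∣≥0 i = ∑-nonNeg {m} {λ r′ → + ℤ.∣ C r′ i ∣} λ r′ → ℤ.+≤+ ℕ.z≤n

      q∣C∣≤K : ∀ i → + q ℤ.* Σ∣C∣ i ℤ.≤ + suc K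
      q∣C∣≤K i = ℤ.≤-trans (ℤ.*-monoˡ-≤-nonNeg (+ q) (term≤∑ Σ∣C∣≥0 i)) (ℤ.≤-trans (ℤ.≤-reflexive (begin
        + q ℤ.* ∑ℤ Σ∣C∣                    ≡⟨ cong (+ q ℤ.*_) (ℤ.0≤i⇒+∣i∣≡i (∑-nonNeg Σ∣C∣≥0)) ⟨
        + q ℤ.* + ℤ.∣ ∑ℤ Σ∣C∣ ∣            ≡⟨ ℤ.pos-* q ℤ.∣ ∑ℤ Σ∣C∣ ∣ ⟨
        + K                                ∎)) (ℤ.+≤+ (ℕ.n≤1+n K)))
        where open ≡-Reasoning

      qΣ∣C∣ε≤1 : ∀ i → ι (+ q) * (ι (Σ∣C∣ i) * ε₀) ≤ 1ℚ
      qΣ∣C∣ε≤1 i = subst₂ _≤_ (trans (cong (_* ε₀) (ι-* (+ q) (Σ∣C∣ i))) (ℚ.*-assoc (ι (+ q)) (ι (Σ∣C∣ i)) ε₀))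
        (trans (cong (_* ε₀) (ι-fromℕ (suc K))) (ℚ.*-inverseʳ (Rational.fromℕ (suc K))))
        (ℚ.*-monoʳ-≤-nonNeg ε₀ {{ℚ.nonNegative (ℚ.<⇒≤ 0<ε₀)}} (ι-mono (q∣C∣≤K i)))

    module _ (b : Vector ℤ m) (cell : InCell b) where

      open InCell cell

      private
        -- As κ = 1 / (E q), these are the coefficients of the point b + x - g′ v in the columns of
        -- A_B.
        weight : (Fin m → ℚ) → Fin m → ℚ
        weight x i = κ * (ι (Θ i) + ι (+ q) * ∑ℚ λ r′ → ι (C r′ i) * x r′)

        weight≥0 : ∀ x → (∀ r → - ε₀ ≤ x r × x r ≤ ε₀) → ∀ i → 0ℚ ≤ weight x i
        weight≥0 x small i = Rational.0≤* 0≤κ (begin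
          0ℚ                                             ≡⟨ ℚ.+-inverseʳ 1ℚ ⟨
          -- Θ i is a positive integer and so at least 1, which absorbs the perturbation.
          1ℚ + - 1ℚ                                      ≤⟨ ℚ.+-mono-≤ (subst (_≤ ι (Θ i)) ι-1 (ι-mono (ℤ.i<j⇒suc[i]≤j (lower i))))
                                                              (ℚ.neg-antimono-≤ (qΣ∣C∣ε≤1 i)) ⟩
          ι (Θ i) + - (ι (+ q) * (ι (Σ∣C∣ i) * ε₀))      ≡⟨ cong (λ z → ι (Θ i) + z) (ℚ.neg-distribʳ-* (ι (+ q)) (ι (Σ∣C∣ i) * ε₀)) ⟩
          ι (Θ i) + ι (+ q) * - (ι (Σ∣C∣ i) * ε₀)        ≤⟨ ℚ.+-monoʳ-≤ (ι (Θ i)) (ℚ.*-monoˡ-≤-nonNeg (ι (+ q))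
                                                              {{ℚ.nonNegative (subst (_≤ ι (+ q)) ι-0 (ι-mono (ℤ.+≤+ ℕ.z≤n)))}} inner) ⟩
          ι (Θ i) + ι (+ q) * ∑ℚ (λ r′ → ι (C r′ i) * x r′) ∎)
          where
          open ℚ.≤-Reasoning
          inner : - (ι (Σ∣C∣ i) * ε₀) ≤ ∑ℚ (λ r′ → ι (C r′ i) * x r′)
          inner = begin
            - (ι (Σ∣C∣ i) * ε₀)                           ≡⟨ ℚ.neg-distribʳ-* (ι (Σ∣C∣ i)) ε₀ ⟩
            ι (Σ∣C∣ i) * - ε₀                             ≡⟨ cong (_* - ε₀) (ι-∑ λ r′ → + ℤ.∣ C r′ i ∣) ⟩
            ∑ℚ (λ r′ → ι (+ ℤ.∣ C r′ i ∣)) * - ε₀         ≡⟨ ℚSum.*-distribʳ-sum (- ε₀) (λ r′ → ι (+ ℤ.∣ C r′ i ∣)) ⟩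
            ∑ℚ (λ r′ → ι (+ ℤ.∣ C r′ i ∣) * - ε₀)         ≡⟨ ℚSum.sum-cong-≗ (λ r′ → ℚ.neg-distribʳ-* (ι (+ ℤ.∣ C r′ i ∣)) ε₀) ⟨
            ∑ℚ (λ r′ → - (ι (+ ℤ.∣ C r′ i ∣) * ε₀))       ≤⟨ ∑ℚ-mono (λ r′ → scaled-lower (C r′ i) (proj₁ (small r′)) (proj₂ (small r′))) ⟩
            ∑ℚ (λ r′ → ι (C r′ i) * x r′)                 ∎

        weight-value : ∀ x r → ∑ℚ (λ i → ι (A r (B i)) * weight x i) ≡ ι (b r) - g′ * ι (∑ℤ (A r)) + x r
        weight-value x r = begin
          ∑ℚ (λ i → ι (A r (B i)) * weight x i)
            ≡⟨ ℚSum.sum-cong-≗ (λ i → regroup (ι (A r (B i))) κ (ι (Θ i)) (ι (+ q)) (Y i)) ⟩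
          ∑ℚ (λ i → κ * (ι (Θ i) * ι (A r (B i)) + ι (+ q) * (ι (A r (B i)) * Y i)))
            ≡⟨ ℚSum.*-distribˡ-sum κ (λ i → ι (Θ i) * ι (A r (B i)) + ι (+ q) * (ι (A r (B i)) * Y i)) ⟨
          κ * ∑ℚ (λ i → ι (Θ i) * ι (A r (B i)) + ι (+ q) * (ι (A r (B i)) * Y i))
            ≡⟨ cong (κ *_) (ℚSum.∑-distrib-+ (λ i → ι (Θ i) * ι (A r (B i))) (λ i → ι (+ q) * (ι (A r (B i)) * Y i))) ⟩
          κ * (∑ℚ (λ i → ι (Θ i) * ι (A r (B i))) + ∑ℚ (λ i → ι (+ q) * (ι (A r (B i)) * Y i)))
            ≡⟨ cong₂ (λ s t → κ * (s + t)) (sym (ι-∑* Θ (λ i → A r (B i)))) (sym (ℚSum.*-distribˡ-sum (ι (+ q)) λ i → ι (A r (B i)) * Y i)) ⟩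
          κ * (ι S + ι (+ q) * ∑ℚ (λ i → ι (A r (B i)) * Y i))
            ≡⟨ cong (λ t → κ * (ι S + ι (+ q) * t)) inverted ⟩
          κ * (ι S + ι (+ q) * (ι (+ E) * x r))
            ≡⟨ cong (λ s → κ * (s + ι (+ q) * (ι (+ E) * x r))) S≡ ⟩
          κ * (ι (+ E) * ι (+ q) * ι (b r) - ι (+ E) * (g′ * ι (+ q)) * V + ι (+ q) * (ι (+ E) * x r))
            ≡⟨ solve 7 (λ κ e q b g V x → κ :* (e :* q :* b :- e :* (g :* q) :* V :+ q :* (e :* x)) := e :* q :* κ :* (b :- g :* V :+ x)) refl
                 κ (ι (+ E)) (ι (+ q)) (ι (b r)) g′ V (x r) ⟩
          ι (+ E) * ι (+ q) * κ * (ι (b r) - g′ * V + x r)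
            ≡⟨ cong (_* (ι (b r) - g′ * V + x r)) (trans (cong (_* κ) (trans (sym (ι-* (+ E) (+ q))) (cong ι (sym (ℤ.pos-* E q))))) (proj₂ (proj₂ inverse))) ⟩
          1ℚ * (ι (b r) - g′ * V + x r)
            ≡⟨ ℚ.*-identityˡ (ι (b r) - g′ * V + x r) ⟩
          ι (b r) - g′ * V + x r
            ∎
          where
          open ≡-Reasoning
          V : ℚ
          V = ι (∑ℤ (A r))
          Y : Fin m → ℚ
          Y i = ∑ℚ λ r′ → ι (C r′ i) * x r′
          S : ℤ
          S = ∑ℤ (λ i → Θ i ℤ.* A r (B i))
          regroup : ∀ a κ θ q Y → a * (κ * (θ + q * Y)) ≡ κ * (θ * a + q * (a * Y))
          regroup = solve 5 (λ a κ θ q Y → a :* (κ :* (θ :+ q :* Y)) := κ :* (θ :* a :+ q :* (a :* Y))) refl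
          S≡ : ι S ≡ ι (+ E) * ι (+ q) * ι (b r) - ι (+ E) * (g′ * ι (+ q)) * V
          S≡ = begin
            ι S
              ≡⟨ solve 2 (λ s t → s := t :+ s :- t) refl (ι S) (ι (+ (E ℕ.* α) ℤ.* ∑ℤ (A r))) ⟩
            ι (+ (E ℕ.* α) ℤ.* ∑ℤ (A r)) + ι S - ι (+ (E ℕ.* α) ℤ.* ∑ℤ (A r))
              ≡⟨ cong (_- ι (+ (E ℕ.* α) ℤ.* ∑ℤ (A r))) (trans (sym (ι-+ (+ (E ℕ.* α) ℤ.* ∑ℤ (A r)) S)) (cong ι (sym (value r)))) ⟩
            ι (+ (E ℕ.* q) ℤ.* b r) - ι (+ (E ℕ.* α) ℤ.* ∑ℤ (A r))
              ≡⟨ cong₂ _-_ (trans (ι-* (+ (E ℕ.* q)) (b r)) (cong (_* ι (b r)) (trans (cong ι (ℤ.pos-* E q)) (ι-* (+ E) (+ q)))))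
                   (trans (ι-* (+ (E ℕ.* α)) (∑ℤ (A r))) (cong (_* V) (trans (cong ι (ℤ.pos-* E α)) (trans (ι-* (+ E) (+ α)) (cong (ι (+ E) *_) (sym g′q≡α)))))) ⟩
            ι (+ E) * ι (+ q) * ι (b r) - ι (+ E) * (g′ * ι (+ q)) * V
              ∎
          inverted : ∑ℚ (λ i → ι (A r (B i)) * Y i) ≡ ι (+ E) * x r
          inverted = begin
            ∑ℚ (λ i → ι (A r (B i)) * Y i)
              ≡⟨ ℚSum.sum-cong-≗ (λ i → trans (ℚSum.*-distribˡ-sum (ι (A r (B i))) λ r′ → ι (C r′ i) * x r′)
                   (ℚSum.sum-cong-≗ λ r′ → swap (ι (A r (B i))) (ι (C r′ i)) (x r′))) ⟩
            ∑ℚ (λ i → ∑ℚ λ r′ → ι (C r′ i) * ι (A r (B i)) * x r′)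
              ≡⟨ ℚSum.∑-comm (λ i r′ → ι (C r′ i) * ι (A r (B i)) * x r′) ⟩
            ∑ℚ (λ r′ → ∑ℚ λ i → ι (C r′ i) * ι (A r (B i)) * x r′)
              ≡⟨ ℚSum.sum-cong-≗ (λ r′ → trans (sym (ℚSum.*-distribʳ-sum (x r′) λ i → ι (C r′ i) * ι (A r (B i))))
                   (cong (_* x r′) (trans (sym (ι-∑* (C r′) (λ i → A r (B i)))) (trans (cong ι (sym (C-inverse r′ r)))
                     (trans (ι-* (+ E) (δ r′ r)) (cong (λ d → ι (+ E) * ι d) (δ-sym r′ r))))))) ⟩
            ∑ℚ (λ r′ → ι (+ E) * ι (δ r r′) * x r′)
              ≡⟨ ℚSum.sum-cong-≗ (λ r′ → ℚ.*-assoc (ι (+ E)) (ι (δ r r′)) (x r′)) ⟩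
            ∑ℚ (λ r′ → ι (+ E) * (ι (δ r r′) * x r′))
              ≡⟨ ℚSum.*-distribˡ-sum (ι (+ E)) (λ r′ → ι (δ r r′) * x r′) ⟨
            ι (+ E) * ∑ℚ (λ r′ → ι (δ r r′) * x r′)
              ≡⟨ cong (ι (+ E) *_) (∑ℚ-δ r x) ⟩
            ι (+ E) * x r
              ∎
            where
            swap : ∀ x y z → x * (y * z) ≡ y * x * z
            swap = solve 3 (λ x y z → x :* (y :* z) := y :* x :* z) refl

        offset : Vector ℝ m → ℕ → Fin m → ℚ
        offset z t r = seq (z r) t - ι (b r)

        ω : Vector ℝ m → Fin m → ℝ
        ω z i = fromℚ κ Real.* (fromℤ (Θ i) Real.+ fromℤ (+ q) Real.* ∑ λ r′ → fromℤ (C r′ i) Real.* (z r′ Real.- fromℤ (b r′)))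

        -- The decomposition is z = g v + (g′ - g) v + A_B ω; since v is the sum of all columns, g′
        -- - g is added to every coefficient.
        coefficients : Vector ℝ m → Vector ℝ n
        coefficients z l = (fromℚ g′ Real.- g) Real.+ ∑ λ i → fromℤ (δ (B i) l) Real.* ω z i

        seq-ω : ∀ z i t → seq (ω z i) t ≡ weight (offset z t) i
        seq-ω z i t = cong (κ *_) (cong₂ _+_ (sym (ι≡ (Θ i))) (cong₂ _*_ (sym (ι≡ (+ q)))
          (trans (seq-∑ (λ r′ → fromℤ (C r′ i) Real.* (z r′ Real.- fromℤ (b r′))) t)
            (ℚSum.sum-cong-≗ λ r′ → cong₂ _*_ (sym (ι≡ (C r′ i))) (cong (λ y → seq (z r′) t - y) (sym (ι≡ (b r′))))))))

        seq-coefficients : ∀ z l t → seq (coefficients z l) t ≡ (g′ - seq g t) + ∑ℚ λ i → ι (δ (B i) l) * weight (offset z t) i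
        seq-coefficients z l t = cong (λ y → (g′ - seq g t) + y) (trans (seq-∑ (λ i → fromℤ (δ (B i) l) Real.* ω z i) t)
          (ℚSum.sum-cong-≗ λ i → cong₂ _*_ (sym (ι≡ (δ (B i) l))) (seq-ω z i t)))

      -- Every z in the box of radius ε₀ around b is g v + A c with c = `coefficients z`. This
      -- equation holds at each index of the Cauchy sequences; nonnegativity of c is checked only
      -- from an index on where g is at most g′ and z has entered the box.
      cell⊆interior : embed b ∈ int (translate (g · (A *ᵥ 1ᵥ)) (cone A))
      cell⊆interior = fromℚ ε₀ , (½ε₀ , Rational.0<½* 0<ε₀ , 0 , λ _ _ → ½ε₀≤ε₀) , λ z near →
        A *ᵥ coefficients z , (coefficients z , nonNeg z near , λ r → ≃-pointwise {(A *ᵥ coefficients z) r} {(A *ᵥ coefficients z) r} λ _ → refl) ,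
        λ r → ≃-pointwise {z r} {((g · (A *ᵥ 1ᵥ)) ⊕ (A *ᵥ coefficients z)) r} (value-at z r)
        where
        ½ε₀ : ℚ
        ½ε₀ = ℚ.½ * ε₀
        ½ε₀≤ε₀ : 0ℚ + ½ε₀ ≤ ε₀
        ½ε₀≤ε₀ = subst₂ _≤_ (sym (ℚ.+-identityˡ ½ε₀)) (Rational.½*+½* ε₀) (Rational.x≤x+y ½ε₀ (ℚ.<⇒≤ (Rational.0<½* 0<ε₀)))
        nonNeg : ∀ z → (∀ i → (embed b i Real.- fromℚ ε₀) Real.< z i × z i Real.< (embed b i Real.+ fromℚ ε₀)) → NonNegative (coefficients z)
        nonNeg z near l ε 0<ε = T ℕ.⊔ proj₁ small , λ t t≥ → ℚ.≤-trans
          (subst (0ℚ ≤_) (sym (seq-coefficients z l t)) (Rational.0≤+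
            (subst (_≤ g′ - seq g t) (ℚ.+-inverseʳ (seq g t)) (ℚ.+-monoˡ-≤ (- seq g t) (g≤g′ t (ℕ.m⊔n≤o⇒m≤o T (proj₁ small) t≥))))
            (subst (_≤ ∑ℚ (λ i → ι (δ (B i) l) * weight (offset z t) i)) (∑ℚ-zero {m} {λ _ → 0ℚ} λ _ → refl) (∑ℚ-mono λ i → Rational.0≤*
              (subst (_≤ ι (δ (B i) l)) ι-0 (ι-mono (δ-nonNeg (B i) l)))
              (weight≥0 (offset z t) (proj₂ small t (ℕ.m⊔n≤o⇒n≤o T (proj₁ small) t≥)) i)))))
          (Rational.x≤x+y (seq (coefficients z l) t) (ℚ.<⇒≤ 0<ε))
          where
          small : ∃ λ M → ∀ t → M ℕ.≤ t → ∀ r → - ε₀ ≤ offset z t r × offset z t r ≤ ε₀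
          small = eventually-all {m} {λ r t → - ε₀ ≤ offset z t r × offset z t r ≤ ε₀} λ r →
            let ((e , 0<e , M , lo) , (e′ , 0<e′ , M′ , hi)) = near r
            in M ℕ.⊔ M′ , λ t t≥ → lower-bound (seq (z r) t) (b r) e 0<e (lo t (ℕ.m⊔n≤o⇒m≤o M M′ t≥)) ,
                 upper-bound (seq (z r) t) (b r) e′ 0<e′ (hi t (ℕ.m⊔n≤o⇒n≤o M M′ t≥))
            where
            lower-bound : ∀ s b e → 0ℚ < e → (b ℚ./ 1 - ε₀) + e ≤ s → - ε₀ ≤ s - ι b
            lower-bound s b e 0<e le = subst (_≤ s - ι b) (solve 2 (λ b ε → b :- ε :- b := :- ε) refl (ι b) ε₀)
              (ℚ.+-monoˡ-≤ (- ι b) (ℚ.≤-trans (Rational.x≤x+y (ι b - ε₀) (ℚ.<⇒≤ 0<e)) (subst (λ y → (y - ε₀) + e ≤ s) (sym (ι≡ b)) le)))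
            upper-bound : ∀ s b e → 0ℚ < e → s + e ≤ b ℚ./ 1 + ε₀ → s - ι b ≤ ε₀
            upper-bound s b e 0<e le = subst (s - ι b ≤_) (solve 2 (λ b ε → b :+ ε :- b := ε) refl (ι b) ε₀)
              (ℚ.+-monoˡ-≤ (- ι b) (ℚ.≤-trans (Rational.x≤x+y s (ℚ.<⇒≤ 0<e)) (subst (λ y → s + e ≤ y + ε₀) (sym (ι≡ b)) le)))
        value-at : ∀ z r t → seq (z r) t ≡ seq (((g · (A *ᵥ 1ᵥ)) ⊕ (A *ᵥ coefficients z)) r) t
        value-at z r t = sym (begin
          seq g t * seq ((A *ᵥ 1ᵥ) r) t + seq ((A *ᵥ coefficients z) r) t
            ≡⟨ cong₂ (λ v s → seq g t * v + s)
                 (trans (seq-*ᵥ A 1ᵥ r t) (trans (ℚSum.sum-cong-≗ λ l → ℚ.*-identityʳ (ι (A r l))) (sym (ι-∑ (A r)))))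
                 (trans (seq-*ᵥ A (coefficients z) r t) (trans (ℚSum.sum-cong-≗ λ l → cong (ι (A r l) *_) (seq-coefficients z l t))
                   (trans (row-value (A r) B (g′ - seq g t) (weight x)) (cong (λ s → (g′ - seq g t) * V + s) (weight-value x r))))) ⟩
          seq g t * V + ((g′ - seq g t) * V + (ι (b r) - g′ * V + (seq (z r) t - ι (b r))))
            ≡⟨ solve 5 (λ g V g′ b z → g :* V :+ ((g′ :- g) :* V :+ (b :- g′ :* V :+ (z :- b))) := z) refl (seq g t) V g′ (ι (b r)) (seq (z r) t) ⟩
          seq (z r) t ∎)
          where
          open ≡-Reasoning
          V : ℚ
          V = ι (∑ℤ (A r))
          x : Fin m → ℚ
          x = offset z t

-- The counting bound in integers, for boxes and for simplices.

module IntegerBound where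

  open Determinant
  open Minors
  open Estimates
  open PointedMatrix
  open CoordinateBound
  open MinorRatio
  open LatticePoints
  open CellSolutions
  open import Defs using (Matrix; det; gram; ∑ℤ; maxMinor; minMinor; columnChoices)
  open import Data.Integer using (∣_∣)
  import Data.Integer.Tactic.RingSolver as ℤSolver
  open import Data.List using (length)
  open import Data.Nat
  open import Data.Nat.Properties
  open import Data.Nat.Tactic.RingSolver using (solve-∀)
  import Algebra.Properties.Semiring.Sum ℤ.+-*-semiring as ℤSum
  import Algebra.Properties.CommutativeMonoid.Sum +-0-commutativeMonoid as ℕSum

  pos-sum : ∀ {n} (f : Vector ℕ n) → + ℕSum.sum f ≡ ∑ℤ (+_ ∘ f)
  pos-sum {zero}  f = refl
  pos-sum {suc n} f = cong (λ z → + f zero ℤ.+ z) (pos-sum (f ∘ suc))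

  det-1×1 : (M : Matrix ℤ 1 1) → Det M ≡ M zero zero
  det-1×1 M = trans (det-row-expansion M) (trans
    (cong (λ d → 1ℤ ℤ.* M zero zero ℤ.* d ℤ.+ 0ℤ) (Det-empty _)) (eq (M zero zero)))
    where
    eq : ∀ x → 1ℤ ℤ.* x ℤ.* 1ℤ ℤ.+ 0ℤ ≡ x
    eq = ℤSolver.solve-∀

  signOf : ℤ → ℤ
  signOf (+ _)    = 1ℤ
  signOf -[1+ _ ] = -1ℤ

  same-sign : ∀ x y → x ≢ 0ℤ → + ∣ y ∣ ℤ.* x ℤ.+ + ∣ x ∣ ℤ.* y ≢ 0ℤ → + ∣ y ∣ ≡ signOf x ℤ.* y
  same-sign (+ zero)  y          x≢0 _   = contradiction refl x≢0
  same-sign (+ suc a) (+ b)      _   _   = sym (ℤ.*-identityˡ (+ b))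
  same-sign (+ suc a) -[1+ b ]   _   ≢0  = contradiction (eq (+ suc b) (+ suc a)) ≢0
    where
    eq : ∀ c d → c ℤ.* d ℤ.+ d ℤ.* ℤ.- c ≡ 0ℤ
    eq = ℤSolver.solve-∀
  same-sign -[1+ a ]  (+ b)      _   ≢0  = contradiction (eq (+ b) (+ suc a)) ≢0
    where
    eq : ∀ c d → c ℤ.* ℤ.- d ℤ.+ d ℤ.* c ≡ 0ℤ
    eq = ℤSolver.solve-∀
  same-sign -[1+ a ]  -[1+ b ]   _   _   = sym (ℤ.-1*i≡-i -[1+ b ])

  module _ {m n k} (A : Matrix ℤ m n) (B : Fin m → Fin n) (N : Fin k → Fin n) (part : IsPartition B N)
           (E : ℕ) (E≡ : absMinor A B ≡ E) (q α : ℕ) where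

    open Fibres A B N part E E≡ q α

    SolvableCells : ℕ → Set
    SolvableCells s = ∀ b → InCell b → ∃ λ (f : Fin s → Vector ℤ n) → Injective _≡_ _≗_ f × ∀ i → Solution b (f i)

    ∣∣-injective : ∀ {T} (h : Fin T → Vector ℤ n) → Injective _≡_ _≗_ (λ i → h i ∘ N) → (∀ i l → 0ℤ ℤ.≤ h i l) →
      Injective _≡_ _≗_ (λ i j → ∣ h i (N j) ∣)
    ∣∣-injective h h-inj h≥0 {i} {i′} eq = h-inj λ j →
      trans (sym (ℤ.0≤i⇒+∣i∣≡i (h≥0 i (N j)))) (trans (cong +_ (eq j)) (ℤ.0≤i⇒+∣i∣≡i (h≥0 i′ (N j))))

  box-case : ∀ {m′ n k} → n ≡ suc (k + m′) → (A : Matrix ℤ (suc m′) n) → Pointed A → 0 < minMinor A →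
    ∀ B (N : Fin k → Fin n) (part : IsPartition B N) E (E≡ : absMinor A B ≡ E) q α s → 0 < E * q →
    SolvableCells A B N part E E≡ q α s →
    s * E * (q * minMinor A) ^ k ≤ ((α + q) * (k * maxMinor A + minMinor A)) ^ k
  box-case {k = k} refl A pointed 0<μ B N part E E≡ q α s 0<Eq solvable = begin
    s * E * (q * μ) ^ k              ≡⟨ cong (_* (q * μ) ^ k) (*-comm s E) ⟩
    E * s * (q * μ) ^ k              ≤⟨ box-count (λ i j → ∣ h i (N j) ∣)
      (∣∣-injective A B N part E E≡ q α h h-inj (λ i → Solution.nonNeg (sol i))) (q * μ) (α * μ + k * (α + q) * M) bound ⟩
    -- The summand `q * μ` accounts for the value 0 of a coordinate, and with it the bound factors.
    (α * μ + k * (α + q) * M + q * μ) ^ k ≡⟨ cong (_^ k) (collect α μ k q M) ⟩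
    ((α + q) * (k * M + μ)) ^ k      ∎
    where
    open ≤-Reasoning
    open Fibres A B N part E E≡ q α
    μ = minMinor A
    M = maxMinor A
    family = solution-family s 0<Eq solvable
    h = proj₁ family
    h-inj : Injective _≡_ _≗_ (λ i → h i ∘ N)
    h-inj = proj₁ (proj₂ family)
    cell = λ i → proj₁ (proj₂ (proj₂ (proj₂ family) i))
    sol = λ i → proj₂ (proj₂ (proj₂ (proj₂ family) i))
    collect : ∀ α μ k q M → α * μ + k * (α + q) * M + q * μ ≡ (α + q) * (k * M + μ)
    collect = solve-∀
    swap : ∀ h q μ → h * (q * μ) ≡ q * h * μ
    swap = solve-∀
    0<E : 0 < E
    0<E = n≢0⇒n>0 λ E≡0 → <-irrefl (sym (cong (_* q) E≡0)) 0<Eq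
    bound : ∀ i j → ∣ h i (N j) ∣ * (q * μ) ≤ α * μ + k * (α + q) * M
    bound i j = ≤-trans (≤-reflexive (swap ∣ h i (N j) ∣ q μ))
      (coordinate-bound A pointed 0<μ B N part E q α 0<E (InCell.Θ (cell i))
        (λ l → ℤ.<⇒≤ (InCell.lower (cell i) l) , InCell.upper (cell i) l) (h i) (Solution.nonNeg (sol i))
        (λ r → trans (cong (+ (E * q) ℤ.*_) (Solution.solves (sol i) r)) (InCell.value (cell i) r)) j)

  -- For m = 1 pointedness forces all entries of A to have the same sign. The single equation A u =
  -- b then bounds a positive weighted sum of all coordinates, so those outside B lie in a simplex
  -- and not merely in a box.
  simplex-case : ∀ {n k} → n ≡ suc k → (A : Matrix ℤ 1 n) → Pointed A → 0 < minMinor A →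
    ∀ B (N : Fin k → Fin n) (part : IsPartition B N) E (E≡ : absMinor A B ≡ E) q α s → 0 < E * q →
    SolvableCells A B N part E E≡ q α s →
    s * E * k ! * (q * minMinor A) ^ k ≤ ((α + q) * (suc k * maxMinor A)) ^ k
  simplex-case {n} {k} n≡1+k A pointed 0<μ B N part E E≡ q α s 0<Eq solvable = let open ≤-Reasoning in begin
    s * E * k ! * (q * μ) ^ k              ≡⟨ regroup s E (k !) ((q * μ) ^ k) ⟩
    k ! * (q * μ) ^ k * (E * s)            ≤⟨ simplex-count (λ i j → ∣ h i (N j) ∣)
      (∣∣-injective A B N part E E≡ q α h h-inj (λ i → Solution.nonNeg (sol i)))
      (λ j → q * w (N j)) (α * V + q * w b₀) (q * μ) (*-mono-< 0<q 0<μ) (λ j → *-monoʳ-≤ q (μ≤w (N j)))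
      (λ i → ℤ.drop‿+≤+ (bound i)) ⟩
    (α * V + q * w b₀ + ℕSum.sum (λ j → q * w (N j))) ^ k  ≡⟨ cong (_^ k) total ⟩
    ((α + q) * V) ^ k                      ≤⟨ ^-monoˡ-≤ k (*-monoʳ-≤ (α + q) V≤) ⟩
    ((α + q) * (suc k * M)) ^ k            ∎
    where
    open Fibres A B N part E E≡ q α
    μ = minMinor A
    M = maxMinor A
    b₀ = B zero
    a : Fin n → ℤ
    a = A zero
    w : Fin n → ℕ
    w l = ∣ a l ∣
    V : ℕ
    V = ℕSum.sum w
    0<E : 0 < E
    0<E = n≢0⇒n>0 λ E≡0 → <-irrefl (sym (cong (_* q) E≡0)) 0<Eq
    0<q : 0 < q
    0<q = n≢0⇒n>0 λ q≡0 → <-irrefl (sym (trans (cong (E *_) q≡0) (*-zeroʳ E))) 0<Eq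
    family = solution-family s 0<Eq solvable
    h = proj₁ family
    h-inj : Injective _≡_ _≗_ (λ i → h i ∘ N)
    h-inj = proj₁ (proj₂ family)
    cell = λ i → proj₁ (proj₂ (proj₂ (proj₂ family) i))
    sol = λ i → proj₂ (proj₂ (proj₂ (proj₂ family) i))
    minor≡ : ∀ l → absMinor A (λ _ → l) ≡ w l
    minor≡ l = cong ∣_∣ (det-1×1 (column A ∘ λ _ → l))
    μ≤w : ∀ l → μ ≤ w l
    μ≤w l = subst (μ ≤_) (minor≡ l) (min≤absMinor A (λ _ → l) λ { {zero} {zero} _ → refl })
    w≤M : ∀ l → w l ≤ M
    w≤M l = subst (_≤ M) (minor≡ l) (absMinor≤max A (λ _ → l))
    a≢0 : ∀ l → a l ≢ 0ℤ
    a≢0 l al≡0 = <-irrefl (sym (cong ∣_∣ al≡0)) (<-≤-trans 0<μ (μ≤w l))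
    σ : ℤ
    σ = signOf (a b₀)
    w≡σa : ∀ l → + w l ≡ σ ℤ.* a l
    -- Entries of opposite sign would satisfy a relation with the positive coefficients |a l| and |a
    -- b₀|.
    w≡σa l = same-sign (a b₀) (a l) (a≢0 b₀) λ rel → positive (relation-not-nonNeg A pointed c z (ℤ.+<+ (<-≤-trans 0<μ (μ≤w l)))
      λ { zero → trans (cong (λ y → + w l ℤ.* a b₀ ℤ.+ y) (ℤ.+-identityʳ (+ w b₀ ℤ.* a l))) rel })
      where
      c : Fin 2 → Fin n
      c = b₀ ∷ λ _ → l
      z : Vector ℤ 2
      z = (+ w l) ∷ λ _ → + w b₀
      positive : (∃ λ i → z i ℤ.< 0ℤ) → _
      positive (zero , ℤ.+<+ ())
      positive (suc zero , ℤ.+<+ ())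
    regroup : ∀ s E f p → s * E * f * p ≡ f * p * (E * s)
    regroup = solve-∀
    split-w : V ≡ w b₀ + ℕSum.sum (w ∘ N)
    split-w = ℤ.+-injective (trans (pos-sum w) (trans (IsPartition.split part (+_ ∘ w))
      (cong₂ ℤ._+_ (ℤ.+-identityʳ (+ w b₀)) (sym (pos-sum (w ∘ N))))))
    sum-q* : ∀ {j} (f : Vector ℕ j) → ℕSum.sum (λ i → q * f i) ≡ q * ℕSum.sum f
    sum-q* {zero}  f = sym (*-zeroʳ q)
    sum-q* {suc j} f = trans (cong (λ z → q * f zero + z) (sum-q* (f ∘ suc))) (sym (*-distribˡ-+ q (f zero) (ℕSum.sum (f ∘ suc))))
    -- The sum of weights added by the simplex count completes the term of the basis column to q V;
    -- this is the 1 in g′ + 1.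
    total : α * V + q * w b₀ + ℕSum.sum (λ j → q * w (N j)) ≡ (α + q) * V
    total = trans (cong (λ y → α * V + q * w b₀ + y) (sum-q* (w ∘ N))) (trans (factor (α * V) q (w b₀) (ℕSum.sum (w ∘ N)))
      (trans (cong (λ y → α * V + q * y) (sym split-w)) (sym (*-distribʳ-+ V α q))))
      where
      factor : ∀ x q y z → x + q * y + q * z ≡ x + q * (y + z)
      factor = solve-∀
    V≤ : V ≤ suc k * M
    V≤ = ≤-trans (bounded w w≤M) (≤-reflexive (cong (_* M) n≡1+k))
      where
      bounded : ∀ {j} (f : Vector ℕ j) → (∀ i → f i ≤ M) → ℕSum.sum f ≤ j * M
      bounded {zero}  f f≤ = z≤n
      bounded {suc j} f f≤ = +-mono-≤ (f≤ zero) (bounded (f ∘ suc) (f≤ ∘ suc))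
    scaled : ∀ i → + (E * q) ℤ.* ∑ℤ (λ l → h i l ℤ.* + w l) ≡ + (E * α) ℤ.* + V ℤ.+ InCell.Θ (cell i) zero ℤ.* + w b₀
    scaled i = begin
      + (E * q) ℤ.* ∑ℤ (λ l → h i l ℤ.* + w l)
        ≡⟨ cong (+ (E * q) ℤ.*_) (trans (ℤSum.sum-cong-≗ λ l → trans (cong (h i l ℤ.*_) (w≡σa l)) (pull (h i l) σ (a l)))
             (sym (ℤSum.*-distribˡ-sum σ λ l → h i l ℤ.* a l))) ⟩
      + (E * q) ℤ.* (σ ℤ.* ∑ℤ (λ l → h i l ℤ.* a l))
        ≡⟨ pull (+ (E * q)) σ (∑ℤ (λ l → h i l ℤ.* a l)) ⟩
      σ ℤ.* (+ (E * q) ℤ.* ∑ℤ (λ l → h i l ℤ.* a l))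
        ≡⟨ cong (σ ℤ.*_) (trans (cong (+ (E * q) ℤ.*_) (Solution.solves (sol i) zero)) (InCell.value (cell i) zero)) ⟩
      σ ℤ.* (+ (E * α) ℤ.* ∑ℤ a ℤ.+ (θ ℤ.* a b₀ ℤ.+ 0ℤ))
        ≡⟨ expand σ (+ (E * α)) (∑ℤ a) θ (a b₀) ⟩
      + (E * α) ℤ.* (σ ℤ.* ∑ℤ a) ℤ.+ θ ℤ.* (σ ℤ.* a b₀)
        ≡⟨ cong₂ (λ x y → + (E * α) ℤ.* x ℤ.+ θ ℤ.* y)
             (trans (ℤSum.*-distribˡ-sum σ a) (trans (ℤSum.sum-cong-≗ λ l → sym (w≡σa l)) (sym (pos-sum w)))) (sym (w≡σa b₀)) ⟩
      + (E * α) ℤ.* + V ℤ.+ θ ℤ.* + w b₀ ∎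
      where
      open ≡-Reasoning
      θ = InCell.Θ (cell i) zero
      pull : ∀ x s y → x ℤ.* (s ℤ.* y) ≡ s ℤ.* (x ℤ.* y)
      pull = ℤSolver.solve-∀
      expand : ∀ s e v θ b → s ℤ.* (e ℤ.* v ℤ.+ (θ ℤ.* b ℤ.+ 0ℤ)) ≡ e ℤ.* (s ℤ.* v) ℤ.+ θ ℤ.* (s ℤ.* b)
      expand = ℤSolver.solve-∀
    bound : ∀ i → + ℕSum.sum (λ j → q * w (N j) * ∣ h i (N j) ∣) ℤ.≤ + (α * V + q * w b₀)
    bound i = ℤ.*-cancelˡ-≤-pos (+ ℕSum.sum (λ j → q * w (N j) * ∣ h i (N j) ∣)) (+ (α * V + q * w b₀)) (+ E) {{ℤ.positive (ℤ.+<+ 0<E)}} (begin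
      + E ℤ.* + ℕSum.sum (λ j → q * w (N j) * ∣ h i (N j) ∣)
        ≡⟨ cong (+ E ℤ.*_) (trans (pos-sum λ j → q * w (N j) * ∣ h i (N j) ∣) (trans (ℤSum.sum-cong-≗ term) (sym (ℤSum.*-distribˡ-sum (+ q) (F ∘ N))))) ⟩
      + E ℤ.* (+ q ℤ.* ∑ℤ (F ∘ N))
        ≡⟨ trans (sym (ℤ.*-assoc (+ E) (+ q) (∑ℤ (F ∘ N)))) (cong (ℤ._* ∑ℤ (F ∘ N)) (sym (ℤ.pos-* E q))) ⟩
      + (E * q) ℤ.* ∑ℤ (F ∘ N)
        ≤⟨ ℤ.*-monoˡ-≤-nonNeg (+ (E * q)) (subst₂ ℤ._≤_ (ℤ.+-identityˡ (∑ℤ (F ∘ N))) (sym (IsPartition.split part F))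
               (ℤ.+-monoˡ-≤ (∑ℤ (F ∘ N)) (∑-nonNeg {f = F ∘ B} λ l → 0≤* (Solution.nonNeg (sol i) (B l)) (ℤ.+≤+ z≤n)))) ⟩
      + (E * q) ℤ.* ∑ℤ F
        ≡⟨ scaled i ⟩
      + (E * α) ℤ.* + V ℤ.+ InCell.Θ (cell i) zero ℤ.* + w b₀
        ≤⟨ ℤ.+-monoʳ-≤ (+ (E * α) ℤ.* + V) (ℤ.*-monoʳ-≤-nonNeg (+ w b₀) (InCell.upper (cell i) zero)) ⟩
      + (E * α) ℤ.* + V ℤ.+ + (E * q) ℤ.* + w b₀
        ≡⟨ trans (cong₂ ℤ._+_ (sym (ℤ.pos-* (E * α) V)) (sym (ℤ.pos-* (E * q) (w b₀)))) (trans (cong +_ (factor E α V q (w b₀))) (ℤ.pos-* E (α * V + q * w b₀))) ⟩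
      + E ℤ.* + (α * V + q * w b₀) ∎)
      where
      open ℤ.≤-Reasoning
      F : Fin n → ℤ
      F l = h i l ℤ.* + w l
      factor : ∀ E α V q w → E * α * V + E * q * w ≡ E * (α * V + q * w)
      factor = solve-∀
      reorder : ∀ q w u → q ℤ.* w ℤ.* u ≡ q ℤ.* (u ℤ.* w)
      reorder = ℤSolver.solve-∀
      term : ∀ j → + (q * w (N j) * ∣ h i (N j) ∣) ≡ + q ℤ.* F (N j)
      term j = trans (ℤ.pos-* (q * w (N j)) ∣ h i (N j) ∣) (trans (cong₂ ℤ._*_ (ℤ.pos-* q (w (N j))) (ℤ.0≤i⇒+∣i∣≡i (Solution.nonNeg (sol i) (N j))))
        (reorder (+ q) (+ w (N j)) (h i (N j))))

  -- The inequality s² det(A Aᵀ) ρ⁴ᵏ (k/n)ᵏ ≤ ((g′ + 1) (k + ρ))²ᵏ for g′ = α / q and ρ = μ / M, cleared of denominators.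
  discriminant-bound : ∀ m′ k (A : Matrix ℤ (suc m′) (suc m′ + suc k)) → Pointed A →
    ∀ B (N : Fin (suc k) → Fin (suc m′ + suc k)) (part : IsPartition B N) (max : absMinor A B ≡ maxMinor A) → 0 < maxMinor A →
    ∀ q α s → 0 < q → SolvableCells A B N part (maxMinor A) max q α s →
    let μ = minMinor A ; M = maxMinor A ; κ = suc k ; e = (α + q) * (κ * M + μ) in
    s * s * ∣ det (gram A) ∣ * (μ * μ * μ * μ * κ * q * q) ^ κ ≤ ((suc m′ + κ) * e * e * M * M) ^ κ
  discriminant-bound m′ k A pointed B N part max 0<M q α s 0<q solvable = by-minimum (minMinor A) refl
    where
    κ = suc k
    M = maxMinor A
    G = ∣ det (gram A) ∣
    Goal : ℕ → Set
    Goal μ = s * s * G * (μ * μ * μ * μ * κ * q * q) ^ κ ≤ ((suc m′ + κ) * ((α + q) * (κ * M + μ)) * ((α + q) * (κ * M + μ)) * M * M) ^ κ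
    0<Mq : 0 < M * q
    0<Mq = *-mono-< 0<M 0<q
    nondegenerate : ∀ m′ (A : Matrix ℤ (suc m′) (suc m′ + suc k)) → Pointed A →
      ∀ B (N : Fin (suc k) → Fin (suc m′ + suc k)) (part : IsPartition B N) (max : absMinor A B ≡ maxMinor A) → 0 < maxMinor A * q →
      SolvableCells A B N part (maxMinor A) max q α s → 0 < minMinor A →
      s * s * ∣ det (gram A) ∣ * (minMinor A * minMinor A * minMinor A * minMinor A * κ * q * q) ^ κ ≤
        ((suc m′ + κ) * ((α + q) * (κ * maxMinor A + minMinor A)) * ((α + q) * (κ * maxMinor A + minMinor A)) * maxMinor A * maxMinor A) ^ κ
    nondegenerate zero A pointed B N part max 0<Mq solvable 0<μ =
      simplex-bound s (∣ det (gram A) ∣) (minMinor A) (maxMinor A) κ q (α + q)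
        (subst (minMinor A ≤_) max (min≤absMinor A B (IsPartition.c-inj part)))
        (subst (λ l → ∣ det (gram A) ∣ ≤ l * (maxMinor A * maxMinor A)) (length-columnChoices-1 (1 + κ)) (∣det-gram∣≤ A))
        (simplex-case refl A pointed 0<μ B N part (maxMinor A) max q α s 0<Mq solvable)
    nondegenerate (suc m″) A pointed B N part max 0<Mq solvable 0<μ =
      box-bound s (∣ det (gram A) ∣) (length (columnChoices (suc (suc m″)) (suc (suc m″) + κ))) (minMinor A) (maxMinor A) κ (suc (suc m″) + κ) q
        ((α + q) * (κ * maxMinor A + minMinor A)) (∣det-gram∣≤ A) (choices-minors-bound A B N part max 0<μ)
        (box-case (cong suc (+-comm (suc m″) κ)) A pointed 0<μ B N part (maxMinor A) max q α s 0<Mq solvable)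
    by-minimum : ∀ μ → minMinor A ≡ μ → Goal (minMinor A)
    -- Without a positive minimum no vertex bound is available, but the left side is then 0.
    by-minimum zero    μ≡0 = subst Goal (sym μ≡0) (≤-trans (≤-reflexive (*-zeroʳ (s * s * G))) z≤n)
    by-minimum (suc _) μ≡  = nondegenerate m′ A pointed B N part max 0<Mq solvable (subst (0 <_) (sym μ≡) (s≤s z≤n))

-- From the integer inequality to rational approximations of the roots.

module RationalBound where

  open Embedding
  open import Defs
  open Rational using (_^_)
  open Real using (ℝ; seq; fromℚ; fromℤ; 0ℝ)
  open import Data.Rational as ℚ using (ℚ; 0ℚ; 1ℚ; ½; _+_; _*_; _-_; -_; _≤_; _<_; _⊔_)
  import Data.Rational.Properties as ℚ
  open import Data.Rational.Solver using (module +-*-Solver)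
  open +-*-Solver using (solve; _:+_; _:*_; _:-_; :-_; _:=_; con)

  ^-distrib-* : ∀ k x y → (x * y) ^ k ≡ x ^ k * y ^ k
  ^-distrib-* zero    x y = refl
  ^-distrib-* (suc k) x y = trans (cong (x * y *_) (^-distrib-* k x y))
    (solve 4 (λ x y p q → x :* y :* (p :* q) := x :* p :* (y :* q)) refl x y (x ^ k) (y ^ k))

  ^-cancel-≤ : ∀ k {x y} → 0ℚ ≤ y → x ^ suc k ≤ y ^ suc k → x ≤ y
  ^-cancel-≤ k {x} {y} 0≤y le with x ℚ.≤? y
  ... | yes x≤y = x≤y
  ... | no  x≰y = contradiction (ℚ.<-≤-trans strict le) (ℚ.<-irrefl refl)
    where
    d = x - y
    0<d : 0ℚ < d
    0<d = subst (_< d) (ℚ.+-inverseʳ y) (ℚ.+-monoˡ-< (- y) (ℚ.≰⇒> x≰y))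
    strict : y ^ suc k < x ^ suc k
    strict = ℚ.<-≤-trans (subst (_< y ^ suc k + d ^ suc k) (ℚ.+-identityʳ (y ^ suc k)) (ℚ.+-monoʳ-< (y ^ suc k) (Rational.0<^ (suc k) 0<d)))
      (subst (λ z → y ^ suc k + d ^ suc k ≤ z ^ suc k) (solve 2 (λ x y → y :+ (x :- y) := x) refl x y)
        (Rational.^-superadditive k 0≤y (ℚ.<⇒≤ 0<d)))

  square-cancel-≤ : ∀ {x y} → 0ℚ ≤ y → x * x ≤ y * y → x ≤ y
  square-cancel-≤ {x} {y} 0≤y le = ^-cancel-≤ 1 0≤y (subst₂ _≤_ (sq x) (sq y) le)
    where
    sq : ∀ x → x * x ≡ x * (x * 1ℚ)
    sq x = cong (x *_) (sym (ℚ.*-identityʳ x))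

  ιℕ : ℕ → ℚ
  ιℕ n = ι (+ n)

  ιℕ-* : ∀ a b → ιℕ (a ℕ.* b) ≡ ιℕ a * ιℕ b
  ιℕ-* a b = trans (cong ι (ℤ.pos-* a b)) (ι-* (+ a) (+ b))

  ιℕ-+ : ∀ a b → ιℕ (a ℕ.+ b) ≡ ιℕ a + ιℕ b
  ιℕ-+ a b = ι-+ (+ a) (+ b)

  ιℕ-^ : ∀ a k → ιℕ (a ℕ.^ k) ≡ ιℕ a ^ k
  ιℕ-^ a zero    = ι-1
  ιℕ-^ a (suc k) = trans (ιℕ-* a (a ℕ.^ k)) (cong (ιℕ a *_) (ιℕ-^ a k))

  ιℕ-mono : ∀ {a b} → a ℕ.≤ b → ιℕ a ≤ ιℕ b
  ιℕ-mono a≤b = ι-mono (ℤ.+≤+ a≤b)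

  0≤ιℕ : ∀ n → 0ℚ ≤ ιℕ n
  0≤ιℕ n = subst (_≤ ιℕ n) ι-0 (ιℕ-mono ℕ.z≤n)

  0<ιℕ : ∀ {n} → 0 ℕ.< n → 0ℚ < ιℕ n
  0<ιℕ {n} 0<n = ℚ.<-≤-trans (ℚ.positive⁻¹ 1ℚ) (subst (_≤ ιℕ n) ι-1 (ιℕ-mono 0<n))

  ιℕ-*³ : ∀ a b c → ιℕ (a ℕ.* b ℕ.* c) ≡ ιℕ a * ιℕ b * ιℕ c
  ιℕ-*³ a b c = trans (ιℕ-* (a ℕ.* b) c) (cong (_* ιℕ c) (ιℕ-* a b))

  *-cancelʳ-≤ : ∀ {x y c} → 0ℚ < c → x * c ≤ y * c → x ≤ y
  *-cancelʳ-≤ {c = c} 0<c = ℚ.*-cancelʳ-≤-pos c {{ℚ.positive 0<c}}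

  -- `r₁` and `r₂` stand for the κ-th roots of s and √G, `r₃` and `w` for √η and √G, all rounded
  -- down. They occur on the smaller side, so their upper bounds suffice. Squaring both sides and
  -- then taking κ-th powers brings in the integer inequality, and c clears the denominators n, M⁴
  -- and q².
  power-product-bound : ∀ k n s G μ M q α {ρ η g′ r₁ r₂ r₃ w} → let κ = suc k ; e = (α ℕ.+ q) ℕ.* (κ ℕ.* M ℕ.+ μ) in
    0 ℕ.< n → 0 ℕ.< M → 0 ℕ.< q → ρ * ιℕ M ≡ ιℕ μ → η * ιℕ n ≡ ιℕ κ → g′ * ιℕ q ≡ ιℕ α →
    0ℚ ≤ ρ → 0ℚ ≤ g′ → 0ℚ ≤ r₁ → 0ℚ ≤ r₂ → 0ℚ ≤ r₃ → 0ℚ ≤ w →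
    r₁ ^ κ ≤ ιℕ s → r₂ ^ κ ≤ w → w * w ≤ ιℕ G → r₃ * r₃ ≤ η →
    s ℕ.* s ℕ.* G ℕ.* (μ ℕ.* μ ℕ.* μ ℕ.* μ ℕ.* κ ℕ.* q ℕ.* q) ℕ.^ κ ℕ.≤ (n ℕ.* e ℕ.* e ℕ.* M ℕ.* M) ℕ.^ κ →
    r₁ * r₂ * (ρ * ρ) * r₃ ≤ (g′ + 1ℚ) * (ιℕ κ + ρ)
  power-product-bound k n s G μ M q α {ρ} {η} {g′} {r₁} {r₂} {r₃} {w} 0<n 0<M 0<q ρM≡μ ηn≡κ g′q≡α 0≤ρ 0≤g′ 0≤r₁ 0≤r₂ 0≤r₃ 0≤w r₁≤ r₂≤ w≤ r₃≤ target =
    square-cancel-≤ 0≤Y (*-cancelʳ-≤ 0<c (^-cancel-≤ k (Rational.0≤* (Rational.0≤* 0≤Y 0≤Y) (ℚ.<⇒≤ 0<c)) (begin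
      (X * X * c) ^ κ
        ≤⟨ Rational.^-mono κ (Rational.0≤* (Rational.0≤* 0≤X 0≤X) (ℚ.<⇒≤ 0<c)) X²c≤ ⟩
      (r₁ * r₁ * (r₂ * r₂) * ιℕ T₁) ^ κ
        ≡⟨ trans (^-distrib-* κ (r₁ * r₁ * (r₂ * r₂)) (ιℕ T₁)) (cong (_* ιℕ T₁ ^ κ) (trans (^-distrib-* κ (r₁ * r₁) (r₂ * r₂))
             (cong₂ _*_ (^-distrib-* κ r₁ r₁) (^-distrib-* κ r₂ r₂)))) ⟩
      r₁ ^ κ * r₁ ^ κ * (r₂ ^ κ * r₂ ^ κ) * ιℕ T₁ ^ κ
        ≤⟨ ℚ.*-monoʳ-≤-nonNeg (ιℕ T₁ ^ κ) {{ℚ.nonNegative (Rational.0≤^ κ (0≤ιℕ T₁))}}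
             (Rational.*-mono (Rational.0≤* (Rational.0≤^ κ 0≤r₁) (Rational.0≤^ κ 0≤r₁)) (0≤ιℕ G)
               (Rational.*-mono (Rational.0≤^ κ 0≤r₁) (0≤ιℕ s) r₁≤ r₁≤)
               (ℚ.≤-trans (Rational.*-mono (Rational.0≤^ κ 0≤r₂) 0≤w r₂≤ r₂≤) w≤)) ⟩
      ιℕ s * ιℕ s * ιℕ G * ιℕ T₁ ^ κ
        ≡⟨ trans (ιℕ-* (s ℕ.* s ℕ.* G) (T₁ ℕ.^ κ)) (cong₂ _*_ (ιℕ-*³ s s G) (ιℕ-^ T₁ κ)) ⟨
      ιℕ (s ℕ.* s ℕ.* G ℕ.* T₁ ℕ.^ κ)
        ≤⟨ ιℕ-mono target ⟩
      ιℕ (T₂ ℕ.^ κ)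
        ≡⟨ ιℕ-^ T₂ κ ⟩
      ιℕ T₂ ^ κ
        ≡⟨ cong (_^ κ) Y²c≡ ⟨
      (Y * Y * c) ^ κ
        ∎)))
    where
    open ℚ.≤-Reasoning
    κ e T₁ T₂ : ℕ
    κ = suc k
    e = (α ℕ.+ q) ℕ.* (κ ℕ.* M ℕ.+ μ)
    T₁ = μ ℕ.* μ ℕ.* μ ℕ.* μ ℕ.* κ ℕ.* q ℕ.* q
    T₂ = n ℕ.* e ℕ.* e ℕ.* M ℕ.* M
    X Y c : ℚ
    X = r₁ * r₂ * (ρ * ρ) * r₃
    Y = (g′ + 1ℚ) * (ιℕ κ + ρ)
    c = ιℕ n * (ιℕ M * ιℕ M * ιℕ M * ιℕ M) * (ιℕ q * ιℕ q)
    0≤X : 0ℚ ≤ X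
    0≤X = Rational.0≤* (Rational.0≤* (Rational.0≤* 0≤r₁ 0≤r₂) (Rational.0≤* 0≤ρ 0≤ρ)) 0≤r₃
    0≤Y : 0ℚ ≤ Y
    0≤Y = Rational.0≤* (Rational.0≤+ 0≤g′ Rational.0≤1) (Rational.0≤+ (0≤ιℕ κ) 0≤ρ)
    0<M⁴ : 0ℚ < ιℕ M * ιℕ M * ιℕ M * ιℕ M
    0<M⁴ = Rational.0<* (Rational.0<* (Rational.0<* (0<ιℕ 0<M) (0<ιℕ 0<M)) (0<ιℕ 0<M)) (0<ιℕ 0<M)
    0<c : 0ℚ < c
    0<c = Rational.0<* (Rational.0<* (0<ιℕ 0<n) 0<M⁴) (Rational.0<* (0<ιℕ 0<q) (0<ιℕ 0<q))
    T₁≡ : ιℕ T₁ ≡ ιℕ μ * ιℕ μ * ιℕ μ * ιℕ μ * ιℕ κ * ιℕ q * ιℕ q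
    T₁≡ = trans (ιℕ-*³ (μ ℕ.* μ ℕ.* μ ℕ.* μ ℕ.* κ) q q) (cong (λ z → z * ιℕ q * ιℕ q) (trans (ιℕ-*³ (μ ℕ.* μ ℕ.* μ) μ κ)
      (cong (λ z → z * ιℕ μ * ιℕ κ) (ιℕ-*³ μ μ μ))))
    X²c≤ : X * X * c ≤ r₁ * r₁ * (r₂ * r₂) * ιℕ T₁
    X²c≤ = begin
      X * X * c
        ≡⟨ solve 5 (λ a b r p c → (a :* b :* (p :* p) :* r) :* (a :* b :* (p :* p) :* r) :* c :=
                                  (a :* a :* (b :* b) :* (p :* p :* p :* p) :* c) :* (r :* r)) refl r₁ r₂ r₃ ρ c ⟩
      r₁ * r₁ * (r₂ * r₂) * (ρ * ρ * ρ * ρ) * c * (r₃ * r₃)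
        ≤⟨ ℚ.*-monoˡ-≤-nonNeg (r₁ * r₁ * (r₂ * r₂) * (ρ * ρ * ρ * ρ) * c) {{ℚ.nonNegative (Rational.0≤* (Rational.0≤*
             (Rational.0≤* (Rational.0≤* 0≤r₁ 0≤r₁) (Rational.0≤* 0≤r₂ 0≤r₂))
             (Rational.0≤* (Rational.0≤* (Rational.0≤* 0≤ρ 0≤ρ) 0≤ρ) 0≤ρ)) (ℚ.<⇒≤ 0<c))}} r₃≤ ⟩
      r₁ * r₁ * (r₂ * r₂) * (ρ * ρ * ρ * ρ) * c * η
        ≡⟨ solve 6 (λ R p n M q h → R :* (p :* p :* p :* p) :* (n :* (M :* M :* M :* M) :* (q :* q)) :* h :=
                                      R :* ((p :* M) :* (p :* M) :* (p :* M) :* (p :* M) :* (h :* n) :* q :* q)) refl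
             (r₁ * r₁ * (r₂ * r₂)) ρ (ιℕ n) (ιℕ M) (ιℕ q) η ⟩
      r₁ * r₁ * (r₂ * r₂) * ((ρ * ιℕ M) * (ρ * ιℕ M) * (ρ * ιℕ M) * (ρ * ιℕ M) * (η * ιℕ n) * ιℕ q * ιℕ q)
        ≡⟨ cong₂ (λ m h → r₁ * r₁ * (r₂ * r₂) * (m * m * m * m * h * ιℕ q * ιℕ q)) ρM≡μ ηn≡κ ⟩
      r₁ * r₁ * (r₂ * r₂) * (ιℕ μ * ιℕ μ * ιℕ μ * ιℕ μ * ιℕ κ * ιℕ q * ιℕ q)
        ≡⟨ cong (r₁ * r₁ * (r₂ * r₂) *_) T₁≡ ⟨
      r₁ * r₁ * (r₂ * r₂) * ιℕ T₁ ∎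
    e≡ : ιℕ e ≡ (g′ * ιℕ q + ιℕ q) * (ιℕ κ * ιℕ M + ρ * ιℕ M)
    e≡ = trans (ιℕ-* (α ℕ.+ q) (κ ℕ.* M ℕ.+ μ)) (cong₂ _*_ (trans (ιℕ-+ α q) (cong (_+ ιℕ q) (sym g′q≡α)))
      (trans (ιℕ-+ (κ ℕ.* M) μ) (cong₂ _+_ (ιℕ-* κ M) (sym ρM≡μ))))
    Y²c≡ : Y * Y * c ≡ ιℕ T₂
    Y²c≡ = begin-equality
      Y * Y * c
        ≡⟨ solve 6 (λ g k p n M q → (g :+ con 1ℚ) :* (k :+ p) :* ((g :+ con 1ℚ) :* (k :+ p)) :* (n :* (M :* M :* M :* M) :* (q :* q)) :=
             n :* ((g :* q :+ q) :* (k :* M :+ p :* M)) :* ((g :* q :+ q) :* (k :* M :+ p :* M)) :* M :* M) refl g′ (ιℕ κ) ρ (ιℕ n) (ιℕ M) (ιℕ q) ⟩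
      ιℕ n * ((g′ * ιℕ q + ιℕ q) * (ιℕ κ * ιℕ M + ρ * ιℕ M)) * ((g′ * ιℕ q + ιℕ q) * (ιℕ κ * ιℕ M + ρ * ιℕ M)) * ιℕ M * ιℕ M
        ≡⟨ cong (λ z → ιℕ n * z * z * ιℕ M * ιℕ M) e≡ ⟨
      ιℕ n * ιℕ e * ιℕ e * ιℕ M * ιℕ M
        ≡⟨ trans (ιℕ-*³ (n ℕ.* e ℕ.* e) M M) (cong (λ z → z * ιℕ M * ιℕ M) (ιℕ-*³ n e e)) ⟨
      ιℕ T₂ ∎

  -- The origin of the denominator n - m + 1: with κ = n - m, (g′ + 1) (κ + ρ) - κ - 2ρ = g′ (κ + ρ)
  -- - ρ, and 0 ≤ ρ ≤ 1 bounds this by g′ (κ + 1).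
  frobenius-bound : ∀ k {u X ρ g′} → u * ιℕ (suc (suc k)) ≡ 1ℚ → 0ℚ ≤ u → 0ℚ ≤ ρ → ρ ≤ 1ℚ → 0ℚ ≤ g′ →
    X ≤ (g′ + 1ℚ) * (ιℕ (suc k) + ρ) → u * (X - ιℕ (suc k) - ιℕ 2 * ρ) ≤ g′
  frobenius-bound k {u} {X} {ρ} {g′} uκ≡1 0≤u 0≤ρ ρ≤1 0≤g′ X≤ = begin
    u * (X - κ - ιℕ 2 * ρ)
      ≡⟨ cong (λ z → u * (X - κ - z * ρ)) two ⟩
    u * (X - κ - (1ℚ + 1ℚ) * ρ)
      ≤⟨ ℚ.*-monoˡ-≤-nonNeg u {{ℚ.nonNegative 0≤u}} (begin
        X - κ - (1ℚ + 1ℚ) * ρ                            ≤⟨ ℚ.+-monoˡ-≤ (- ((1ℚ + 1ℚ) * ρ)) (ℚ.+-monoˡ-≤ (- κ) X≤) ⟩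
        (g′ + 1ℚ) * (κ + ρ) - κ - (1ℚ + 1ℚ) * ρ          ≡⟨ solve 3 (λ g k p → (g :+ con 1ℚ) :* (k :+ p) :- k :- (con 1ℚ :+ con 1ℚ) :* p :=
                                                              g :* k :+ g :* p :+ :- p) refl g′ κ ρ ⟩
        g′ * κ + g′ * ρ + - ρ                            ≤⟨ ℚ.+-mono-≤ (ℚ.+-monoʳ-≤ (g′ * κ) (ℚ.*-monoˡ-≤-nonNeg g′ {{ℚ.nonNegative 0≤g′}} ρ≤1))
                                                              (ℚ.neg-antimono-≤ 0≤ρ) ⟩
        g′ * κ + g′ * 1ℚ + - 0ℚ                          ≡⟨ solve 2 (λ g k → g :* k :+ g :* con 1ℚ :+ con 0ℚ := (con 1ℚ :+ k) :* g) refl g′ κ ⟩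
        (1ℚ + κ) * g′                                    ∎) ⟩
    u * ((1ℚ + κ) * g′)
      ≡⟨ ℚ.*-assoc u (1ℚ + κ) g′ ⟨
    u * (1ℚ + κ) * g′
      ≡⟨ cong (λ z → u * z * g′) (trans (cong (_+ κ) (sym ι-1)) (sym (ιℕ-+ 1 (suc k)))) ⟩
    u * ιℕ (suc (suc k)) * g′
      ≡⟨ trans (cong (_* g′) uκ≡1) (ℚ.*-identityˡ g′) ⟩
    g′ ∎
    where
    open ℚ.≤-Reasoning
    κ = ιℕ (suc k)
    two : ιℕ 2 ≡ 1ℚ + 1ℚ
    two = trans (ιℕ-+ 1 1) (cong₂ _+_ ι-1 ι-1)

  nonNeg-⊔0 : ∀ {p} → 0ℚ ≤ p → p ⊔ 0ℚ ≡ p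
  nonNeg-⊔0 = ℚ.p≥q⇒p⊔q≡p

  rational-above : ∀ g → 0ℝ Real.≤ g → ∀ ε → 0ℚ < ε →
    ∃ λ g′ → 0ℚ ≤ g′ × ∃ λ T → (∀ t → T ℕ.≤ t → seq g t ≤ g′) × (∀ t → T ℕ.≤ t → g′ ≤ seq g t + ε)
  rational-above g 0≤g ε 0<ε =
    let (N , close) = Real.cauchy g (½ * ε) (Rational.0<½* 0<ε)
        (N′ , above) = 0≤g ε 0<ε
        -- Late terms of g lie within ε / 2 of `seq g N`, so p is above them by at most ε. The
        -- maximum with 0 makes g′ nonnegative, and 0 ≤ g keeps it within ε as well.
        p = seq g N + ½ * ε
    in p ⊔ 0ℚ , ℚ.p≤q⊔p p 0ℚ , N ℕ.⊔ N′ ,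
       (λ t t≥ → ℚ.≤-trans (Rational.∣-∣≤⇒≤+ {seq g t} {seq g N} (close t N (ℕ.m⊔n≤o⇒m≤o N N′ t≥) ℕ.≤-refl)) (ℚ.p≤p⊔q p 0ℚ)) ,
       λ t t≥ → ℚ.⊔-lub
         (subst (p ≤_) (trans (ℚ.+-assoc (seq g t) (½ * ε) (½ * ε)) (cong (λ z → seq g t + z) (Rational.½*+½* ε)))
           (ℚ.+-monoˡ-≤ (½ * ε) (Rational.∣-∣≤⇒≤+ {seq g N} {seq g t} (close N t ℕ.≤-refl (ℕ.m⊔n≤o⇒m≤o N N′ t≥)))))
         (above t (ℕ.m⊔n≤o⇒n≤o N N′ t≥))

-- The lower bound for g.

open Minors
open PointedMatrix
open Embedding
open InteriorCells
open IntegerBound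
open RationalBound
open import Defs
open import Data.List.Extrema.Nat using (min≤⊤)
import Data.List.Membership.Propositional as List
open import Data.Nat using (_∸_)
open import Data.Nat.Properties using (m<n⇒0<n∸m; m<n⇒n≢0)
open import Data.Rational as ℚ using (ℚ; 0ℚ; 1ℚ; _/_)
import Data.Rational.Properties as ℚ
open import Data.Vec using (lookup)
open import Relation.Unary using (_∈_; _≐_)
open Real

complement : ∀ {m} k c → c List.∈ columnChoices m (m ℕ.+ k) →
  ∃ λ (N : Fin k → Fin (m ℕ.+ k)) → IsPartition (lookup c) N
complement {m} k c c∈ =
  let (k₀ , m+k₀≡m+k , N , part) = partition c c∈
  in subst (λ j → ∃ λ (N : Fin j → Fin (m ℕ.+ k)) → IsPartition (lookup c) N) (ℕ.+-cancelˡ-≡ m k₀ k m+k₀≡m+k) (N , part)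

/-nonNeg : ∀ a n .{{_ : ℕ.NonZero n}} → 0ℚ ℚ.≤ + a / n
/-nonNeg a n = *-cancelʳ-≤ (0<ιℕ (ℕ.>-nonZero⁻¹ n)) (subst₂ ℚ._≤_ (sym (ℚ.*-zeroˡ (ιℕ n))) (sym (/-ι (+ a) n)) (0≤ιℕ a))

i≤∣i∣ : ∀ i → i ℤ.≤ + ℤ.∣ i ∣
i≤∣i∣ (+ i)    = ℤ.≤-refl
i≤∣i∣ -[1+ i ] = ℤ.-≤+

-- At every index the roots are rationals rounded down, so the rational bound holds index by index
-- with g′ on the right, and g′ exceeds the late terms of g by at most ε.
admissible-bound : ∀ m′ k s (A : Matrix ℤ (suc m′) (suc m′ ℕ.+ suc k)) (gcd≡1 : gcdMinors A ≡ 1) → Pointed A →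
  ∀ g → g ∈ Admissible s A →
  let ratio = fromℚ (minorRatio A gcd≡1)
  in fromℚ (+ 1 / suc (suc k)) *
       ( root (suc k) (fromℤ (+ s))
           * root (suc k) (√ fromℤ (det (gram A)))
           * ratio ²
           * √ fromℚ (+ suc k / (suc m′ ℕ.+ suc k))
         - fromℤ (+ suc k)
         - fromℤ (+ 2) * ratio )
     ≤ g
admissible-bound m′ k s A gcd≡1 ptd g (0≤g , int⊆𝓕) ε 0<ε =
  let (g′ , 0≤g′ , T , g≤g′ , g′≤g+ε) = rational-above g 0≤g ε 0<ε
      (α , q , 0<q , g′q≡α) = nonNeg-fraction g′ 0≤g′
  in T , λ t t≥ → ℚ.≤-trans (bound g′ 0≤g′ T g≤g′ α q 0<q g′q≡α t) (g′≤g+ε t t≥)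
  where
  n κ M μ : ℕ
  n = suc m′ ℕ.+ suc k
  κ = suc k
  M = maxMinor A
  μ = minMinor A
  instance
    M≢0 : ℕ.NonZero M
    M≢0 = maxMinor-nonZero A gcd≡1
  0<M : 0 ℕ.< M
  0<M = ℕ.>-nonZero⁻¹ M
  basis : ∃ λ c → c List.∈ columnChoices (suc m′) n × absMinor A (lookup c) ≡ M
  basis = maxMinor-attained A M≢0
  B : Fin (suc m′) → Fin n
  B = lookup (proj₁ basis)
  N : Fin κ → Fin n
  N = proj₁ (complement κ (proj₁ basis) (proj₁ (proj₂ basis)))
  part : IsPartition B N
  part = proj₂ (complement κ (proj₁ basis) (proj₁ (proj₂ basis)))
  max : absMinor A B ≡ M
  max = proj₂ (proj₂ basis)
  ρ η u : ℚ
  ρ = + μ / M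
  η = + κ / n
  u = + 1 / suc κ
  ρ≤1 : ρ ℚ.≤ 1ℚ
  ρ≤1 = *-cancelʳ-≤ (0<ιℕ 0<M) (subst₂ ℚ._≤_ (sym (/-ι (+ μ) M)) (sym (ℚ.*-identityˡ (ιℕ M)))
    (ιℕ-mono (min≤⊤ M (absMinors A))))

  solvable : ∀ g′ T → (∀ t → T ℕ.≤ t → seq g t ℚ.≤ g′) → ∀ α q → 0 ℕ.< q → g′ ℚ.* ιℕ q ≡ ιℕ α →
    SolvableCells A B N part M max q α s
  solvable g′ T g≤g′ α q 0<q g′q≡α b cell =
    let (f , f-inj , f∈) = int⊆𝓕 {b} (Interior.cell⊆interior A B N part M max q α (ℕ.*-mono-< 0<M 0<q) g′ g′q≡α g T g≤g′ b cell)
    in f , f-inj , λ i → let (nonNeg , solves) = integer-point⁻ A b (f i) (f∈ i) in record { nonNeg = nonNeg ; solves = solves }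

  bound : ∀ g′ → 0ℚ ℚ.≤ g′ → ∀ T → (∀ t → T ℕ.≤ t → seq g t ℚ.≤ g′) → ∀ α q → 0 ℕ.< q → g′ ℚ.* ιℕ q ≡ ιℕ α → ∀ t →
    u ℚ.* (proj₁ (rootAt k (fromℤ (+ s)) t) ℚ.* proj₁ (rootAt k (√ fromℤ (det (gram A))) t) ℚ.* (ρ ℚ.* ρ) ℚ.* proj₁ (rootAt 1 (fromℚ η) t)
      ℚ.- (+ κ / 1) ℚ.- (+ 2 / 1) ℚ.* ρ) ℚ.≤ g′
  bound g′ 0≤g′ T g≤g′ α q 0<q g′q≡α t =
    subst₂ (λ x y → u ℚ.* (r₁ ℚ.* r₂ ℚ.* (ρ ℚ.* ρ) ℚ.* r₃ ℚ.- x ℚ.- y ℚ.* ρ) ℚ.≤ g′) (ι≡ (+ κ)) (ι≡ (+ 2))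
      (frobenius-bound k (trans (/-ι (+ 1) (suc κ)) ι-1) (/-nonNeg 1 (suc κ)) (/-nonNeg μ M) ρ≤1 0≤g′
        (power-product-bound k n s ℤ.∣ G ∣ μ M q α (ℕ.s≤s ℕ.z≤n) 0<M 0<q (/-ι (+ μ) M) (/-ι (+ κ) n) g′q≡α
          (/-nonNeg μ M) 0≤g′ (nonNeg R₁) (nonNeg R₂) (nonNeg R₃) (nonNeg W) r₁≤ r₂≤ w≤ r₃≤
          (discriminant-bound m′ k A ptd B N part max 0<M q α s 0<q (solvable g′ T g≤g′ α q 0<q g′q≡α))))
    where
    open Rational
    open IsApproxRoot
    G = det (gram A)
    r₁ = proj₁ (rootAt k (fromℤ (+ s)) t)
    r₂ = proj₁ (rootAt k (√ fromℤ G) t)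
    r₃ = proj₁ (rootAt 1 (fromℚ η) t)
    w = proj₁ (rootAt 1 (fromℤ G) t)
    R₁ = proj₂ (rootAt k (fromℤ (+ s)) t)
    R₂ = proj₂ (rootAt k (√ fromℤ G) t)
    R₃ = proj₂ (rootAt 1 (fromℚ η) t)
    W = proj₂ (rootAt 1 (fromℤ G) t)
    square : ∀ x → x ^ 2 ≡ x ℚ.* x
    square x = cong (x ℚ.*_) (ℚ.*-identityʳ x)
    r₁≤ : r₁ ^ κ ℚ.≤ ιℕ s
    r₁≤ = subst (r₁ ^ κ ℚ.≤_) (trans (cong (ℚ._⊔ 0ℚ) (sym (ι≡ (+ s)))) (nonNeg-⊔0 (0≤ιℕ s))) (lower R₁)
    r₂≤ : r₂ ^ κ ℚ.≤ w
    r₂≤ = subst (r₂ ^ κ ℚ.≤_) (nonNeg-⊔0 (nonNeg W)) (lower R₂)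
    r₃≤ : r₃ ℚ.* r₃ ℚ.≤ η
    r₃≤ = subst₂ ℚ._≤_ (square r₃) (nonNeg-⊔0 (/-nonNeg κ n)) (lower R₃)
    -- The square root is that of max(G, 0), and both G and 0 are at most |G|.
    w≤ : w ℚ.* w ℚ.≤ ιℕ ℤ.∣ G ∣
    w≤ = subst (ℚ._≤ ιℕ ℤ.∣ G ∣) (square w) (ℚ.≤-trans (lower W)
      (ℚ.⊔-lub (subst (ℚ._≤ ιℕ ℤ.∣ G ∣) (ι≡ G) (ι-mono (i≤∣i∣ G))) (0≤ιℕ ℤ.∣ G ∣)))

-- The codimension is a variable here, so that matching m + κ ≡ n with `refl` replaces n; the
-- truncated difference `n ∸ m` would block this.
codimension-bound : ∀ {m n} κ → m ℕ.+ κ ≡ n → .{{κ≢0 : ℕ.NonZero κ}} → .{{n≢0 : ℕ.NonZero n}} → ∀ s → 1 ℕ.≤ m →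
  (A : Matrix ℤ m n) (gcd≡1 : gcdMinors A ≡ 1) → Pointed A → ∀ g → g ∈ Admissible s A →
  let ratio = fromℚ (minorRatio A gcd≡1)
  in fromℚ (+ 1 / suc κ) *
       ( root κ (fromℤ (+ s))
           * root κ (√ fromℤ (det (gram A)))
           * ratio ²
           * √ fromℚ (+ κ / n)
         - fromℤ (+ κ)
         - fromℤ (+ 2) * ratio )
     ≤ g
codimension-bound {suc m′} (suc k) refl s 1≤m = admissible-bound m′ k s

theorem1p3 : (m n s : ℕ) → 1 ℕ.≤ m → (m<n : m ℕ.< n) → 1 ℕ.≤ s →
    (A : Matrix ℤ m n) →
    (gcd≡1 : gcdMinors A ≡ 1) →
    P A (λ _ → 0ℤ) ≐ (λ x → x ≈ 0ᵥ) →
    (g : ℝ) → g ∈ IsDiagonalFrobenius s A →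
    let n-m≢0 = ℕ.>-nonZero (m<n⇒0<n∸m m<n)
        n≢0 = ℕ.≢-nonZero (m<n⇒n≢0 m<n)
        ratio = fromℚ (minorRatio A gcd≡1)
    in fromℚ (+ 1 / suc (n ∸ m)) *
         ( root (n ∸ m) {{n-m≢0}} (fromℤ (+ s))
             * root (n ∸ m) {{n-m≢0}} (√ fromℤ (det (gram A)))
             * ratio ²
             * √ fromℚ ((+ (n ∸ m) / n) {{n≢0}})
           - fromℤ (+ (n ∸ m))
           - fromℤ (+ 2) * ratio )
       ≤ g
theorem1p3 m n s 1≤m m<n 1≤s A gcd≡1 P≐0 g (admissible , _) =
  codimension-bound (n ∸ m) (ℕ.m+[n∸m]≡n (ℕ.<⇒≤ m<n)) {{ℕ.>-nonZero (m<n⇒0<n∸m m<n)}} {{ℕ.≢-nonZero (m<n⇒n≢0 m<n)}}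
    s 1≤m A gcd≡1 (pointed A P≐0) g admissible
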